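{- For each positive integer $n$, place $n^2$ line-queens at random on the $3$-dimensional chessboard with side length $n$. Then, as $n\to\infty$, the expected proportion of safe spaces converges to $$\frac{ -1+9e^2-2e^3}{3e^9}.$$
   Context: The $3$-dimensional board of side length $n$ is the set of spaces $\{1,\dots,n\}^3$. "Placing $n^2$ pieces at random" means that the set of occupied spaces (the board configuration) is chosen uniformly among all $\binom{n^3}{n^2}$ subsets of $n^2$ distinct spaces. A line-queen attacks every space that a line-rook or a line-bishop at the same position would attack. A line-rook attacks every space that agrees with its position in all but one coordinate. A line-bishop at $(a_1,a_2,a_3)$ attacks $(x_1,x_2,x_3)$ if there are two distinct indices $i,j$ with $|x_i-a_i|=|x_j-a_j|$ while the remaining coordinate of the two spaces is equal. A space is safe under a board configuration if it is neither occupied nor attacked by any of the placed pieces. The expected proportion of safe spaces is the expected number of safe spaces divided by $n^3$. -}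

module Defs where

open import Data.Bool.Base using (true; false)
open import Data.Fin.Base using (Fin; toℕ; finToFun)
open import Data.Fin.Properties as Fin using (any?; all?)
open import Data.Fin.Subset using (Subset; inside; outside; _∈_; _∉_; ∣_∣)
open import Data.Fin.Subset.Properties using (_∈?_)
open import Data.Integer.Base as ℤ using (+_)
open import Data.List.Base using (List; []; _∷_; _++_; map; filter; length; allFin)
open import Data.List.Membership.Propositional using () renaming (_∈_ to _∈ˡ_)
open import Data.List.Membership.Propositional.Properties
  using (∈-map⁺; ∈-++⁺ˡ; ∈-++⁺ʳ; ∈-filter⁺)
open import Data.List.Relation.Unary.Any using (here)
open import Data.Nat.Base as ℕ using (ℕ; zero; suc; z≤n; s≤s; _!)
import Data.Nat.Properties as ℕ
open import Data.Nat.ListAction using (sum)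
open import Data.Nat.Tactic.RingSolver using (solve-∀)
open import Data.Product.Base using (Σ; ∃-syntax; _×_; _,_)
open import Data.Rational.Base as ℚ using (ℚ; 0ℚ; 1ℚ; ½; _/_)
import Data.Rational.Properties as ℚ
open import Data.Rational.Solver using (module +-*-Solver)
import Data.Rational.Unnormalised.Base as ℚᵘ
import Data.Rational.Unnormalised.Properties as ℚᵘ
open import Data.Sum.Base using (_⊎_; inj₁; inj₂)
open import Data.Vec.Base using ([]; _∷_)
open import Function.Base using (it)
open import Relation.Binary.PropositionalEquality
  using (_≡_; _≢_; refl; sym; trans; cong; cong₂; subst; subst₂)
open import Relation.Nullary using (¬_; Dec; yes; no; ¬?; contradiction)
open import Relation.Nullary.Decidable using (_×-dec_; _⊎-dec_; _→-dec_)

------------------------------------------------------------------------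
-- The board

-- `finToFun` is a bijection from Fin (n ^ 3) to Fin 3 → Fin n, so a space is
-- its triple of coordinates; coding spaces as a finite type makes `Subset`
-- available for board configurations.
Space : ℕ → Set
Space n = Fin (n ℕ.^ 3)

coord : ∀ n → Space n → Fin 3 → ℕ
coord n s i = suc (toℕ (finToFun {n} {3} s i))

LineRookAttacks : ∀ n → Space n → Space n → Set
LineRookAttacks n a x =
  ∃[ i ] coord n x i ≢ coord n a i × (∀ j → j ≢ i → coord n x j ≡ coord n a j)

LineBishopAttacks : ∀ n → Space n → Space n → Set
LineBishopAttacks n a x =
  ∃[ i ] ∃[ j ] i ≢ j
    × ℕ.∣ coord n x i - coord n a i ∣ ≡ ℕ.∣ coord n x j - coord n a j ∣
    × (∀ k → k ≢ i → k ≢ j → coord n x k ≡ coord n a k)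

LineQueenAttacks : ∀ n → Space n → Space n → Set
LineQueenAttacks n a x = LineRookAttacks n a x ⊎ LineBishopAttacks n a x

Safe : ∀ n → Subset (n ℕ.^ 3) → Space n → Set
Safe n c x = x ∉ c × (∀ a → a ∈ c → ¬ LineQueenAttacks n a x)

lineRookAttacks? : ∀ n (a x : Space n) → Dec (LineRookAttacks n a x)
lineRookAttacks? n a x = any? λ i →
  ¬? (coord n x i ℕ.≟ coord n a i)
  ×-dec all? λ j → ¬? (j Fin.≟ i) →-dec (coord n x j ℕ.≟ coord n a j)

lineBishopAttacks? : ∀ n (a x : Space n) → Dec (LineBishopAttacks n a x)
lineBishopAttacks? n a x = any? λ i → any? λ j →
  ¬? (i Fin.≟ j)
  ×-dec (ℕ.∣ coord n x i - coord n a i ∣ ℕ.≟ ℕ.∣ coord n x j - coord n a j ∣)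
  ×-dec all? λ k → ¬? (k Fin.≟ i) →-dec (¬? (k Fin.≟ j) →-dec
                     (coord n x k ℕ.≟ coord n a k))

lineQueenAttacks? : ∀ n (a x : Space n) → Dec (LineQueenAttacks n a x)
lineQueenAttacks? n a x = lineRookAttacks? n a x ⊎-dec lineBishopAttacks? n a x

safe? : ∀ n (c : Subset (n ℕ.^ 3)) (x : Space n) → Dec (Safe n c x)
safe? n c x =
  ¬? (x ∈? c) ×-dec all? λ a → (a ∈? c) →-dec ¬? (lineQueenAttacks? n a x)

safeCount : ∀ n → Subset (n ℕ.^ 3) → ℕ
safeCount n c = length (filter (safe? n c) (allFin (n ℕ.^ 3)))

------------------------------------------------------------------------
-- Placing n² pieces uniformly at random

subsets : ∀ m → List (Subset m)
subsets zero    = [] ∷ []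
subsets (suc m) = map (outside ∷_) (subsets m) ++ map (inside ∷_) (subsets m)

∈-subsets : ∀ {m} (p : Subset m) → p ∈ˡ subsets m
∈-subsets []                  = here refl
∈-subsets (false ∷ p)         = ∈-++⁺ˡ (∈-map⁺ (outside ∷_) (∈-subsets p))
∈-subsets {suc m} (true ∷ p)  =
  ∈-++⁺ʳ (map (outside ∷_) (subsets m)) (∈-map⁺ (inside ∷_) (∈-subsets p))

configurations : ∀ n → List (Subset (n ℕ.^ 3))
configurations n = filter (λ c → ∣ c ∣ ℕ.≟ n ℕ.^ 2) (subsets (n ℕ.^ 3))

subsetOfSize : ∀ {k m} → k ℕ.≤ m → Σ (Subset m) λ p → ∣ p ∣ ≡ k
subsetOfSize {m = zero}  z≤n = [] , refl
subsetOfSize {m = suc m} z≤n with subsetOfSize {m = m} z≤n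
... | p , eq = outside ∷ p , eq
subsetOfSize (s≤s k≤m) with subsetOfSize k≤m
... | p , eq = inside ∷ p , cong suc eq

configurations≢0 : ∀ n .{{_ : ℕ.NonZero n}} → ℕ.NonZero (length (configurations n))
configurations≢0 n with subsetOfSize (ℕ.^-monoʳ-≤ n {2} {3} (s≤s (s≤s z≤n)))
... | p , ∣p∣≡n² =
  length≢0 (∈-filter⁺ (λ c → ∣ c ∣ ℕ.≟ n ℕ.^ 2) (∈-subsets p) ∣p∣≡n²)
  where
  length≢0 : ∀ {A : Set} {x : A} {xs} → x ∈ˡ xs → ℕ.NonZero (length xs)
  length≢0 {xs = _ ∷ _} _ = _

expectedSafeCount : ∀ n .{{_ : ℕ.NonZero n}} → ℚ
expectedSafeCount n =
  (+ sum (map (safeCount n) (configurations n)) / length (configurations n))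
    {{configurations≢0 n}}

expectedSafeProportion : ∀ n .{{_ : ℕ.NonZero n}} → ℚ
expectedSafeProportion n = expectedSafeCount n ℚ.* (+ 1 / n ℕ.^ 3) {{ℕ.m^n≢0 n 3}}

------------------------------------------------------------------------
-- Real numbers as Cauchy sequences of rationals

Cauchy : (ℕ → ℚ) → Set
Cauchy x = ∀ ε → 0ℚ ℚ.< ε →
  ∃[ N ] ∀ m n → N ℕ.≤ m → N ℕ.≤ n → ℚ.∣ x m ℚ.- x n ∣ ℚ.< ε

record ℝ : Set where
  no-eta-equality
  constructor mkℝ
  field
    seq    : ℕ → ℚ
    cauchy : Cauchy seq

open ℝ public

infix 4 _<_

record _<_ (x y : ℝ) : Set where
  no-eta-equality
  pattern
  constructor mk<
  field
    gap   : ℚ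
    gap>0 : 0ℚ ℚ.< gap
    from  : ℕ
    bound : ∀ n → from ℕ.≤ n → seq x n ℚ.+ gap ℚ.≤ seq y n

private
  module Q where
    open +-*-Solver using (solve; _:+_; :-_; _:=_)

    pos-* : ∀ {p q} → 0ℚ ℚ.< p → 0ℚ ℚ.< q → 0ℚ ℚ.< p ℚ.* q
    pos-* {p} {q} p>0 q>0 = ℚ.positive⁻¹ _
      {{ℚ.pos*pos⇒pos p {{ℚ.positive p>0}} q {{ℚ.positive q>0}}}}

    pos≢0 : ∀ {p} → 0ℚ ℚ.< p → ℚ.NonZero p
    pos≢0 {p} p>0 = ℚ.pos⇒nonZero p {{ℚ.positive p>0}}

    pos-1/ : ∀ {p} (p>0 : 0ℚ ℚ.< p) → 0ℚ ℚ.< (ℚ.1/ p) {{pos≢0 p>0}}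
    pos-1/ {p} p>0 = ℚ.positive⁻¹ _ {{ℚ.1/pos⇒pos p {{ℚ.positive p>0}}}}

    *-mono : ∀ {p q r s} → 0ℚ ℚ.≤ p → 0ℚ ℚ.≤ s → p ℚ.≤ q → r ℚ.≤ s → p ℚ.* r ℚ.≤ q ℚ.* s
    *-mono {p} {q} {r} {s} p≥0 s≥0 p≤q r≤s = ℚ.≤-trans
      (ℚ.*-monoˡ-≤-nonNeg p {{ℚ.nonNegative p≥0}} r≤s)
      (ℚ.*-monoʳ-≤-nonNeg s {{ℚ.nonNegative s≥0}} p≤q)

    +-posʳ : ∀ p {q} → 0ℚ ℚ.≤ q → p ℚ.≤ p ℚ.+ q
    +-posʳ p q≥0 = ℚ.≤-trans (ℚ.≤-reflexive (sym (ℚ.+-identityʳ p))) (ℚ.+-monoʳ-≤ p q≥0)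

    ≤1* : ∀ {p q} → p ℚ.≤ q → p ℚ.≤ 1ℚ ℚ.* q
    ≤1* {p} {q} = subst (p ℚ.≤_) (sym (ℚ.*-identityˡ q))

    a-b+b : ∀ a b → (a ℚ.- b) ℚ.+ b ≡ a
    a-b+b = solve 2 (λ a b → (a :+ (:- b)) :+ b := a) refl

    a≤∣a-b∣+b : ∀ a b → ℚ.∣ a ∣ ℚ.≤ ℚ.∣ a ℚ.- b ∣ ℚ.+ ℚ.∣ b ∣
    a≤∣a-b∣+b a b = subst (ℚ._≤ ℚ.∣ a ℚ.- b ∣ ℚ.+ ℚ.∣ b ∣) (cong ℚ.∣_∣ (a-b+b a b))
      (ℚ.∣p+q∣≤∣p∣+∣q∣ (a ℚ.- b) b)

    swap : ∀ a b → ℚ.∣ a ℚ.- b ∣ ≡ ℚ.∣ b ℚ.- a ∣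
    swap a b = trans (cong ℚ.∣_∣ (solve 2 (λ a b → a :+ (:- b) := :- (b :+ (:- a))) refl a b))
                     (ℚ.∣-p∣≡∣p∣ (b ℚ.- a))

    ≤⇒-≤ : ∀ {a b c} → a ℚ.≤ c ℚ.+ b → a ℚ.- b ℚ.≤ c
    ≤⇒-≤ {a} {b} {c} h = subst (a ℚ.- b ℚ.≤_)
      (solve 2 (λ c b → (c :+ b) :+ (:- b) := c) refl c b) (ℚ.+-monoˡ-≤ (ℚ.- b) h)

    ∣-∣≤ : ∀ {a b c} → a ℚ.≤ c ℚ.+ b → b ℚ.≤ c ℚ.+ a → ℚ.∣ a ℚ.- b ∣ ℚ.≤ c
    ∣-∣≤ {a} {b} {c} h k with ℚ.∣p∣≡p∨∣p∣≡-p (a ℚ.- b)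
    ... | inj₁ eq = subst (ℚ._≤ c) (sym eq) (≤⇒-≤ h)
    ... | inj₂ eq = subst (ℚ._≤ c)
      (sym (trans eq (solve 2 (λ a b → :- (a :+ (:- b)) := b :+ (:- a)) refl a b))) (≤⇒-≤ k)

    ∣∣-∣∣≤ : ∀ a b → ℚ.∣ ℚ.∣ a ∣ ℚ.- ℚ.∣ b ∣ ∣ ℚ.≤ ℚ.∣ a ℚ.- b ∣
    ∣∣-∣∣≤ a b = ∣-∣≤ (a≤∣a-b∣+b a b)
      (subst (λ t → ℚ.∣ b ∣ ℚ.≤ t ℚ.+ ℚ.∣ a ∣) (swap b a) (a≤∣a-b∣+b b a))

  cauchy-by : (x y : ℝ) (z : ℕ → ℚ) (K : ℚ) → 0ℚ ℚ.< K → (N : ℕ) →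
    (∀ m n → N ℕ.≤ m → N ℕ.≤ n →
      ℚ.∣ z m ℚ.- z n ∣ ℚ.≤
        K ℚ.* (ℚ.∣ seq x m ℚ.- seq x n ∣ ℚ.+ ℚ.∣ seq y m ℚ.- seq y n ∣)) →
    Cauchy z
  cauchy-by x y z K K>0 N lip ε ε>0 =
    let instance _ = Q.pos≢0 K>0
        δ     = ½ ℚ.* (ℚ.1/ K ℚ.* ε)
        δ>0   = Q.pos-* {½} (ℚ.positive⁻¹ ½) (Q.pos-* (Q.pos-1/ K>0) ε>0)
        X , f = cauchy x δ δ>0
        Y , g = cauchy y δ δ>0
        M     = N ℕ.+ (X ℕ.+ Y)
    in M , λ m n M≤m M≤n →
      let N≤M = ℕ.m≤m+n N (X ℕ.+ Y)
          X≤M = ℕ.≤-trans (ℕ.m≤m+n X Y) (ℕ.m≤n+m (X ℕ.+ Y) N)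
          Y≤M = ℕ.≤-trans (ℕ.m≤n+m Y X) (ℕ.m≤n+m (X ℕ.+ Y) N)
      in ℚ.≤-<-trans
           (lip m n (ℕ.≤-trans N≤M M≤m) (ℕ.≤-trans N≤M M≤n))
           (subst (K ℚ.* (ℚ.∣ seq x m ℚ.- seq x n ∣ ℚ.+ ℚ.∣ seq y m ℚ.- seq y n ∣) ℚ.<_)
             (K*2δ {{Q.pos≢0 K>0}})
             (ℚ.*-monoʳ-<-pos K {{ℚ.positive K>0}}
               (ℚ.+-mono-< (f m n (ℕ.≤-trans X≤M M≤m) (ℕ.≤-trans X≤M M≤n))
                           (g m n (ℕ.≤-trans Y≤M M≤m) (ℕ.≤-trans Y≤M M≤n)))))
    where
    open +-*-Solver using (solve; _:+_; _:*_; _:=_; con)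
    K*2δ : .{{_ : ℚ.NonZero K}} →
      K ℚ.* (½ ℚ.* (ℚ.1/ K ℚ.* ε) ℚ.+ ½ ℚ.* (ℚ.1/ K ℚ.* ε)) ≡ ε
    K*2δ = trans
      (solve 3 (λ k k⁻¹ ε → k :* (con ½ :* (k⁻¹ :* ε) :+ con ½ :* (k⁻¹ :* ε)) := (k :* k⁻¹) :* ε)
        refl K (ℚ.1/ K) ε)
      (trans (cong (ℚ._* ε) (ℚ.*-inverseʳ K)) (ℚ.*-identityˡ ε))

  eventually-bounded : (x : ℝ) → Σ ℚ λ B → 0ℚ ℚ.< B ×
    ∃[ N ] ∀ n → N ℕ.≤ n → ℚ.∣ seq x n ∣ ℚ.≤ B
  eventually-bounded x =
    let N , f = cauchy x 1ℚ (ℚ.positive⁻¹ 1ℚ)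
    in 1ℚ ℚ.+ ℚ.∣ seq x N ∣
     , ℚ.<-≤-trans (ℚ.positive⁻¹ 1ℚ) (Q.+-posʳ 1ℚ (ℚ.0≤∣p∣ (seq x N)))
     , N
     , λ n N≤n → ℚ.≤-trans (Q.a≤∣a-b∣+b (seq x n) (seq x N))
         (ℚ.+-monoˡ-≤ ℚ.∣ seq x N ∣ (ℚ.<⇒≤ (f n N N≤n ℕ.≤-refl)))

-- The operations are defined by copatterns and ℝ has no eta, so that an applied
-- operation does not unfold and instance search for 0ℝ < ∣ x ∣ᴿ can recognise it.

fromℚ : ℚ → ℝ
fromℚ p .seq _ = p
fromℚ p .cauchy ε ε>0 = 0 , λ _ _ _ _ →
  subst (λ t → ℚ.∣ t ∣ ℚ.< ε) (sym (ℚ.+-inverseʳ p)) ε>0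

fromℕ : ℕ → ℝ
fromℕ n = fromℚ (+ n / 1)

0ℝ 1ℝ : ℝ
0ℝ = fromℕ 0
1ℝ = fromℕ 1

infixl 6 _+_ _-_
infixl 7 _*_ _÷_
infix  8 -_
infixr 9 _^_

_+_ : ℝ → ℝ → ℝ
(x + y) .seq n = seq x n ℚ.+ seq y n
(x + y) .cauchy = cauchy-by x y (λ n → seq x n ℚ.+ seq y n) 1ℚ (ℚ.positive⁻¹ 1ℚ) 0 λ m n _ _ →
  Q.≤1* (subst (ℚ._≤ ℚ.∣ seq x m ℚ.- seq x n ∣ ℚ.+ ℚ.∣ seq y m ℚ.- seq y n ∣)
    (cong ℚ.∣_∣ (rearrange (seq x m) (seq x n) (seq y m) (seq y n)))
    (ℚ.∣p+q∣≤∣p∣+∣q∣ (seq x m ℚ.- seq x n) (seq y m ℚ.- seq y n)))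
  where
  open +-*-Solver using (solve; _:+_; :-_; _:=_)
  rearrange : ∀ a b c d → (a ℚ.- b) ℚ.+ (c ℚ.- d) ≡ (a ℚ.+ c) ℚ.- (b ℚ.+ d)
  rearrange = solve 4 (λ a b c d → (a :+ (:- b)) :+ (c :+ (:- d)) := (a :+ c) :+ (:- (b :+ d))) refl

-_ : ℝ → ℝ
(- x) .seq n = ℚ.- seq x n
(- x) .cauchy = cauchy-by x x (λ n → ℚ.- seq x n) 1ℚ (ℚ.positive⁻¹ 1ℚ) 0 λ m n _ _ →
  Q.≤1* (ℚ.≤-trans
    (ℚ.≤-reflexive (sym
      (trans (Q.swap (seq x m) (seq x n)) (cong ℚ.∣_∣ (rearrange (seq x m) (seq x n))))))
    (Q.+-posʳ _ (ℚ.0≤∣p∣ (seq x m ℚ.- seq x n))))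
  where
  open +-*-Solver using (solve; _:+_; :-_; _:=_)
  rearrange : ∀ a b → b ℚ.- a ≡ (ℚ.- a) ℚ.- (ℚ.- b)
  rearrange = solve 2 (λ a b → b :+ (:- a) := (:- a) :+ (:- (:- b))) refl

_-_ : ℝ → ℝ → ℝ
x - y = x + (- y)

∣_∣ᴿ : ℝ → ℝ
∣ x ∣ᴿ .seq n = ℚ.∣ seq x n ∣
∣ x ∣ᴿ .cauchy = cauchy-by x x (λ n → ℚ.∣ seq x n ∣) 1ℚ (ℚ.positive⁻¹ 1ℚ) 0 λ m n _ _ →
  Q.≤1* (ℚ.≤-trans (Q.∣∣-∣∣≤ (seq x m) (seq x n))
    (Q.+-posʳ _ (ℚ.0≤∣p∣ (seq x m ℚ.- seq x n))))

_*_ : ℝ → ℝ → ℝ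
(x * y) .seq n = seq x n ℚ.* seq y n
(x * y) .cauchy =
  let A , A>0 , M , f = eventually-bounded x
      B , B>0 , N , g = eventually-bounded y
  in cauchy-by x y (λ n → seq x n ℚ.* seq y n) (A ℚ.+ B) (ℚ.+-mono-< A>0 B>0) (M ℕ.+ N) λ m n ≤m ≤n →
    estimate A B (seq x m) (seq x n) (seq y m) (seq y n) (ℚ.<⇒≤ A>0) (ℚ.<⇒≤ B>0)
      (f m (ℕ.≤-trans (ℕ.m≤m+n M N) ≤m)) (g n (ℕ.≤-trans (ℕ.m≤n+m N M) ≤n))
  where
  open +-*-Solver using (solve; _:+_; _:*_; :-_; _:=_)
  estimate : ∀ A B a b c d → 0ℚ ℚ.≤ A → 0ℚ ℚ.≤ B → ℚ.∣ a ∣ ℚ.≤ A → ℚ.∣ d ∣ ℚ.≤ B →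
    ℚ.∣ a ℚ.* c ℚ.- b ℚ.* d ∣ ℚ.≤ (A ℚ.+ B) ℚ.* (ℚ.∣ a ℚ.- b ∣ ℚ.+ ℚ.∣ c ℚ.- d ∣)
  estimate A B a b c d A≥0 B≥0 a≤A d≤B = begin
    ℚ.∣ a ℚ.* c ℚ.- b ℚ.* d ∣
      ≡⟨ cong ℚ.∣_∣ (solve 4 (λ a b c d → a :* c :+ (:- (b :* d)) :=
           a :* (c :+ (:- d)) :+ d :* (a :+ (:- b))) refl a b c d) ⟩
    ℚ.∣ a ℚ.* (c ℚ.- d) ℚ.+ d ℚ.* (a ℚ.- b) ∣
      ≤⟨ ℚ.∣p+q∣≤∣p∣+∣q∣ (a ℚ.* (c ℚ.- d)) (d ℚ.* (a ℚ.- b)) ⟩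
    ℚ.∣ a ℚ.* (c ℚ.- d) ∣ ℚ.+ ℚ.∣ d ℚ.* (a ℚ.- b) ∣
      ≡⟨ cong₂ ℚ._+_ (ℚ.∣p*q∣≡∣p∣*∣q∣ a (c ℚ.- d)) (ℚ.∣p*q∣≡∣p∣*∣q∣ d (a ℚ.- b)) ⟩
    ℚ.∣ a ∣ ℚ.* v ℚ.+ ℚ.∣ d ∣ ℚ.* u
      ≤⟨ ℚ.+-mono-≤ (*u≤ a≤A v≥0) (*u≤ d≤B u≥0) ⟩
    A ℚ.* v ℚ.+ B ℚ.* u
      ≤⟨ Q.+-posʳ _ (ℚ.+-mono-≤ (0≤* A≥0 u≥0) (0≤* B≥0 v≥0)) ⟩
    (A ℚ.* v ℚ.+ B ℚ.* u) ℚ.+ (A ℚ.* u ℚ.+ B ℚ.* v)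
      ≡⟨ solve 4 (λ A B u v → (A :* v :+ B :* u) :+ (A :* u :+ B :* v) :=
           (A :+ B) :* (u :+ v)) refl A B u v ⟩
    (A ℚ.+ B) ℚ.* (u ℚ.+ v) ∎
    where
    open ℚ.≤-Reasoning
    u = ℚ.∣ a ℚ.- b ∣
    v = ℚ.∣ c ℚ.- d ∣
    u≥0 = ℚ.0≤∣p∣ (a ℚ.- b)
    v≥0 = ℚ.0≤∣p∣ (c ℚ.- d)
    *u≤ : ∀ {p q r} → p ℚ.≤ q → 0ℚ ℚ.≤ r → p ℚ.* r ℚ.≤ q ℚ.* r
    *u≤ {r = r} p≤q r≥0 = ℚ.*-monoʳ-≤-nonNeg r {{ℚ.nonNegative r≥0}} p≤q
    0≤* : ∀ {p q} → 0ℚ ℚ.≤ p → 0ℚ ℚ.≤ q → 0ℚ ℚ.≤ p ℚ.* q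
    0≤* {p} {q} p≥0 q≥0 = ℚ.nonNegative⁻¹ _
      {{ℚ.nonNeg*nonNeg⇒nonNeg p {{ℚ.nonNegative p≥0}} q {{ℚ.nonNegative q≥0}}}}

_^_ : ℝ → ℕ → ℝ
x ^ zero  = 1ℝ
x ^ suc n = x * x ^ n

-- A real apart from zero may still have finitely many zero terms; the value
-- of `recip` there does not affect the inverse.
recip : ℚ → ℚ
recip p with p ℚ.≟ 0ℚ
... | yes _  = 0ℚ
... | no p≢0 = (ℚ.1/ p) {{ℚ.≢-nonZero p≢0}}

recip-inverse : ∀ {p} → p ≢ 0ℚ → p ℚ.* recip p ≡ 1ℚ
recip-inverse {p} p≢0 with p ℚ.≟ 0ℚ
... | yes p≡0 = contradiction p≡0 p≢0
... | no p≢0′ = ℚ.*-inverseʳ p {{ℚ.≢-nonZero p≢0′}}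

apart≢0 : ∀ {δ p} → 0ℚ ℚ.< δ → δ ℚ.≤ ℚ.∣ p ∣ → p ≢ 0ℚ
apart≢0 δ>0 δ≤ refl = ℚ.<-irrefl refl (ℚ.<-≤-trans δ>0 δ≤)

∣recip∣≤ : ∀ {δ p} (δ>0 : 0ℚ ℚ.< δ) → δ ℚ.≤ ℚ.∣ p ∣ →
  ℚ.∣ recip p ∣ ℚ.≤ (ℚ.1/ δ) {{Q.pos≢0 δ>0}}
∣recip∣≤ {δ} {p} δ>0 δ≤ = ℚ.*-cancelˡ-≤-pos δ {{ℚ.positive δ>0}} (begin
  δ ℚ.* ℚ.∣ recip p ∣
    ≤⟨ ℚ.*-monoʳ-≤-nonNeg ℚ.∣ recip p ∣ {{ℚ.∣-∣-nonNeg (recip p)}} δ≤ ⟩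
  ℚ.∣ p ∣ ℚ.* ℚ.∣ recip p ∣   ≡⟨ ℚ.∣p*q∣≡∣p∣*∣q∣ p (recip p) ⟨
  ℚ.∣ p ℚ.* recip p ∣         ≡⟨ cong ℚ.∣_∣ (recip-inverse (apart≢0 δ>0 δ≤)) ⟩
  1ℚ                          ≡⟨ ℚ.*-inverseʳ δ {{Q.pos≢0 δ>0}} ⟨
  δ ℚ.* (ℚ.1/ δ) {{Q.pos≢0 δ>0}} ∎)
  where open ℚ.≤-Reasoning

recip-lipschitz : ∀ {δ} (δ>0 : 0ℚ ℚ.< δ) a b → δ ℚ.≤ ℚ.∣ a ∣ → δ ℚ.≤ ℚ.∣ b ∣ →
  let δ⁻¹ = (ℚ.1/ δ) {{Q.pos≢0 δ>0}} in
  ℚ.∣ recip a ℚ.- recip b ∣ ℚ.≤ (δ⁻¹ ℚ.* δ⁻¹) ℚ.* ℚ.∣ a ℚ.- b ∣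
recip-lipschitz {δ} δ>0 a b δ≤a δ≤b = begin
  ℚ.∣ r ℚ.- s ∣                                ≡⟨ cong ℚ.∣_∣ expand ⟩
  ℚ.∣ (r ℚ.* s) ℚ.* (b ℚ.- a) ∣                ≡⟨ ℚ.∣p*q∣≡∣p∣*∣q∣ (r ℚ.* s) (b ℚ.- a) ⟩
  ℚ.∣ r ℚ.* s ∣ ℚ.* ℚ.∣ b ℚ.- a ∣
    ≡⟨ cong₂ ℚ._*_ (ℚ.∣p*q∣≡∣p∣*∣q∣ r s) (Q.swap b a) ⟩
  (ℚ.∣ r ∣ ℚ.* ℚ.∣ s ∣) ℚ.* ℚ.∣ a ℚ.- b ∣
    ≤⟨ ℚ.*-monoʳ-≤-nonNeg _ {{ℚ.∣-∣-nonNeg (a ℚ.- b)}}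
         (Q.*-mono (ℚ.0≤∣p∣ r) (ℚ.<⇒≤ (Q.pos-1/ δ>0)) (∣recip∣≤ δ>0 δ≤a) (∣recip∣≤ δ>0 δ≤b)) ⟩
  _ ∎
  where
  open ℚ.≤-Reasoning
  open +-*-Solver using (solve; _:+_; _:*_; :-_; _:=_)
  r = recip a
  s = recip b
  expand : r ℚ.- s ≡ (r ℚ.* s) ℚ.* (b ℚ.- a)
  expand = trans
    (cong₂ ℚ._-_
      (trans (sym (ℚ.*-identityʳ r)) (cong (r ℚ.*_) (sym (recip-inverse (apart≢0 δ>0 δ≤b)))))
      (trans (sym (ℚ.*-identityʳ s)) (cong (s ℚ.*_) (sym (recip-inverse (apart≢0 δ>0 δ≤a))))))
    (solve 4 (λ r s a b → r :* (b :* s) :+ (:- (s :* (a :* r))) := (r :* s) :* (b :+ (:- a)))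
      refl r s a b)

apart-from : ∀ {x} (p : 0ℝ < ∣ x ∣ᴿ) n → _<_.from p ℕ.≤ n → _<_.gap p ℚ.≤ ℚ.∣ seq x n ∣
apart-from {x} p n ≤n = subst (ℚ._≤ ℚ.∣ seq x n ∣) (ℚ.+-identityˡ _) (_<_.bound p n ≤n)

_⁻¹ : (x : ℝ) {{_ : 0ℝ < ∣ x ∣ᴿ}} → ℝ
(x ⁻¹) .seq n = recip (seq x n)
(_⁻¹ x {{x#0}}) .cauchy =
  let open _<_ x#0
      δ⁻¹  = (ℚ.1/ gap) {{Q.pos≢0 gap>0}}
      K>0  = Q.pos-* (Q.pos-1/ gap>0) (Q.pos-1/ gap>0)
  in cauchy-by x x (λ n → recip (seq x n)) (δ⁻¹ ℚ.* δ⁻¹) K>0 from λ m n ≤m ≤n →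
    ℚ.≤-trans
      (recip-lipschitz gap>0 (seq x m) (seq x n)
        (apart-from {x} x#0 m ≤m) (apart-from {x} x#0 n ≤n))
      (ℚ.*-monoˡ-≤-nonNeg (δ⁻¹ ℚ.* δ⁻¹) {{ℚ.nonNegative (ℚ.<⇒≤ K>0)}}
        (Q.+-posʳ _ (ℚ.0≤∣p∣ (seq x m ℚ.- seq x n))))

_÷_ : (x y : ℝ) {{_ : 0ℝ < ∣ y ∣ᴿ}} → ℝ
x ÷ y = x * y ⁻¹

instance
  fromℚ-apart : ∀ {p} .{{_ : ℚ.NonZero p}} → 0ℝ < ∣ fromℚ p ∣ᴿ
  fromℚ-apart {p} = mk< ℚ.∣ p ∣ ∣p∣>0 0 λ _ _ → ℚ.≤-reflexive (ℚ.+-identityˡ ℚ.∣ p ∣)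
    where
    ∣p∣>0 : 0ℚ ℚ.< ℚ.∣ p ∣
    ∣p∣>0 = ℚ.≰⇒> λ ∣p∣≤0 →
      let p≡0 = ℚ.∣p∣≡0⇒p≡0 p (ℚ.≤-antisym ∣p∣≤0 (ℚ.0≤∣p∣ p))
      in ℕ.≢-nonZero⁻¹ 0 {{subst ℚ.NonZero p≡0 it}} refl

  *-apart : ∀ {x y} {{_ : 0ℝ < ∣ x ∣ᴿ}} {{_ : 0ℝ < ∣ y ∣ᴿ}} → 0ℝ < ∣ x * y ∣ᴿ
  *-apart {x} {y} {{mk< δ δ>0 M f}} {{mk< η η>0 N g}} =
    mk< (δ ℚ.* η) (Q.pos-* δ>0 η>0) (M ℕ.+ N) λ n ≤n →
      subst₂ ℚ._≤_ (sym (ℚ.+-identityˡ _)) (sym (ℚ.∣p*q∣≡∣p∣*∣q∣ (seq x n) (seq y n)))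
        (Q.*-mono (ℚ.<⇒≤ δ>0) (ℚ.0≤∣p∣ (seq y n))
          (apart-from {x} (mk< δ δ>0 M f) n (ℕ.≤-trans (ℕ.m≤m+n M N) ≤n))
          (apart-from {y} (mk< η η>0 N g) n (ℕ.≤-trans (ℕ.m≤n+m N M) ≤n)))

------------------------------------------------------------------------
-- e = Σ 1/k!

expSum : ℕ → ℚ
expSum zero    = 1ℚ
expSum (suc n) = expSum n ℚ.+ (+ 1 / suc n !) {{suc n ℕ.!≢0}}

unitFraction : ℕ → ℚ
unitFraction k = + 1 / suc k

unit-nonNeg : ∀ n .{{_ : ℕ.NonZero n}} → 0ℚ ℚ.≤ + 1 / n
unit-nonNeg n = ℚ.nonNegative⁻¹ _ {{ℚ.normalize-nonNeg 1 n}}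

expSum-mono : ∀ {m n} → m ℕ.≤′ n → expSum m ℚ.≤ expSum n
expSum-mono (ℕ.≤′-reflexive refl) = ℚ.≤-refl
expSum-mono {n = suc n} (ℕ.≤′-step m≤n) = ℚ.≤-trans (expSum-mono m≤n)
  (Q.+-posʳ (expSum n) (unit-nonNeg (suc n !) {{suc n ℕ.!≢0}}))

unit-sum : ∀ n d .{{_ : ℕ.NonZero d}} → suc (suc n) ℕ.* suc n ℕ.≤ d →
  + 1 / d ℚ.+ unitFraction (suc n) ℚ.≤ unitFraction n
unit-sum n d@(suc d-1) h = ℚ.toℚᵘ-cancel-≤ (begin
  ℚ.toℚᵘ (+ 1 / d ℚ.+ unitFraction (suc n))
    ≃⟨ ℚ.toℚᵘ-homo-+ (+ 1 / d) (unitFraction (suc n)) ⟩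
  ℚ.toℚᵘ (+ 1 / d) ℚᵘ.+ ℚ.toℚᵘ (unitFraction (suc n))
    ≃⟨ ℚᵘ.+-cong (ℚ.toℚᵘ-fromℚᵘ (ℚᵘ.mkℚᵘ (+ 1) d-1))
                 (ℚ.toℚᵘ-fromℚᵘ (ℚᵘ.mkℚᵘ (+ 1) (suc n))) ⟩
  ℚᵘ.mkℚᵘ (+ 1) d-1 ℚᵘ.+ ℚᵘ.mkℚᵘ (+ 1) (suc n)
    ≤⟨ ℚᵘ.*≤* (ℤ.+≤+ cross) ⟩
  ℚᵘ.mkℚᵘ (+ 1) n
    ≃⟨ ℚ.toℚᵘ-fromℚᵘ (ℚᵘ.mkℚᵘ (+ 1) n) ⟨
  ℚ.toℚᵘ (unitFraction n) ∎)
  where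
  open ℚᵘ.≤-Reasoning
  left : ∀ n d → (suc (suc n) ℕ.+ 0 ℕ.+ (d ℕ.+ 0)) ℕ.* suc n
    ≡ suc (suc n) ℕ.* suc n ℕ.+ d ℕ.* suc n
  left = solve-∀
  right : ∀ n d → d ℕ.+ d ℕ.* suc n ≡ d ℕ.* suc (suc n) ℕ.+ 0
  right = solve-∀
  cross : (suc (suc n) ℕ.+ 0 ℕ.+ (d ℕ.+ 0)) ℕ.* suc n ℕ.≤ d ℕ.* suc (suc n) ℕ.+ 0
  cross = subst₂ ℕ._≤_ (sym (left n d)) (right n d) (ℕ.+-monoˡ-≤ (d ℕ.* suc n) h)

expSum+unit-step : ∀ n →
  expSum (suc (suc n)) ℚ.+ unitFraction (suc n) ℚ.≤ expSum (suc n) ℚ.+ unitFraction n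
expSum+unit-step n = subst (ℚ._≤ expSum (suc n) ℚ.+ unitFraction n)
  (sym (ℚ.+-assoc (expSum (suc n)) _ (unitFraction (suc n))))
  (ℚ.+-monoʳ-≤ (expSum (suc n))
    (unit-sum n (suc (suc n) !) {{suc (suc n) ℕ.!≢0}}
      (ℕ.*-monoʳ-≤ (suc (suc n)) (ℕ.m≤m*n (suc n) (n !) {{n ℕ.!≢0}}))))

expSum+unit-anti : ∀ {m n} → m ℕ.≤′ n →
  expSum (suc n) ℚ.+ unitFraction n ℚ.≤ expSum (suc m) ℚ.+ unitFraction m
expSum+unit-anti (ℕ.≤′-reflexive refl) = ℚ.≤-refl
expSum+unit-anti {n = suc n} (ℕ.≤′-step m≤n) =
  ℚ.≤-trans (expSum+unit-step n) (expSum+unit-anti m≤n)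

-- For positive ε = p/q in lowest terms, 1/(q+1) < 1/q ≤ ε.
archimedean : ∀ ε → 0ℚ ℚ.< ε → ∃[ k ] unitFraction k ℚ.< ε
archimedean (ℚ.mkℚ (+ zero) zero _) (ℚ.*<* (ℤ.+<+ ()))
archimedean ε@(ℚ.mkℚ ℤ.+[1+ p ] q-1 _) ε>0 = suc q-1 , ℚ.toℚᵘ-cancel-< (begin-strict
  ℚ.toℚᵘ (unitFraction (suc q-1))       ≃⟨ ℚ.toℚᵘ-fromℚᵘ (ℚᵘ.mkℚᵘ (+ 1) (suc q-1)) ⟩
  ℚᵘ.mkℚᵘ (+ 1) (suc q-1)       <⟨ ℚᵘ.*<* (ℤ.+<+ (ℕ.≤-trans
                                     (s≤s (ℕ.≤-reflexive (ℕ.+-identityʳ (suc q-1))))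
                                     (ℕ.m≤m+n (suc (suc q-1)) (p ℕ.* suc (suc q-1))))) ⟩
  ℚᵘ.mkℚᵘ ℤ.+[1+ p ] q-1        ∎)
  where open ℚᵘ.≤-Reasoning
archimedean (ℚ.mkℚ ℤ.-[1+ _ ] _ _) (ℚ.*<* ())

e : ℝ
e .seq = expSum
e .cauchy ε ε>0 =
  let k , unit<ε = archimedean ε ε>0
  in suc k , λ m n k<m k<n → ℚ.≤-<-trans
       (Q.∣-∣≤ (close k<n k<m) (close k<m k<n)) unit<ε
  where
  close : ∀ {k m n} → suc k ℕ.≤ m → suc k ℕ.≤ n →
    expSum n ℚ.≤ unitFraction k ℚ.+ expSum m
  close {k} {m} {suc n} k<m (s≤s k≤n) = begin
    expSum (suc n)                 ≤⟨ Q.+-posʳ _ (unit-nonNeg (suc n)) ⟩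
    expSum (suc n) ℚ.+ unitFraction n      ≤⟨ expSum+unit-anti (ℕ.≤⇒≤′ k≤n) ⟩
    expSum (suc k) ℚ.+ unitFraction k      ≤⟨ ℚ.+-monoˡ-≤ (unitFraction k) (expSum-mono (ℕ.≤⇒≤′ k<m)) ⟩
    expSum m ℚ.+ unitFraction k            ≡⟨ ℚ.+-comm (expSum m) (unitFraction k) ⟩
    unitFraction k ℚ.+ expSum m            ∎
    where open ℚ.≤-Reasoning

instance
  e-apart : 0ℝ < ∣ e ∣ᴿ
  e-apart = mk< 1ℚ (ℚ.positive⁻¹ 1ℚ) 0 λ n _ →
    let 1≤e = expSum-mono {0} {n} (ℕ.≤⇒≤′ z≤n)
    in subst₂ ℚ._≤_ (sym (ℚ.+-identityˡ 1ℚ))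
         (sym (ℚ.0≤p⇒∣p∣≡p (ℚ.≤-trans (ℚ.<⇒≤ (ℚ.positive⁻¹ 1ℚ)) 1≤e))) 1≤e

------------------------------------------------------------------------
-- Limits

infix 3 _⟶_

_⟶_ : (∀ n → .{{ℕ.NonZero n}} → ℝ) → ℝ → Set
x ⟶ L = ∀ ε → 0ℝ < ε → ∃[ N ] ∀ n .{{_ : ℕ.NonZero n}} → N ℕ.≤ n → ∣ x n - L ∣ᴿ < ε

{-# OPTIONS --safe #-}

-- Write h for the distance of a coordinate from the nearer end of its range. A line-queen
-- placed on a space with coordinates x, y, z would attack m spaces, itself included, where
--   m + 5 = 6 n + 2 (min(h x, h y) + min(h x, h z) + min(h y, h z)),
-- and the attack relation is symmetric, so the space is safe with probability
-- C(n³ - m, n²) / C(n³, n²). With u = 1/n and t = 1 - u this is t^(m + 5) + O(u).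
-- Peeling the outer layer off the square and the cube gives linear recurrences with step 2 in n
-- for the double and triple sums of powers of t²; comparing them with the solutions of the
-- differential equations they discretise yields
--   3 u³ Σ t^(m + 5) = τ⁶ (9 τ - 2 - τ³) + O(u),  τ = t^n.
-- Finally τ E lies between 1 - u and 1 for every partial sum E of the series for e with at
-- least n terms, so 1/e may replace τ.

module Submission where

-- A real is a Cauchy sequence of rationals, and the inequality to be met at board size `n` concerns
-- all late indices `j`, with `expSum j` in the place of e. So no real exponential enters: every
-- estimate is rational, with error an explicit and generous multiple of u. The base 1 - u comes
-- from consecutive binomials: asking for one more free space multiplies the probability by 1 -
-- n²/(n³ - m), which is 1 - u up to O(u²) while m = O(n). The shift by 5 is the overcount of the
-- queen's own space, which lies on all six families of lines; moving it into the exponent costs a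
-- factor t⁵ = 1 + O(u), and t^(m + 5) then splits exactly into τ⁶ and a power of t². Peeling avoids
-- counting spaces by layer, where the parity of n would matter: with step 2, the boards of side 0
-- and 1 start both cases. In the scaled variable z = k u the recurrences are Euler steps with local
-- error O(u²); since the factors t² and t⁶ are at most 1, about n/2 such errors add up to O(u).

open import Data.Nat.Base using (nonZero)

-- Finite sums, the cube as three coordinates, and layers of a segment.

module Sums where

  open import Algebra.Bundles using (CommutativeMonoid)
  open import Data.Fin.Base using (Fin; zero; suc; toℕ; fromℕ; inject₁; _↑ˡ_; _↑ʳ_; combine; quotient; remainder; finToFun)
  open import Data.Fin.Patterns using (0F; 1F; 2F)
  open import Data.Fin.Properties using (toℕ-inject₁; toℕ-fromℕ; toℕ<n; remQuot-combine)
  open import Data.Nat.Base as ℕ using (ℕ; zero; suc; _⊓_; _∸_)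
  import Data.Nat.Properties as ℕ
  open import Data.Product.Base using (_,_)
  open import Function.Base using (_∘_)
  open import Relation.Binary.PropositionalEquality as ≡ using (_≡_)
  open import Level using (0ℓ)

  layer : ∀ {n} → Fin n → ℕ
  layer {n} x = toℕ x ⊓ (n ∸ suc (toℕ x))

  -- One new point at each end raises both distances to the ends by one; the truncated subtraction
  -- is harmless because `toℕ x` is below `n`.
  layer-inject₁ : ∀ {n} (x : Fin n) → layer (suc (inject₁ x)) ≡ suc (layer x)
  layer-inject₁ {n} x = ≡.trans
    (≡.cong (λ k → suc k ⊓ (n ∸ k)) (toℕ-inject₁ x))
    (≡.cong (suc (toℕ x) ⊓_) (ℕ.+-∸-assoc 1 (toℕ<n x)))

  layer-fromℕ : ∀ n → layer (suc (fromℕ n)) ≡ 0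
  layer-fromℕ n = ≡.trans
    (≡.cong (λ k → suc k ⊓ (n ∸ k)) (toℕ-fromℕ n))
    (≡.cong (suc n ⊓_) (ℕ.n∸n≡0 n))

  -- Over any commutative monoid, because the same lemmas serve the counts in ℕ and the weighted
  -- sums in ℚ.
  module FiniteSums (M : CommutativeMonoid 0ℓ 0ℓ) where
    open CommutativeMonoid M
    open import Algebra.Properties.CommutativeMonoid.Sum M public
      using (sum-cong-≋; sum-cong-≗; ∑-distrib-+; sum-init-last; sum-replicate-zero) renaming (sum to ∑)
    open import Relation.Binary.Reasoning.Setoid setoid

    ∑-+ : ∀ m {n} (f : Fin (m ℕ.+ n) → Carrier) → ∑ f ≈ ∑ (f ∘ (_↑ˡ n)) ∙ ∑ (f ∘ (m ↑ʳ_))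
    ∑-+ zero    f = sym (identityˡ (∑ f))
    ∑-+ (suc m) f = trans (∙-congˡ (∑-+ m (f ∘ suc))) (sym (assoc _ _ _))

    ∑-combine : ∀ {m n} (f : Fin (m ℕ.* n) → Carrier) → ∑ f ≈ ∑ λ i → ∑ λ j → f (combine {m} i j)
    ∑-combine {zero}      f = refl
    ∑-combine {suc m} {n} f = trans (∑-+ n f) (∙-congˡ (∑-combine {m} (f ∘ (n ↑ʳ_))))

    ∑-quotient-remainder : ∀ {m} n (f : Fin m → Fin n → Carrier) →
      ∑ (λ k → f (quotient n k) (remainder {m} n k)) ≈ ∑ λ i → ∑ λ j → f i j
    ∑-quotient-remainder {m} n f = trans (∑-combine {m} _)
      (sum-cong-≋ λ i → sum-cong-≋ λ j → reflexive (≡.cong (λ (q , r) → f q r) (remQuot-combine i j)))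

    -- `finToFun` reads off coordinates by repeated division, so each coordinate costs one splitting
    -- into quotient and remainder; the index left at the end ranges over a single point.
    ∑-cube : ∀ n (f : Fin n → Fin n → Fin n → Carrier) →
      ∑ {n ℕ.^ 3} (λ a → f (finToFun {n} {3} a 0F) (finToFun {n} {3} a 1F) (finToFun {n} {3} a 2F))
      ≈ ∑ λ i → ∑ λ j → ∑ λ k → f i j k
    ∑-cube n f = begin
      _ ≈⟨ ∑-quotient-remainder {n} (n ℕ.^ 2) (λ i b → f i (quotient (n ℕ.^ 1) b) (quotient (n ℕ.^ 0) (remainder {n} (n ℕ.^ 1) b))) ⟩
      _ ≈⟨ sum-cong-≋ (λ i → ∑-quotient-remainder {n} (n ℕ.^ 1) (λ j c → f i j (quotient (n ℕ.^ 0) c))) ⟩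
      _ ≈⟨ sum-cong-≋ (λ i → sum-cong-≋ (λ j → ∑-quotient-remainder {n} (n ℕ.^ 0) (λ k _ → f i j k))) ⟩
      _ ≈⟨ sum-cong-≋ (λ i → sum-cong-≋ (λ j → sum-cong-≋ (λ k → identityʳ (f i j k)))) ⟩
      _ ∎

    -- The two end points have layer 0, and the inner `n` points form a segment with all layers
    -- raised by one. This is the source of the recurrences with step 2.
    ∑-layer : ∀ n (g : ℕ → Carrier) →
      ∑ {2 ℕ.+ n} (g ∘ layer) ≈ g 0 ∙ (∑ {n} (g ∘ suc ∘ layer) ∙ g 0)
    ∑-layer n g = ∙-congˡ (trans (sum-init-last {n} (g ∘ layer ∘ suc))
      (∙-cong (sum-cong-≋ {n} λ i → reflexive (≡.cong g (layer-inject₁ i)))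
              (reflexive (≡.cong g (layer-fromℕ n)))))

-- Counting subsets of given size that avoid a given set.

module Counting where

  open import Data.Bool.Base using (true; false; if_then_else_)
  open import Data.Fin.Base using (Fin; zero; suc)
  open import Data.Fin.Subset using (Subset; inside; outside; _∈_; ∣_∣)
  open import Data.List.Base using ([]; _∷_; _++_; map; filter; length; allFin; tabulate)
  open import Data.List.Properties using (filter-++; length-++)
  open import Data.Nat.Base
  open import Data.Nat.Combinatorics using (_C_; nCk+nC[k+1]≡[n+1]C[k+1])
  open import Data.Nat.ListAction using () renaming (sum to sumˡ)
  open import Data.Nat.Properties
  open import Data.Product.Base using (_×_; _,_; proj₁; proj₂)
  open import Data.Vec.Base using ([]; _∷_; here; there)
  open import Function.Base using (_∘_; id)
  open import Function.Bundles using (_⇔_; mk⇔; Equivalence)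
  open import Relation.Binary.PropositionalEquality
  open import Relation.Nullary using (¬_; Dec; yes; no; does; ¬?; contradiction)
  open import Relation.Unary using (Pred; Decidable)
  open import Level using (0ℓ)
  open Sums
  open FiniteSums +-0-commutativeMonoid
  open import Defs using (subsets)
  open Equivalence using (to; from)

  𝟙 : ∀ {A : Set} → Dec A → ℕ
  𝟙 a? = if does a? then 1 else 0

  length-filter-∷ : ∀ {A : Set} {P : Pred A 0ℓ} (P? : Decidable P) x xs →
    length (filter P? (x ∷ xs)) ≡ 𝟙 (P? x) + length (filter P? xs)
  length-filter-∷ P? x xs with does (P? x)
  ... | true  = refl
  ... | false = refl

  length-filter-tabulate : ∀ {A : Set} {P : Pred A 0ℓ} (P? : Decidable P) {n} (f : Fin n → A) →
    length (filter P? (tabulate f)) ≡ ∑ (λ i → 𝟙 (P? (f i)))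
  length-filter-tabulate P? {zero}  f = refl
  length-filter-tabulate P? {suc n} f = trans (length-filter-∷ P? (f zero) (tabulate (f ∘ suc)))
    (cong (𝟙 (P? (f zero)) +_) (length-filter-tabulate P? (f ∘ suc)))

  length-filter-map : ∀ {A B : Set} {P : Pred B 0ℓ} (P? : Decidable P) (f : A → B) xs →
    length (filter P? (map f xs)) ≡ length (filter (P? ∘ f) xs)
  length-filter-map P? f []       = refl
  length-filter-map P? f (x ∷ xs) with does (P? (f x))
  ... | true  = cong suc (length-filter-map P? f xs)
  ... | false = length-filter-map P? f xs

  length-filter-none : ∀ {A : Set} {P : Pred A 0ℓ} (P? : Decidable P) → (∀ x → ¬ P x) → ∀ xs →
    length (filter P? xs) ≡ 0
  length-filter-none P? ¬P []       = refl
  length-filter-none P? ¬P (x ∷ xs) with P? x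
  ... | yes Px = contradiction Px (¬P x)
  ... | no _   = length-filter-none P? ¬P xs

  -- Merges the filters for size and for safety into one predicate to which `count-avoiding`
  -- applies.
  length-filter-filter : ∀ {A : Set} {P Q R : Pred A 0ℓ}
    (P? : Decidable P) (Q? : Decidable Q) (R? : Decidable R) → (∀ x → R x ⇔ (P x × Q x)) → ∀ xs →
    length (filter P? (filter Q? xs)) ≡ length (filter R? xs)
  length-filter-filter P? Q? R? eq [] = refl
  length-filter-filter P? Q? R? eq (x ∷ xs) with Q? x | R? x
  ... | no ¬q | yes r = contradiction (proj₂ (to (eq x) r)) ¬q
  ... | no ¬q | no ¬r = length-filter-filter P? Q? R? eq xs
  ... | yes q | r?    with P? x | r?
  ...   | yes p | yes r = cong suc (length-filter-filter P? Q? R? eq xs)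
  ...   | yes p | no ¬r = contradiction (from (eq x) (p , q)) ¬r
  ...   | no ¬p | yes r = contradiction (proj₁ (to (eq x) r)) ¬p
  ...   | no ¬p | no ¬r = length-filter-filter P? Q? R? eq xs

  -- Linearity of expectation before normalising: incidences of configurations and spaces are
  -- counted by columns instead of rows.
  double-counting : ∀ {A : Set} {n} {R : A → Pred (Fin n) 0ℓ} (R? : ∀ x → Decidable (R x)) xs →
    sumˡ (map (λ x → length (filter (R? x) (allFin n))) xs) ≡ ∑ (λ i → length (filter (λ x → R? x i) xs))
  double-counting {n = n} R? [] = sym (sum-replicate-zero n)
  double-counting {n = n} R? (x ∷ xs) = begin
    length (filter (R? x) (allFin n)) + sumˡ (map (λ x → length (filter (R? x) (allFin n))) xs)
      ≡⟨ cong₂ _+_ (length-filter-tabulate (R? x) id) (double-counting R? xs) ⟩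
    ∑ (λ i → 𝟙 (R? x i)) + ∑ (λ i → length (filter (λ x → R? x i) xs))
      ≡⟨ ∑-distrib-+ (λ i → 𝟙 (R? x i)) (λ i → length (filter (λ x → R? x i) xs)) ⟨
    ∑ (λ i → 𝟙 (R? x i) + length (filter (λ x → R? x i) xs))
      ≡⟨ sum-cong-≗ (λ i → length-filter-∷ (λ x → R? x i) x xs) ⟨
    ∑ (λ i → length (filter (λ x → R? x i) (x ∷ xs))) ∎
    where open ≡-Reasoning

  Avoids : ∀ {n} → Pred (Fin n) 0ℓ → Subset n → Set
  Avoids B c = ∀ i → i ∈ c → ¬ B i

  -- Pascal's rule along the first element: a subset omits it, or contains it, which requires that
  -- `B` fails there and that `k` is positive. `P` is arbitrary up to equivalence so that the
  -- induction can specialise it to subsets with a prescribed head.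
  count-avoiding : ∀ {n} {B : Pred (Fin n) 0ℓ} (B? : Decidable B) k
    {P : Pred (Subset n) 0ℓ} (P? : Decidable P) →
    (∀ c → P c ⇔ (∣ c ∣ ≡ k × Avoids B c)) →
    length (filter P? (subsets n)) ≡ ∑ (λ i → 𝟙 (¬? (B? i))) C k
  count-avoiding {zero} B? zero P? eq with P? []
  ... | yes _ = refl
  ... | no ¬p = contradiction (from (eq []) (refl , λ ())) ¬p
  count-avoiding {zero} B? (suc k) P? eq with P? []
  ... | yes p = contradiction (proj₁ (to (eq []) p)) λ ()
  ... | no _  = refl
  count-avoiding {suc n} {B} B? k {P} P? eq = begin
    length (filter P? (map (outside ∷_) ss ++ map (inside ∷_) ss))
      ≡⟨ cong length (filter-++ P? (map (outside ∷_) ss) (map (inside ∷_) ss)) ⟩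
    length (filter P? (map (outside ∷_) ss) ++ filter P? (map (inside ∷_) ss))
      ≡⟨ length-++ (filter P? (map (outside ∷_) ss)) ⟩
    length (filter P? (map (outside ∷_) ss)) + length (filter P? (map (inside ∷_) ss))
      ≡⟨ cong₂ _+_ (length-filter-map P? (outside ∷_) ss) (length-filter-map P? (inside ∷_) ss) ⟩
    length (filter (P? ∘ (outside ∷_)) ss) + length (filter (P? ∘ (inside ∷_)) ss)
      ≡⟨ cong (_+ length (filter (P? ∘ (inside ∷_)) ss)) (count-avoiding (B? ∘ suc) k (P? ∘ (outside ∷_)) eq-outside) ⟩
    X C k + length (filter (P? ∘ (inside ∷_)) ss)
      ≡⟨ insides k eq (B? zero) ⟩
    (𝟙 (¬? (B? zero)) + X) C k ∎
    where
    open ≡-Reasoning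
    ss = subsets n
    X  = ∑ (λ i → 𝟙 (¬? (B? (suc i))))
    eq-outside : ∀ c → P (outside ∷ c) ⇔ (∣ c ∣ ≡ k × Avoids (B ∘ suc) c)
    eq-outside c = mk⇔
      (λ p → let size , avoids = to (eq (outside ∷ c)) p in size , λ i i∈c → avoids (suc i) (there i∈c))
      (λ (size , avoids) → from (eq (outside ∷ c)) (size , λ { (suc i) (there i∈c) → avoids i i∈c }))
    insides : ∀ k → (∀ c → P c ⇔ (∣ c ∣ ≡ k × Avoids B c)) → (b? : Dec (B zero)) →
      X C k + length (filter (P? ∘ (inside ∷_)) ss) ≡ (𝟙 (¬? b?) + X) C k
    insides k eq (yes b) = trans
      (cong (X C k +_) (length-filter-none (P? ∘ (inside ∷_))
        (λ c p → proj₂ (to (eq (inside ∷ c)) p) zero here b) ss))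
      (+-identityʳ (X C k))
    insides zero eq (no ¬b) = cong (1 +_) (length-filter-none (P? ∘ (inside ∷_))
        (λ c p → contradiction (proj₁ (to (eq (inside ∷ c)) p)) λ ()) ss)
    insides (suc k) eq (no ¬b) = trans
      (cong (X C suc k +_) (count-avoiding (B? ∘ suc) k (P? ∘ (inside ∷_)) λ c → mk⇔
        (λ p → let size , avoids = to (eq (inside ∷ c)) p in
          suc-injective size , λ i i∈c → avoids (suc i) (there i∈c))
        (λ (size , avoids) → from (eq (inside ∷ c))
          (cong suc size , λ { zero _ → ¬b ; (suc i) (there i∈c) → avoids i i∈c }))))
      (trans (+-comm (X C suc k) (X C k)) (nCk+nC[k+1]≡[n+1]C[k+1] X k))

  -- Absorption: both sides count subsets of size k + 1 in n + 1 elements with one of their elements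
  -- marked.
  [1+n]*nCk≡[1+k]*[1+n]C[1+k] : ∀ n k → suc n * (n C k) ≡ suc k * (suc n C suc k)
  [1+n]*nCk≡[1+k]*[1+n]C[1+k] zero    zero    = refl
  [1+n]*nCk≡[1+k]*[1+n]C[1+k] zero    (suc k) = sym (*-zeroʳ k)
  [1+n]*nCk≡[1+k]*[1+n]C[1+k] (suc n) zero    = begin
    suc (suc n) * 1             ≡⟨ *-identityʳ _ ⟩
    suc (suc n)                 ≡⟨ cong suc (trans (sym (*-identityʳ (suc n))) ([1+n]*nCk≡[1+k]*[1+n]C[1+k] n 0)) ⟩
    suc (1 * (suc n C 1))       ≡⟨ cong suc (*-identityˡ (suc n C 1)) ⟩
    suc (suc n C 1)             ≡⟨ nCk+nC[k+1]≡[n+1]C[k+1] (suc n) 0 ⟩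
    suc (suc n) C 1             ≡⟨ *-identityˡ _ ⟨
    1 * (suc (suc n) C 1)       ∎
    where open ≡-Reasoning
  [1+n]*nCk≡[1+k]*[1+n]C[1+k] (suc n) (suc k) = begin
    suc (suc n) * (suc n C suc k)
      ≡⟨ cong (suc n C suc k +_) (cong (suc n *_) (nCk+nC[k+1]≡[n+1]C[k+1] n k)) ⟨
    suc n C suc k + suc n * (n C k + n C suc k)
      ≡⟨ cong (suc n C suc k +_) (*-distribˡ-+ (suc n) (n C k) (n C suc k)) ⟩
    suc n C suc k + (suc n * (n C k) + suc n * (n C suc k))
      ≡⟨ cong (suc n C suc k +_) (cong₂ _+_ ([1+n]*nCk≡[1+k]*[1+n]C[1+k] n k) ([1+n]*nCk≡[1+k]*[1+n]C[1+k] n (suc k))) ⟩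
    suc n C suc k + (suc k * (suc n C suc k) + suc (suc k) * (suc n C suc (suc k)))
      ≡⟨ +-assoc (suc n C suc k) _ _ ⟨
    suc (suc k) * (suc n C suc k) + suc (suc k) * (suc n C suc (suc k))
      ≡⟨ *-distribˡ-+ (suc (suc k)) (suc n C suc k) _ ⟨
    suc (suc k) * (suc n C suc k + suc n C suc (suc k))
      ≡⟨ cong (suc (suc k) *_) (nCk+nC[k+1]≡[n+1]C[k+1] (suc n) (suc k)) ⟩
    suc (suc k) * (suc (suc n) C suc (suc k)) ∎
    where open ≡-Reasoning

  -- The ratio C(n, k) / C(n + 1, k) = 1 - k / (n + 1) without subtraction or division: the factor
  -- by which one more forbidden space lowers the number of placements.
  [1+n]*nCk+k*[1+n]Ck : ∀ n k → suc n * (n C k) + k * (suc n C k) ≡ suc n * (suc n C k)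
  [1+n]*nCk+k*[1+n]Ck n zero    = +-identityʳ _
  [1+n]*nCk+k*[1+n]Ck n (suc k) = begin
    suc n * (n C suc k) + suc k * (suc n C suc k)
      ≡⟨ cong (suc n * (n C suc k) +_) ([1+n]*nCk≡[1+k]*[1+n]C[1+k] n k) ⟨
    suc n * (n C suc k) + suc n * (n C k)
      ≡⟨ +-comm (suc n * (n C suc k)) _ ⟩
    suc n * (n C k) + suc n * (n C suc k)
      ≡⟨ *-distribˡ-+ (suc n) (n C k) _ ⟨
    suc n * (n C k + n C suc k)
      ≡⟨ cong (suc n *_) (nCk+nC[k+1]≡[n+1]C[k+1] n k) ⟩
    suc n * (suc n C suc k) ∎
    where open ≡-Reasoning

-- The number of spaces attacking a given space.

module Geometry where

  open import Data.Bool.Base using (true; false)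
  open import Data.Empty using (⊥)
  open import Data.Fin.Base using (Fin; zero; suc; toℕ; finToFun)
  open import Data.Fin.Patterns using (0F; 1F; 2F)
  open import Data.Fin.Subset using (Subset; ∣_∣)
  open import Data.Fin.Properties using (toℕ<n)
  open import Data.List.Base using (map; filter; length)
  open import Data.Nat.Base
  open import Data.Nat.Combinatorics using (_C_)
  open import Data.Nat.ListAction using () renaming (sum to sumˡ)
  open import Data.Nat.Properties
  open import Data.Nat.Tactic.RingSolver using (solve-∀)
  open import Data.Product.Base using (_×_; _,_; proj₁)
  open import Data.Sum.Base using (_⊎_; inj₁; inj₂)
  open import Function.Base using (_∘_; id)
  open import Function.Bundles using (_⇔_; mk⇔; Equivalence)
  open import Relation.Binary.PropositionalEquality
  open import Relation.Nullary using (Dec; yes; no; contradiction; ¬?)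
  open import Relation.Nullary.Decidable using (_×-dec_; _⊎-dec_)
  open import Algebra.Properties.Semiring.Sum +-*-semiring using (*-distribˡ-sum; *-distribʳ-sum)
  open import Defs
    using (Space; coord; LineQueenAttacks; lineQueenAttacks?; safe?; safeCount; configurations; subsets)
  open Sums
  open Counting
  open FiniteSums +-0-commutativeMonoid
  open Equivalence using (to; from)

  𝟙-cong : ∀ {A B : Set} → A ⇔ B → (a? : Dec A) (b? : Dec B) → 𝟙 a? ≡ 𝟙 b?
  𝟙-cong A⇔B (yes _) (yes _) = refl
  𝟙-cong A⇔B (yes a) (no ¬b) = contradiction (to A⇔B a) ¬b
  𝟙-cong A⇔B (no ¬a) (yes b) = contradiction (from A⇔B b) ¬a
  𝟙-cong A⇔B (no _)  (no _)  = refl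

  -- Sums over distances to a point of a segment

  ∑< : ℕ → (ℕ → ℕ) → ℕ
  ∑< n φ = ∑ {n} (φ ∘ toℕ)

  ∑<-last : ∀ n φ → ∑< (suc n) φ ≡ ∑< n φ + φ n
  ∑<-last zero    φ = +-comm (φ 0) 0
  ∑<-last (suc n) φ = trans (cong (φ 0 +_) (∑<-last n (φ ∘ suc))) (sym (+-assoc (φ 0) _ _))

  -- The point `x` cuts the segment into two arms, and along each the distance runs once through 1,
  -- 2, and so on.
  ∑-distance : ∀ {n} (x : Fin n) φ →
    ∑ {n} (λ a → φ ∣ toℕ x - toℕ a ∣) ≡ φ 0 + ∑< (toℕ x) (φ ∘ suc) + ∑< (n ∸ suc (toℕ x)) (φ ∘ suc)
  ∑-distance {suc n} zero    φ = cong (_+ ∑< n (φ ∘ suc)) (sym (+-identityʳ (φ 0)))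
  ∑-distance {suc n} (suc x) φ = begin
    φ k + ∑ {n} (λ a → φ ∣ toℕ x - toℕ a ∣)
      ≡⟨ cong (φ k +_) (∑-distance x φ) ⟩
    φ k + (φ 0 + ∑< (toℕ x) (φ ∘ suc) + s)
      ≡⟨ rearrange (φ k) (φ 0) (∑< (toℕ x) (φ ∘ suc)) s ⟩
    φ 0 + (∑< (toℕ x) (φ ∘ suc) + φ k) + s
      ≡⟨ cong (λ y → φ 0 + y + s) (∑<-last (toℕ x) (φ ∘ suc)) ⟨
    φ 0 + ∑< k (φ ∘ suc) + s ∎
    where
    open ≡-Reasoning
    k = suc (toℕ x)
    s = ∑< (n ∸ suc (toℕ x)) (φ ∘ suc)
    rearrange : ∀ a b c d → a + (b + c + d) ≡ b + (c + a) + d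
    rearrange = solve-∀

  δ : ℕ → ℕ
  δ d = 𝟙 (d ≟ 0)

  E : ℕ → ℕ → ℕ
  E d d′ = 𝟙 (d ≟ d′)

  ∑-δ : ∀ {n} (x : Fin n) → ∑ {n} (λ a → δ ∣ toℕ x - toℕ a ∣) ≡ 1
  ∑-δ {n} x = trans (∑-distance x δ)
    (cong₂ (λ y z → 1 + y + z) (sum-replicate-zero (toℕ x)) (sum-replicate-zero (n ∸ suc (toℕ x))))

  ∑-E : ∀ p q → ∑< p (λ d → ∑< q (E d)) ≡ p ⊓ q
  ∑-E zero    q       = refl
  ∑-E (suc p) zero    = sum-replicate-zero p
  ∑-E (suc p) (suc q) = cong₂ (λ y z → suc (y + z)) (sum-replicate-zero q) (∑-E p q)

  -- The two diagonals leave the point in four arms, one for each choice of a side in each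
  -- coordinate; an arm is as long as the smaller of its two distances to the border.
  diagonals : ∀ {n} (x y : Fin n) →
    let x̄ = n ∸ suc (toℕ x); ȳ = n ∸ suc (toℕ y) in
    ∑ {n} (λ a → ∑ {n} λ b → E ∣ toℕ x - toℕ a ∣ ∣ toℕ y - toℕ b ∣)
    ≡ suc ((toℕ x ⊓ toℕ y + toℕ x ⊓ ȳ) + (x̄ ⊓ toℕ y + x̄ ⊓ ȳ))
  diagonals {n} x y = begin
    ∑ {n} (λ a → ∑ {n} λ b → E ∣ toℕ x - toℕ a ∣ ∣ toℕ y - toℕ b ∣)
      ≡⟨ sum-cong-≗ {n} (λ a → ∑-distance y (E ∣ toℕ x - toℕ a ∣)) ⟩
    ∑ {n} (λ a → ψ ∣ toℕ x - toℕ a ∣)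
      ≡⟨ ∑-distance x ψ ⟩
    ψ 0 + ∑< (toℕ x) (ψ ∘ suc) + ∑< x̄ (ψ ∘ suc)
      ≡⟨ cong₂ _+_ (cong₂ _+_ ψ₀ (row (toℕ x))) (row x̄) ⟩
    suc (toℕ x ⊓ toℕ y + toℕ x ⊓ ȳ + (x̄ ⊓ toℕ y + x̄ ⊓ ȳ)) ∎
    where
    open ≡-Reasoning
    x̄ = n ∸ suc (toℕ x)
    ȳ = n ∸ suc (toℕ y)
    ψ : ℕ → ℕ
    ψ d = E d 0 + ∑< (toℕ y) (E d ∘ suc) + ∑< ȳ (E d ∘ suc)
    ψ₀ : ψ 0 ≡ 1
    ψ₀ = cong₂ (λ s s′ → 1 + s + s′) (sum-replicate-zero (toℕ y)) (sum-replicate-zero ȳ)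
    row : ∀ p → ∑< p (ψ ∘ suc) ≡ p ⊓ toℕ y + p ⊓ ȳ
    row p = trans (∑-distrib-+ {p} (λ d → ∑< (toℕ y) (E (toℕ d))) (λ d → ∑< ȳ (E (toℕ d))))
      (cong₂ _+_ (∑-E p (toℕ y)) (∑-E p ȳ))

  ⊓-parts : ∀ {m} a b → m ≡ a + b → m ⊓ a + m ⊓ b ≡ m
  ⊓-parts a b refl = cong₂ _+_ (m≥n⇒m⊓n≡n (m≤m+n a b)) (m≥n⇒m⊓n≡n (m≤n+m b a))

  parts-⊓ : ∀ {m} a b → m ≡ a + b → a ⊓ m + b ⊓ m ≡ a + b
  parts-⊓ a b refl = cong₂ _+_ (m≤n⇒m⊓n≡m (m≤m+n a b)) (m≤n⇒m⊓n≡m (m≤n+m b a))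

  -- Lowering all four distances by one takes 4 from either side, so the induction runs until one of
  -- them is 0; there the two surviving arms make up the whole common sum.
  minima : ∀ x x̄ y ȳ → x + x̄ ≡ y + ȳ →
    (x ⊓ y + x ⊓ ȳ) + (x̄ ⊓ y + x̄ ⊓ ȳ) ≡ x + x̄ + 2 * ((x ⊓ x̄) ⊓ (y ⊓ ȳ))
  minima zero x̄ y ȳ eq = trans (⊓-parts y ȳ eq) (sym (+-identityʳ x̄))
  minima (suc x) zero y ȳ eq = trans (+-identityʳ _) (trans
    (⊓-parts y ȳ (trans (sym (+-identityʳ (suc x))) eq))
    (sym (trans (+-identityʳ _) (+-identityʳ (suc x)))))
  minima (suc x) (suc x̄) zero ȳ eq = trans (parts-⊓ (suc x) (suc x̄) (sym eq)) (sym (+-identityʳ _))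
  minima (suc x) (suc x̄) (suc y) zero eq = trans
    (cong₂ _+_ (+-identityʳ (suc x ⊓ suc y)) (+-identityʳ (suc x̄ ⊓ suc y))) (trans
    (parts-⊓ (suc x) (suc x̄) (trans (sym (+-identityʳ (suc y))) (sym eq))) (sym (+-identityʳ _)))
  minima (suc x) (suc x̄) (suc y) (suc ȳ) eq = begin
    (suc (x ⊓ y) + suc (x ⊓ ȳ)) + (suc (x̄ ⊓ y) + suc (x̄ ⊓ ȳ))
      ≡⟨ pull (x ⊓ y) (x ⊓ ȳ) (x̄ ⊓ y) (x̄ ⊓ ȳ) ⟩
    4 + ((x ⊓ y + x ⊓ ȳ) + (x̄ ⊓ y + x̄ ⊓ ȳ))
      ≡⟨ cong (4 +_) (minima x x̄ y ȳ (suc-injective (trans (sym (+-suc x x̄)) (trans (suc-injective eq) (+-suc y ȳ))))) ⟩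
    4 + (x + x̄ + 2 * ((x ⊓ x̄) ⊓ (y ⊓ ȳ)))
      ≡⟨ push x x̄ ((x ⊓ x̄) ⊓ (y ⊓ ȳ)) ⟩
    suc x + suc x̄ + 2 * suc ((x ⊓ x̄) ⊓ (y ⊓ ȳ)) ∎
    where
    open ≡-Reasoning
    pull : ∀ a b c d → (suc a + suc b) + (suc c + suc d) ≡ 4 + ((a + b) + (c + d))
    pull = solve-∀
    push : ∀ a b c → 4 + (a + b + 2 * c) ≡ suc a + suc b + 2 * suc c
    push = solve-∀

  diagonals-layer : ∀ {n} (x y : Fin n) →
    ∑ {n} (λ a → ∑ {n} λ b → E ∣ toℕ x - toℕ a ∣ ∣ toℕ y - toℕ b ∣) ≡ n + 2 * (layer x ⊓ layer y)
  diagonals-layer {n} x y = trans (diagonals x y) (trans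
    (cong suc (minima (toℕ x) (n ∸ suc (toℕ x)) (toℕ y) (n ∸ suc (toℕ y))
      (suc-injective (trans (m+[n∸m]≡n (toℕ<n x)) (sym (m+[n∸m]≡n (toℕ<n y)))))))
    (cong (_+ 2 * (layer x ⊓ layer y)) (m+[n∸m]≡n (toℕ<n x))))

  -- Attacks in terms of the three coordinate distances

  -- Three planar pairs of diagonals, then three axes. Stated by distances alone, so that the count
  -- factors into sums over single coordinates.
  Attacked : ℕ → ℕ → ℕ → Set
  Attacked a b c = (a ≡ b × c ≡ 0) ⊎ (a ≡ c × b ≡ 0) ⊎ (b ≡ c × a ≡ 0)
    ⊎ (a ≡ 0 × b ≡ 0) ⊎ (a ≡ 0 × c ≡ 0) ⊎ (b ≡ 0 × c ≡ 0)

  attacked? : ∀ a b c → Dec (Attacked a b c)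
  attacked? a b c = (a ≟ b ×-dec c ≟ 0) ⊎-dec (a ≟ c ×-dec b ≟ 0) ⊎-dec (b ≟ c ×-dec a ≟ 0)
    ⊎-dec (a ≟ 0 ×-dec b ≟ 0) ⊎-dec (a ≟ 0 ×-dec c ≟ 0) ⊎-dec (b ≟ 0 ×-dec c ≟ 0)

  -- The six families of lines through a space meet pairwise only in that space, where all six
  -- indicators are 1; removing 5 there turns their sum into the indicator of the union.
  𝟙-attacked : ∀ a b c → 𝟙 (attacked? a b c) + 5 * (δ a * δ b * δ c)
    ≡ δ a * δ b + δ a * δ c + δ b * δ c + E a b * δ c + E a c * δ b + E b c * δ a
  𝟙-attacked zero    zero    zero    = refl
  𝟙-attacked zero    zero    (suc c) = refl
  𝟙-attacked zero    (suc b) zero    = refl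
  𝟙-attacked (suc a) zero    zero    = refl
  𝟙-attacked zero    (suc b) (suc c) with b ≡ᵇ c
  ... | true  = refl
  ... | false = refl
  𝟙-attacked (suc a) zero    (suc c) with a ≡ᵇ c
  ... | true  = refl
  ... | false = refl
  𝟙-attacked (suc a) (suc b) zero    with a ≡ᵇ b
  ... | true  = refl
  ... | false = refl
  𝟙-attacked (suc a) (suc b) (suc c) with a ≡ᵇ b | a ≡ᵇ c | b ≡ᵇ c
  ... | true  | true  | true  = refl
  ... | true  | true  | false = refl
  ... | true  | false | true  = refl
  ... | true  | false | false = refl
  ... | false | true  | true  = refl
  ... | false | true  | false = refl
  ... | false | false | true  = refl
  ... | false | false | false = refl

  distance : ∀ n → Space n → Space n → Fin 3 → ℕ
  distance n x a i = ∣ toℕ (finToFun {n} {3} x i) - toℕ (finToFun {n} {3} a i) ∣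

  attacks⇔attacked : ∀ n (a x : Space n) →
    LineQueenAttacks n a x ⇔ Attacked (distance n x a 0F) (distance n x a 1F) (distance n x a 2F)
  attacks⇔attacked n a x = mk⇔ ⇒ ⇐
    where
    d = distance n x a
    0⇒≡ : ∀ i → d i ≡ 0 → coord n x i ≡ coord n a i
    0⇒≡ i eq = cong suc (∣m-n∣≡0⇒m≡n eq)
    ≡⇒0 : ∀ i → coord n x i ≡ coord n a i → d i ≡ 0
    ≡⇒0 i eq = m≡n⇒∣m-n∣≡0 (suc-injective eq)
    ⇒ : LineQueenAttacks n a x → Attacked (d 0F) (d 1F) (d 2F)
    ⇒ (inj₁ (0F , _ , eq)) = inj₂ (inj₂ (inj₂ (inj₂ (inj₂ (≡⇒0 1F (eq 1F λ ()) , ≡⇒0 2F (eq 2F λ ()))))))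
    ⇒ (inj₁ (1F , _ , eq)) = inj₂ (inj₂ (inj₂ (inj₂ (inj₁ (≡⇒0 0F (eq 0F λ ()) , ≡⇒0 2F (eq 2F λ ()))))))
    ⇒ (inj₁ (2F , _ , eq)) = inj₂ (inj₂ (inj₂ (inj₁ (≡⇒0 0F (eq 0F λ ()) , ≡⇒0 1F (eq 1F λ ())))))
    ⇒ (inj₂ (0F , 0F , i≢j , _)) = contradiction refl i≢j
    ⇒ (inj₂ (0F , 1F , _ , d≡d , eq)) = inj₁ (d≡d , ≡⇒0 2F (eq 2F (λ ()) λ ()))
    ⇒ (inj₂ (0F , 2F , _ , d≡d , eq)) = inj₂ (inj₁ (d≡d , ≡⇒0 1F (eq 1F (λ ()) λ ())))
    ⇒ (inj₂ (1F , 0F , _ , d≡d , eq)) = inj₁ (sym d≡d , ≡⇒0 2F (eq 2F (λ ()) λ ()))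
    ⇒ (inj₂ (1F , 1F , i≢j , _)) = contradiction refl i≢j
    ⇒ (inj₂ (1F , 2F , _ , d≡d , eq)) = inj₂ (inj₂ (inj₁ (d≡d , ≡⇒0 0F (eq 0F (λ ()) λ ()))))
    ⇒ (inj₂ (2F , 0F , _ , d≡d , eq)) = inj₂ (inj₁ (sym d≡d , ≡⇒0 1F (eq 1F (λ ()) λ ())))
    ⇒ (inj₂ (2F , 1F , _ , d≡d , eq)) = inj₂ (inj₂ (inj₁ (sym d≡d , ≡⇒0 0F (eq 0F (λ ()) λ ()))))
    ⇒ (inj₂ (2F , 2F , i≢j , _)) = contradiction refl i≢j
    bishop₀₁ : d 0F ≡ d 1F → d 2F ≡ 0 → LineQueenAttacks n a x
    bishop₀₁ d≡d z = inj₂ (0F , 1F , (λ ()) , d≡d ,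
      λ { 0F ≢0 _ → contradiction refl ≢0 ; 1F _ ≢1 → contradiction refl ≢1 ; 2F _ _ → 0⇒≡ 2F z })
    bishop₀₂ : d 0F ≡ d 2F → d 1F ≡ 0 → LineQueenAttacks n a x
    bishop₀₂ d≡d z = inj₂ (0F , 2F , (λ ()) , d≡d ,
      λ { 0F ≢0 _ → contradiction refl ≢0 ; 1F _ _ → 0⇒≡ 1F z ; 2F _ ≢2 → contradiction refl ≢2 })
    bishop₁₂ : d 1F ≡ d 2F → d 0F ≡ 0 → LineQueenAttacks n a x
    bishop₁₂ d≡d z = inj₂ (1F , 2F , (λ ()) , d≡d ,
      λ { 0F _ _ → 0⇒≡ 0F z ; 1F ≢1 _ → contradiction refl ≢1 ; 2F _ ≢2 → contradiction refl ≢2 })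
    -- a space counts as attacked by a bishop on it, which covers the case of distance zero
    rook : ∀ i → (d i ≡ 0 → LineQueenAttacks n a x) →
      (∀ j → j ≢ i → coord n x j ≡ coord n a j) → LineQueenAttacks n a x
    rook i bishop eq with d i ≟ 0
    ... | yes z = bishop z
    ... | no ≢0 = inj₁ (i , (λ same → ≢0 (≡⇒0 i same)) , eq)
    ⇐ : Attacked (d 0F) (d 1F) (d 2F) → LineQueenAttacks n a x
    ⇐ (inj₁ (d≡d , z)) = bishop₀₁ d≡d z
    ⇐ (inj₂ (inj₁ (d≡d , z))) = bishop₀₂ d≡d z
    ⇐ (inj₂ (inj₂ (inj₁ (d≡d , z)))) = bishop₁₂ d≡d z
    ⇐ (inj₂ (inj₂ (inj₂ (inj₁ (z₀ , z₁))))) = rook 2F (bishop₀₁ (trans z₀ (sym z₁)))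
      λ { 0F _ → 0⇒≡ 0F z₀ ; 1F _ → 0⇒≡ 1F z₁ ; 2F ≢2 → contradiction refl ≢2 }
    ⇐ (inj₂ (inj₂ (inj₂ (inj₂ (inj₁ (z₀ , z₂)))))) = rook 1F (bishop₀₂ (trans z₀ (sym z₂)))
      λ { 0F _ → 0⇒≡ 0F z₀ ; 1F ≢1 → contradiction refl ≢1 ; 2F _ → 0⇒≡ 2F z₂ }
    ⇐ (inj₂ (inj₂ (inj₂ (inj₂ (inj₂ (z₁ , z₂)))))) = rook 0F (bishop₁₂ (trans z₁ (sym z₂)))
      λ { 0F ≢0 → contradiction refl ≢0 ; 1F _ → 0⇒≡ 1F z₁ ; 2F _ → 0⇒≡ 2F z₂ }

  ∑-const : ∀ n c → ∑ {n} (λ _ → c) ≡ n * c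
  ∑-const zero    c = refl
  ∑-const (suc n) c = cong (c +_) (∑-const n c)

  ∑³ : ∀ {n} → (Fin n → Fin n → Fin n → ℕ) → ℕ
  ∑³ {n} f = ∑ {n} λ i → ∑ {n} λ j → ∑ {n} λ k → f i j k

  ∑³-cong : ∀ {n} {f g : Fin n → Fin n → Fin n → ℕ} → (∀ i j k → f i j k ≡ g i j k) → ∑³ f ≡ ∑³ g
  ∑³-cong {n} eq = sum-cong-≗ {n} λ i → sum-cong-≗ {n} λ j → sum-cong-≗ {n} λ k → eq i j k

  ∑³-+ : ∀ {n} (f g : Fin n → Fin n → Fin n → ℕ) →
    ∑³ (λ i j k → f i j k + g i j k) ≡ ∑³ f + ∑³ g
  ∑³-+ {n} f g = trans
    (sum-cong-≗ {n} λ i → trans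
      (sum-cong-≗ {n} λ j → ∑-distrib-+ {n} (f i j) (g i j))
      (∑-distrib-+ {n} (λ j → ∑ {n} (f i j)) (λ j → ∑ {n} (g i j))))
    (∑-distrib-+ {n} (λ i → ∑ {n} λ j → ∑ {n} (f i j)) (λ i → ∑ {n} λ j → ∑ {n} (g i j)))

  module _ {n} (x y z : Fin n) where
    private
      A B C : Fin n → ℕ
      A i = ∣ toℕ x - toℕ i ∣
      B j = ∣ toℕ y - toℕ j ∣
      C k = ∣ toℕ z - toℕ k ∣

    ∑-*δ : ∀ (w : Fin n) c → ∑ {n} (λ i → c * δ ∣ toℕ w - toℕ i ∣) ≡ c
    ∑-*δ w c = trans (sym (*-distribˡ-sum {n} c (λ i → δ ∣ toℕ w - toℕ i ∣)))
      (trans (cong (c *_) (∑-δ w)) (*-identityʳ c))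

    ∑³-δδδ : ∑³ (λ i j k → δ (A i) * δ (B j) * δ (C k)) ≡ 1
    ∑³-δδδ = trans (sum-cong-≗ {n} λ i → trans (sum-cong-≗ {n} λ j → ∑-*δ z (δ (A i) * δ (B j))) (∑-*δ y (δ (A i)))) (∑-δ x)

    ∑³-δδ₀₁ : ∑³ {n} (λ i j k → δ (A i) * δ (B j)) ≡ n
    ∑³-δδ₀₁ = begin
      ∑ {n} (λ i → ∑ {n} λ j → ∑ {n} λ k → δ (A i) * δ (B j))
        ≡⟨ (sum-cong-≗ {n} λ i → sum-cong-≗ {n} λ j → ∑-const n (δ (A i) * δ (B j))) ⟩
      ∑ {n} (λ i → ∑ {n} λ j → n * (δ (A i) * δ (B j)))
        ≡⟨ (sum-cong-≗ {n} λ i → sum-cong-≗ {n} λ j → *-assoc n (δ (A i)) (δ (B j))) ⟨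
      ∑ {n} (λ i → ∑ {n} λ j → n * δ (A i) * δ (B j))
        ≡⟨ (sum-cong-≗ {n} λ i → ∑-*δ y (n * δ (A i))) ⟩
      ∑ {n} (λ i → n * δ (A i))
        ≡⟨ ∑-*δ x n ⟩
      n ∎
      where open ≡-Reasoning

    ∑³-δδ₀₂ : ∑³ {n} (λ i j k → δ (A i) * δ (C k)) ≡ n
    ∑³-δδ₀₂ = begin
      ∑ {n} (λ i → ∑ {n} λ j → ∑ {n} λ k → δ (A i) * δ (C k))
        ≡⟨ (sum-cong-≗ {n} λ i → sum-cong-≗ {n} λ j → ∑-*δ z (δ (A i))) ⟩
      ∑ {n} (λ i → ∑ {n} λ j → δ (A i))
        ≡⟨ (sum-cong-≗ {n} λ i → ∑-const n (δ (A i))) ⟩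
      ∑ {n} (λ i → n * δ (A i))
        ≡⟨ ∑-*δ x n ⟩
      n ∎
      where open ≡-Reasoning

    ∑³-δδ₁₂ : ∑³ {n} (λ i j k → δ (B j) * δ (C k)) ≡ n
    ∑³-δδ₁₂ = begin
      ∑ {n} (λ i → ∑ {n} λ j → ∑ {n} λ k → δ (B j) * δ (C k))
        ≡⟨ (sum-cong-≗ {n} λ i → sum-cong-≗ {n} λ j → ∑-*δ z (δ (B j))) ⟩
      ∑ {n} (λ i → ∑ {n} λ j → δ (B j))
        ≡⟨ (sum-cong-≗ {n} λ i → ∑-δ y) ⟩
      ∑ {n} (λ i → 1)
        ≡⟨ ∑-const n 1 ⟩
      n * 1
        ≡⟨ *-identityʳ n ⟩
      n ∎
      where open ≡-Reasoning

    ∑³-E₀₁ : ∑³ {n} (λ i j k → E (A i) (B j) * δ (C k)) ≡ n + 2 * (layer x ⊓ layer y)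
    ∑³-E₀₁ = trans (sum-cong-≗ {n} λ i → sum-cong-≗ {n} λ j → ∑-*δ z (E (A i) (B j))) (diagonals-layer x y)

    ∑³-E₀₂ : ∑³ {n} (λ i j k → E (A i) (C k) * δ (B j)) ≡ n + 2 * (layer x ⊓ layer z)
    ∑³-E₀₂ = trans
      (sum-cong-≗ {n} λ i → trans
        (sum-cong-≗ {n} λ j → sym (*-distribʳ-sum {n} (δ (B j)) (λ k → E (A i) (C k))))
        (∑-*δ y (∑ {n} λ k → E (A i) (C k))))
      (diagonals-layer x z)

    ∑³-E₁₂ : ∑³ {n} (λ i j k → E (B j) (C k) * δ (A i)) ≡ n + 2 * (layer y ⊓ layer z)
    ∑³-E₁₂ = trans
      (sum-cong-≗ {n} λ i → trans
        (sum-cong-≗ {n} λ j → sym (*-distribʳ-sum {n} (δ (A i)) (λ k → E (B j) (C k))))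
        (sym (*-distribʳ-sum {n} (δ (A i)) (λ j → ∑ {n} λ k → E (B j) (C k)))))
      (trans (∑-*δ x (∑ {n} λ j → ∑ {n} λ k → E (B j) (C k))) (diagonals-layer y z))

    overlaps : ℕ
    overlaps = layer x ⊓ layer y + layer x ⊓ layer z + layer y ⊓ layer z

    -- Each axis contributes `n` spaces and each pair of diagonals n + 2 h, with h the smaller of
    -- the two layers. The overcount 5 stands on the left to stay within ℕ.
    ∑³-attacked : ∑³ {n} (λ i j k → 𝟙 (attacked? (A i) (B j) (C k))) + 5 ≡ 6 * n + 2 * overlaps
    ∑³-attacked = begin
      ∑³ att + 5
        ≡⟨ cong (λ s → ∑³ att + 5 * s) ∑³-δδδ ⟨
      ∑³ att + 5 * ∑³ δδδ
        ≡⟨ cong (∑³ att +_) (begin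
             5 * ∑³ δδδ
               ≡⟨ *-distribˡ-sum {n} 5 (λ i → ∑ {n} λ j → ∑ {n} λ k → δδδ i j k) ⟩
             ∑ {n} (λ i → 5 * ∑ {n} λ j → ∑ {n} λ k → δδδ i j k)
               ≡⟨ (sum-cong-≗ {n} λ i → *-distribˡ-sum {n} 5 (λ j → ∑ {n} λ k → δδδ i j k)) ⟩
             ∑ {n} (λ i → ∑ {n} λ j → 5 * ∑ {n} λ k → δδδ i j k)
               ≡⟨ (sum-cong-≗ {n} λ i → sum-cong-≗ {n} λ j → *-distribˡ-sum {n} 5 (λ k → δδδ i j k)) ⟩
             ∑³ (λ i j k → 5 * δδδ i j k) ∎) ⟩
      ∑³ att + ∑³ (λ i j k → 5 * δδδ i j k)
        ≡⟨ ∑³-+ att (λ i j k → 5 * δδδ i j k) ⟨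
      ∑³ (λ i j k → att i j k + 5 * δδδ i j k)
        ≡⟨ ∑³-cong (λ i j k → 𝟙-attacked (A i) (B j) (C k)) ⟩
      ∑³ (λ i j k → f₁ i j k + f₂ i j k + f₃ i j k + f₄ i j k + f₅ i j k + f₆ i j k)
        ≡⟨ trans (∑³-+ (λ i j k → f₁ i j k + f₂ i j k + f₃ i j k + f₄ i j k + f₅ i j k) f₆) (cong (_+ ∑³ f₆)
           (trans (∑³-+ (λ i j k → f₁ i j k + f₂ i j k + f₃ i j k + f₄ i j k) f₅) (cong (_+ ∑³ f₅)
           (trans (∑³-+ (λ i j k → f₁ i j k + f₂ i j k + f₃ i j k) f₄) (cong (_+ ∑³ f₄)
           (trans (∑³-+ (λ i j k → f₁ i j k + f₂ i j k) f₃) (cong (_+ ∑³ f₃) (∑³-+ f₁ f₂)))))))) ⟩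
      ∑³ f₁ + ∑³ f₂ + ∑³ f₃ + ∑³ f₄ + ∑³ f₅ + ∑³ f₆
        ≡⟨ cong₂ _+_ (cong₂ _+_ (cong₂ _+_ (cong₂ _+_ (cong₂ _+_ ∑³-δδ₀₁ ∑³-δδ₀₂) ∑³-δδ₁₂) ∑³-E₀₁) ∑³-E₀₂) ∑³-E₁₂ ⟩
      n + n + n + (n + 2 * (layer x ⊓ layer y)) + (n + 2 * (layer x ⊓ layer z)) + (n + 2 * (layer y ⊓ layer z))
        ≡⟨ collect n (layer x ⊓ layer y) (layer x ⊓ layer z) (layer y ⊓ layer z) ⟩
      6 * n + 2 * overlaps ∎
      where
      open ≡-Reasoning
      att δδδ f₁ f₂ f₃ f₄ f₅ f₆ : Fin n → Fin n → Fin n → ℕ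
      att i j k = 𝟙 (attacked? (A i) (B j) (C k))
      δδδ i j k = δ (A i) * δ (B j) * δ (C k)
      f₁ i j k = δ (A i) * δ (B j)
      f₂ i j k = δ (A i) * δ (C k)
      f₃ i j k = δ (B j) * δ (C k)
      f₄ i j k = E (A i) (B j) * δ (C k)
      f₅ i j k = E (A i) (C k) * δ (B j)
      f₆ i j k = E (B j) (C k) * δ (A i)
      collect : ∀ n a b c → n + n + n + (n + 2 * a) + (n + 2 * b) + (n + 2 * c) ≡ 6 * n + 2 * (a + b + c)
      collect = solve-∀

  2*layer≤ : ∀ {n} (x : Fin n) → 2 * layer x ≤ n
  2*layer≤ {n} x = begin
    2 * layer x                     ≡⟨ cong (layer x +_) (+-identityʳ (layer x)) ⟩
    layer x + layer x               ≤⟨ +-mono-≤ (m⊓n≤m (toℕ x) _) (m⊓n≤n (toℕ x) _) ⟩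
    toℕ x + (n ∸ suc (toℕ x))       ≤⟨ n≤1+n _ ⟩
    suc (toℕ x) + (n ∸ suc (toℕ x)) ≡⟨ m+[n∸m]≡n (toℕ<n x) ⟩
    n                               ∎
    where open ≤-Reasoning

  -- What matters is a bound linear in `n`: it keeps the number of attackers small against the
  -- number of spaces.
  2*overlaps≤ : ∀ {n} (x y z : Fin n) → 2 * overlaps x y z ≤ 3 * n
  2*overlaps≤ {n} x y z = begin
    2 * (layer x ⊓ layer y + layer x ⊓ layer z + layer y ⊓ layer z)
      ≤⟨ *-monoʳ-≤ 2 (+-mono-≤ (+-mono-≤ (m⊓n≤m (layer x) (layer y)) (m⊓n≤m (layer x) (layer z))) (m⊓n≤m (layer y) (layer z))) ⟩
    2 * (layer x + layer x + layer y)
      ≡⟨ distrib (layer x) (layer y) ⟩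
    2 * layer x + 2 * layer x + 2 * layer y
      ≤⟨ +-mono-≤ (+-mono-≤ (2*layer≤ x) (2*layer≤ x)) (2*layer≤ y) ⟩
    n + n + n
      ≡⟨ three n ⟩
    3 * n ∎
    where
    open ≤-Reasoning
    distrib : ∀ a b → 2 * (a + a + b) ≡ 2 * a + 2 * a + 2 * b
    distrib = solve-∀
    three : ∀ n → n + n + n ≡ 3 * n
    three = solve-∀

  module _ (n : ℕ) where

    private
      N = n ^ 3

    attackers : Space n → ℕ
    attackers x = ∑ {N} λ a → 𝟙 (lineQueenAttacks? n a x)

    overlapsAt : Space n → ℕ
    overlapsAt x = overlaps (finToFun {n} {3} x 0F) (finToFun {n} {3} x 1F) (finToFun {n} {3} x 2F)

    attackers-overlaps : ∀ x → attackers x + 5 ≡ 6 * n + 2 * overlapsAt x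
    attackers-overlaps x = trans
      (cong (_+ 5) (trans
        (sum-cong-≗ {N} λ a → 𝟙-cong (attacks⇔attacked n a x) (lineQueenAttacks? n a x)
          (attacked? (distance n x a 0F) (distance n x a 1F) (distance n x a 2F)))
        (∑-cube n λ i j k → 𝟙 (attacked? ∣ toℕ (X 0F) - toℕ i ∣ ∣ toℕ (X 1F) - toℕ j ∣ ∣ toℕ (X 2F) - toℕ k ∣))))
      (∑³-attacked (X 0F) (X 1F) (X 2F))
      where X = finToFun {n} {3} x

    attackers≤ : ∀ x → attackers x ≤ 9 * n
    attackers≤ x = begin
      attackers x             ≤⟨ m≤m+n (attackers x) 5 ⟩
      attackers x + 5         ≡⟨ attackers-overlaps x ⟩
      6 * n + 2 * overlapsAt x ≤⟨ +-monoʳ-≤ (6 * n) (2*overlaps≤ (X 0F) (X 1F) (X 2F)) ⟩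
      6 * n + 3 * n           ≡⟨ *-distribʳ-+ n 6 3 ⟨
      9 * n                   ∎
      where
      open ≤-Reasoning
      X = finToFun {n} {3} x

    -- A bishop's condition holds at distance 0, so avoiding all attackers of `x` already leaves `x`
    -- unoccupied, and safety becomes a single avoidance condition.
    attacks-self : ∀ x → LineQueenAttacks n x x
    attacks-self x = from (attacks⇔attacked n x x)
      (inj₂ (inj₂ (inj₂ (inj₁ (∣n-n∣≡0 (toℕ (finToFun {n} {3} x 0F)) , ∣n-n∣≡0 (toℕ (finToFun {n} {3} x 1F)))))))

    non-attackers : ∀ x → ∑ {N} (λ a → 𝟙 (¬? (lineQueenAttacks? n a x))) ≡ N ∸ attackers x
    non-attackers x = trans (sym (m+n∸n≡m _ (attackers x))) (cong (_∸ attackers x) (begin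
      ∑ {N} (λ a → 𝟙 (¬? (D a))) + ∑ {N} (λ a → 𝟙 (D a))
        ≡⟨ ∑-distrib-+ {N} (λ a → 𝟙 (¬? (D a))) (λ a → 𝟙 (D a)) ⟨
      ∑ {N} (λ a → 𝟙 (¬? (D a)) + 𝟙 (D a))
        ≡⟨ sum-cong-≗ {N} (λ a → complement (D a)) ⟩
      ∑ {N} (λ _ → 1)
        ≡⟨ ∑-const N 1 ⟩
      N * 1
        ≡⟨ *-identityʳ N ⟩
      N ∎))
      where
      open ≡-Reasoning
      D : ∀ a → Dec (LineQueenAttacks n a x)
      D a = lineQueenAttacks? n a x
      complement : ∀ {A : Set} (a? : Dec A) → 𝟙 (¬? a?) + 𝟙 a? ≡ 1
      complement (yes _) = refl
      complement (no _)  = refl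

    count-configurations : length (configurations n) ≡ N C n ^ 2
    count-configurations = trans
      -- Every subset of the right size avoids the empty set of spaces.
      (count-avoiding {N} {λ _ → ⊥} (λ _ → no id) (n ^ 2) (λ c → ∣ c ∣ ≟ n ^ 2)
        (λ c → mk⇔ (λ size → size , λ _ _ ()) proj₁))
      (cong (_C n ^ 2) (trans (∑-const N 1) (*-identityʳ N)))

    count-safe : ∀ x → length (filter (λ c → safe? n c x) (configurations n)) ≡ (N ∸ attackers x) C n ^ 2
    count-safe x = trans
      (length-filter-filter (λ c → safe? n c x) size? (λ c → safe? n c x ×-dec size? c)
        (λ c → mk⇔ id id) (subsets N))
      (trans
        (count-avoiding (λ a → lineQueenAttacks? n a x) (n ^ 2) (λ c → safe? n c x ×-dec size? c)
          (λ c → mk⇔ (λ ((_ , avoids) , size) → size , avoids)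
                     (λ (size , avoids) → ((λ x∈c → avoids x x∈c (attacks-self x)) , avoids) , size)))
        (cong (_C n ^ 2) (non-attackers x)))
      where
      size? : (c : Subset N) → Dec (∣ c ∣ ≡ n ^ 2)
      size? c = ∣ c ∣ ≟ n ^ 2

    total-safe : sumˡ (map (safeCount n) (configurations n)) ≡ ∑ {N} λ x → (N ∸ attackers x) C n ^ 2
    total-safe = trans (double-counting (safe? n) (configurations n)) (sum-cong-≗ {N} count-safe)

-- Rational arithmetic and absolute value estimates.

module Rationals where

  open import Algebra.Bundles using (CommutativeRing)
  import Data.Integer.Base as ℤ
  import Data.Integer.Properties as ℤ
  open import Data.Nat.Base as ℕ using (ℕ; zero; suc)
  import Data.Nat.Properties as ℕ
  open import Data.Rational.Base
  open import Data.Rational.Properties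
  open import Data.Rational.Solver using (module +-*-Solver)
  import Data.Rational.Unnormalised.Base as ℚᵘ
  import Data.Rational.Unnormalised.Properties as ℚᵘ
  open import Data.Sum.Base using (inj₁; inj₂)
  open import Relation.Binary.PropositionalEquality
  open import Algebra.Properties.CommutativeSemiring.Exp
    (CommutativeRing.commutativeSemiring +-*-commutativeRing) public
  open +-*-Solver

  ι : ℕ → ℚ
  ι n = ℤ.+ n / 1

  toℚᵘ-/ : ∀ a b .{{_ : ℕ.NonZero b}} → toℚᵘ (ℤ.+ a / b) ℚᵘ.≃ (ℤ.+ a ℚᵘ./ b)
  toℚᵘ-/ a (suc b) = toℚᵘ-fromℚᵘ (ℚᵘ.mkℚᵘ (ℤ.+ a) b)

  ι-+ : ∀ a b → ι (a ℕ.+ b) ≡ ι a + ι b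
  ι-+ a b = toℚᵘ-injective (begin
    toℚᵘ (ι (a ℕ.+ b))            ≈⟨ toℚᵘ-/ (a ℕ.+ b) 1 ⟩
    ℚᵘ.mkℚᵘ (ℤ.+ (a ℕ.+ b)) 0       ≈⟨ ℚᵘ.*≡* (cong₂ (λ x y → (x ℤ.+ y) ℤ.* ℤ.+ 1) (sym (ℤ.*-identityʳ (ℤ.+ a))) (sym (ℤ.*-identityʳ (ℤ.+ b)))) ⟩
    ℚᵘ.mkℚᵘ (ℤ.+ a) 0 ℚᵘ.+ ℚᵘ.mkℚᵘ (ℤ.+ b) 0 ≈⟨ ℚᵘ.+-cong (toℚᵘ-/ a 1) (toℚᵘ-/ b 1) ⟨
    toℚᵘ (ι a) ℚᵘ.+ toℚᵘ (ι b)    ≈⟨ toℚᵘ-homo-+ (ι a) (ι b) ⟨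
    toℚᵘ (ι a + ι b)              ∎)
    where open ℚᵘ.≃-Reasoning

  /-*ι : ∀ a b .{{_ : ℕ.NonZero b}} → (ℤ.+ a / b) * ι b ≡ ι a
  /-*ι a b@(suc b-1) = toℚᵘ-injective (begin
    toℚᵘ ((ℤ.+ a / b) * ι b)                  ≈⟨ toℚᵘ-homo-* (ℤ.+ a / b) (ι b) ⟩
    toℚᵘ (ℤ.+ a / b) ℚᵘ.* toℚᵘ (ι b)          ≈⟨ ℚᵘ.*-cong (toℚᵘ-/ a b) (toℚᵘ-/ b 1) ⟩
    ℚᵘ.mkℚᵘ (ℤ.+ a) b-1 ℚᵘ.* ℚᵘ.mkℚᵘ (ℤ.+ b) 0  ≈⟨ ℚᵘ.*≡* (ℤ.*-assoc (ℤ.+ a) (ℤ.+ b) (ℤ.+ 1)) ⟩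
    ℚᵘ.mkℚᵘ (ℤ.+ a) 0                         ≈⟨ toℚᵘ-/ a 1 ⟨
    toℚᵘ (ι a)                              ∎)
    where open ℚᵘ.≃-Reasoning

  ι-* : ∀ a b → ι (a ℕ.* b) ≡ ι a * ι b
  ι-* zero    b = sym (*-zeroˡ (ι b))
  ι-* (suc a) b = trans (ι-+ b (a ℕ.* b))
    (trans (cong (ι b +_) (ι-* a b))
    (trans (solve 2 (λ a b → b :+ a :* b := (con 1ℚ :+ a) :* b) refl (ι a) (ι b))
           (cong (_* ι b) (sym (ι-+ 1 a)))))

  0≤ι : ∀ n → 0ℚ ≤ ι n
  0≤ι n = nonNegative⁻¹ _ {{normalize-nonNeg n 1}}

  ι-mono : ∀ {a b} → a ℕ.≤ b → ι a ≤ ι b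
  ι-mono {a} {b} a≤b = subst₂ _≤_ (+-identityʳ (ι a))
    (trans (sym (ι-+ a (b ℕ.∸ a))) (cong ι (ℕ.m+[n∸m]≡n a≤b)))
    (+-monoʳ-≤ (ι a) (0≤ι (b ℕ.∸ a)))

  ι-^ : ∀ a k → ι (a ℕ.^ k) ≡ ι a ^ k
  ι-^ a zero    = refl
  ι-^ a (suc k) = trans (ι-* a (a ℕ.^ k)) (cong (ι a *_) (ι-^ a k))

  0≤+ : ∀ {x y} → 0ℚ ≤ x → 0ℚ ≤ y → 0ℚ ≤ x + y
  0≤+ = +-mono-≤

  0≤* : ∀ {x y} → 0ℚ ≤ x → 0ℚ ≤ y → 0ℚ ≤ x * y
  0≤* {x} {y} 0≤x 0≤y = nonNegative⁻¹ _
    {{nonNeg*nonNeg⇒nonNeg x {{nonNegative 0≤x}} y {{nonNegative 0≤y}}}}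

  *-mono : ∀ {x y z w} → 0ℚ ≤ x → 0ℚ ≤ w → x ≤ y → z ≤ w → x * z ≤ y * w
  *-mono {x} {y} {z} {w} 0≤x 0≤w x≤y z≤w = ≤-trans
    (*-monoˡ-≤-nonNeg x {{nonNegative 0≤x}} z≤w)
    (*-monoʳ-≤-nonNeg w {{nonNegative 0≤w}} x≤y)

  *-monoˡ : ∀ {x y z} → 0ℚ ≤ x → y ≤ z → x * y ≤ x * z
  *-monoˡ {x} 0≤x = *-monoˡ-≤-nonNeg x {{nonNegative 0≤x}}

  *-monoʳ : ∀ {x y z} → 0ℚ ≤ x → y ≤ z → y * x ≤ z * x
  *-monoʳ {x} 0≤x = *-monoʳ-≤-nonNeg x {{nonNegative 0≤x}}

  0≤y-x⇒x≤y : ∀ {x y} → 0ℚ ≤ y - x → x ≤ y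
  0≤y-x⇒x≤y {x} {y} h = subst₂ _≤_ (+-identityʳ x)
    (solve 2 (λ x y → x :+ (y :- x) := y) refl x y) (+-monoʳ-≤ x h)

  x≤y⇒0≤y-x : ∀ {x y} → x ≤ y → 0ℚ ≤ y - x
  x≤y⇒0≤y-x {x} {y} h = subst (_≤ y - x) (+-inverseʳ x) (+-monoˡ-≤ (- x) h)

  1-x≤1 : ∀ {x} → 0ℚ ≤ x → 1ℚ - x ≤ 1ℚ
  1-x≤1 {x} 0≤x = 0≤y-x⇒x≤y (subst (0ℚ ≤_)
    (solve 1 (λ x → x := con 1ℚ :- (con 1ℚ :- x)) refl x) 0≤x)

  x≤x+y : ∀ {x y} → 0ℚ ≤ y → x ≤ x + y
  x≤x+y {x} {y} 0≤y = subst (_≤ x + y) (+-identityʳ x) (+-monoʳ-≤ x 0≤y)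

  0≤^ : ∀ {x} n → 0ℚ ≤ x → 0ℚ ≤ x ^ n
  0≤^ zero    0≤x = nonNegative⁻¹ 1ℚ
  0≤^ (suc n) 0≤x = 0≤* 0≤x (0≤^ n 0≤x)

  ^≤1 : ∀ {x} n → 0ℚ ≤ x → x ≤ 1ℚ → x ^ n ≤ 1ℚ
  ^≤1 zero    0≤x x≤1 = ≤-refl
  ^≤1 (suc n) 0≤x x≤1 = *-mono 0≤x (nonNegative⁻¹ 1ℚ) x≤1 (^≤1 n 0≤x x≤1)

  1≤^ : ∀ {x} n → 1ℚ ≤ x → 1ℚ ≤ x ^ n
  1≤^ zero    1≤x = ≤-refl
  1≤^ {x} (suc n) 1≤x = *-mono {1ℚ} {x} {1ℚ} {x ^ n} (nonNegative⁻¹ 1ℚ) (0≤^ n (≤-trans (nonNegative⁻¹ 1ℚ) 1≤x)) 1≤x (1≤^ n 1≤x)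

  ∣∣≤ : ∀ {x c} → x ≤ c → - x ≤ c → ∣ x ∣ ≤ c
  ∣∣≤ {x} {c} h k with ∣p∣≡p∨∣p∣≡-p x
  ... | inj₁ eq = subst (_≤ c) (sym eq) h
  ... | inj₂ eq = subst (_≤ c) (sym eq) k

  ∣+∣≤ : ∀ {x y a b} → ∣ x ∣ ≤ a → ∣ y ∣ ≤ b → ∣ x + y ∣ ≤ a + b
  ∣+∣≤ {x} {y} h k = ≤-trans (∣p+q∣≤∣p∣+∣q∣ x y) (+-mono-≤ h k)

  ∣-∣≤ : ∀ {x y a b} → ∣ x ∣ ≤ a → ∣ y ∣ ≤ b → ∣ x - y ∣ ≤ a + b
  ∣-∣≤ {x} {y} h k = ≤-trans (∣p-q∣≤∣p∣+∣q∣ x y) (+-mono-≤ h k)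

  ∣*∣≤ : ∀ {x y a b} → ∣ x ∣ ≤ a → ∣ y ∣ ≤ b → ∣ x * y ∣ ≤ a * b
  ∣*∣≤ {x} {y} {a} {b} h k = subst (_≤ a * b) (sym (∣p*q∣≡∣p∣*∣q∣ x y))
    (*-mono (0≤∣p∣ x) (≤-trans (0≤∣p∣ y) k) h k)

  ∣ι∣≤ : ∀ k → ∣ ι k ∣ ≤ ι k
  ∣ι∣≤ k = ≤-reflexive (0≤p⇒∣p∣≡p (0≤ι k))

  x≤∣x∣ : ∀ x → x ≤ ∣ x ∣
  x≤∣x∣ x with ≤-total 0ℚ x
  ... | inj₁ 0≤x = ≤-reflexive (sym (0≤p⇒∣p∣≡p 0≤x))
  ... | inj₂ x≤0 = ≤-trans x≤0 (0≤∣p∣ x)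

  0≤⇒∣∣≤ : ∀ {x c} → 0ℚ ≤ x → x ≤ c → ∣ x ∣ ≤ c
  0≤⇒∣∣≤ {x} {c} 0≤x x≤c = subst (_≤ c) (sym (0≤p⇒∣p∣≡p 0≤x)) x≤c

  ∣x-z∣≤ : ∀ {a b} x y z → ∣ x - y ∣ ≤ a → ∣ y - z ∣ ≤ b → ∣ x - z ∣ ≤ a + b
  ∣x-z∣≤ {a} {b} x y z h k = subst (λ w → ∣ w ∣ ≤ a + b)
    (solve 3 (λ x y z → (x :- y) :+ (y :- z) := x :- z) refl x y z) (∣+∣≤ h k)

  -- Lets the ring solver treat the numerals `ι n` of a goal as constants and compute with them.
  κ : ∀ {k} → ℕ → Polynomial k
  κ n = con (ι n)

  1/-anti : ∀ {a b} .{{_ : ℕ.NonZero a}} .{{_ : ℕ.NonZero b}} → a ℕ.≤ b → ℤ.+ 1 / b ≤ ℤ.+ 1 / a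
  1/-anti {a} {b} a≤b = begin
    v                 ≡⟨ *-identityʳ v ⟨
    v * ι 1           ≡⟨ cong (v *_) (/-*ι 1 a) ⟨
    v * (w * ι a)     ≤⟨ *-monoˡ 0≤v (*-monoˡ 0≤w (ι-mono a≤b)) ⟩
    v * (w * ι b)     ≡⟨ solve 3 (λ v w b → v :* (w :* b) := v :* b :* w) refl v w (ι b) ⟩
    v * ι b * w       ≡⟨ cong (_* w) (/-*ι 1 b) ⟩
    ι 1 * w           ≡⟨ *-identityˡ w ⟩
    w                 ∎
    where
    open ≤-Reasoning
    v = ℤ.+ 1 / b
    w = ℤ.+ 1 / a
    0≤v = nonNegative⁻¹ v {{normalize-nonNeg 1 b}}
    0≤w = nonNegative⁻¹ w {{normalize-nonNeg 1 a}}

-- Powers of 1 - u and truncations of the exponential series.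

module Exponential where

  open import Data.Nat.Base as ℕ using (ℕ; zero; suc; _!)
  import Data.Nat.Properties as ℕ
  import Data.Integer.Base as ℤ
  open import Data.Rational.Base
  open import Data.Rational.Properties
  open import Data.Rational.Solver using (module +-*-Solver)
  open import Relation.Binary.PropositionalEquality
  open import Defs using (expSum; expSum-mono)
  open +-*-Solver
  open Rationals

  1/! : ℕ → ℚ
  1/! k = (ℤ.+ 1 / k !) {{k ℕ.!≢0}}

  0≤1/! : ∀ k → 0ℚ ≤ 1/! k
  0≤1/! k = nonNegative⁻¹ _ {{normalize-nonNeg 1 (k !) {{k ℕ.!≢0}}}}

  1/!-suc : ∀ k → ι (suc k) * 1/! (suc k) ≡ 1/! k
  1/!-suc k = begin
    ι (suc k) * 1/! (suc k)
      ≡⟨ *-identityʳ _ ⟨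
    ι (suc k) * 1/! (suc k) * 1ℚ
      ≡⟨ cong (ι (suc k) * 1/! (suc k) *_) (1/!-cancel k) ⟨
    ι (suc k) * 1/! (suc k) * (1/! k * ι (k !))
      ≡⟨ solve 4 (λ s x y f → s :* x :* (y :* f) := (x :* (s :* f)) :* y) refl
           (ι (suc k)) (1/! (suc k)) (1/! k) (ι (k !)) ⟩
    1/! (suc k) * (ι (suc k) * ι (k !)) * 1/! k
      ≡⟨ cong (λ x → 1/! (suc k) * x * 1/! k) (ι-* (suc k) (k !)) ⟨
    1/! (suc k) * ι (suc k !) * 1/! k
      ≡⟨ cong (_* 1/! k) (1/!-cancel (suc k)) ⟩
    1ℚ * 1/! k
      ≡⟨ *-identityˡ _ ⟩
    1/! k ∎
    where
    open ≡-Reasoning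
    1/!-cancel : ∀ k → 1/! k * ι (k !) ≡ 1ℚ
    1/!-cancel k = /-*ι 1 (k !) {{k ℕ.!≢0}}

  -- A variable argument is needed because the bounds below move it in steps of u between 0 and n u
  -- = 1.
  expTrunc : ℕ → ℚ → ℚ
  expTrunc zero    y = 1ℚ
  expTrunc (suc j) y = expTrunc j y + y ^ suc j * 1/! (suc j)

  expTrunc-1 : ∀ j → expTrunc j 1ℚ ≡ expSum j
  expTrunc-1 zero    = refl
  expTrunc-1 (suc j) = cong₂ _+_ (expTrunc-1 j)
    (trans (cong (_* 1/! (suc j)) (1^ (suc j))) (*-identityˡ _))
    where
    1^ : ∀ k → 1ℚ ^ k ≡ 1ℚ
    1^ zero    = refl
    1^ (suc k) = trans (*-identityˡ (1ℚ ^ k)) (1^ k)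

  expTrunc-0 : ∀ j → expTrunc j 0ℚ ≡ 1ℚ
  expTrunc-0 zero    = refl
  expTrunc-0 (suc j) = trans
    (solve 3 (λ a y c → a :+ (con 0ℚ :* y) :* c := a) refl (expTrunc j 0ℚ) (0ℚ ^ j) (1/! (suc j)))
    (expTrunc-0 j)

  expTrunc-suc-≤ : ∀ j {y} → 0ℚ ≤ y → expTrunc j y ≤ expTrunc (suc j) y
  expTrunc-suc-≤ j {y} 0≤y = subst (_≤ expTrunc (suc j) y) (+-identityʳ _)
    (+-monoʳ-≤ (expTrunc j y) (0≤* (0≤^ (suc j) 0≤y) (0≤1/! (suc j))))

  0≤expTrunc : ∀ j {y} → 0ℚ ≤ y → 0ℚ ≤ expTrunc j y
  0≤expTrunc zero    0≤y = nonNegative⁻¹ 1ℚ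
  0≤expTrunc (suc j) 0≤y = ≤-trans (0≤expTrunc j 0≤y) (expTrunc-suc-≤ j 0≤y)

  ^-mono : ∀ k {x y} → 0ℚ ≤ x → x ≤ y → x ^ k ≤ y ^ k
  ^-mono zero    0≤x x≤y = ≤-refl
  ^-mono (suc k) 0≤x x≤y = *-mono 0≤x (0≤^ k (≤-trans 0≤x x≤y)) x≤y (^-mono k 0≤x x≤y)

  -- Convexity: the graph of a power lies above its tangent at `z`. In the induction, multiplying by
  -- z + x leaves a quadratic term to spare.
  ^-tangentˡ : ∀ j {x z} → 0ℚ ≤ x → 0ℚ ≤ z →
    z ^ suc j + ι (suc j) * x * z ^ j ≤ (z + x) ^ suc j
  ^-tangentˡ zero {x} {z} 0≤x 0≤z = ≤-reflexive
    (solve 2 (λ x z → z :* con 1ℚ :+ κ 1 :* x :* con 1ℚ := (z :+ x) :* con 1ℚ) refl x z)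
  ^-tangentˡ (suc j) {x} {z} 0≤x 0≤z = begin
    z * (z * z ^ j) + ι (2 ℕ.+ j) * x * (z * z ^ j)
      ≡⟨ cong (λ s → z * (z * z ^ j) + s * x * (z * z ^ j)) (ι-+ 1 (suc j)) ⟩
    z * (z * z ^ j) + (ι 1 + ι (suc j)) * x * (z * z ^ j)
      ≤⟨ x≤x+y (0≤* (0≤* (0≤* (0≤ι (suc j)) 0≤x) 0≤x) (0≤^ j 0≤z)) ⟩
    (z * (z * z ^ j) + (ι 1 + ι (suc j)) * x * (z * z ^ j)) + ι (suc j) * x * x * z ^ j
      ≡⟨ solve 4 (λ x z p s → (z :* (z :* p) :+ (κ 1 :+ s) :* x :* (z :* p)) :+ s :* x :* x :* p
           := (z :+ x) :* (z :* p :+ s :* x :* p)) refl x z (z ^ j) (ι (suc j)) ⟩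
    (z + x) * (z ^ suc j + ι (suc j) * x * z ^ j)
      ≤⟨ *-monoˡ (0≤+ 0≤z 0≤x) (^-tangentˡ j 0≤x 0≤z) ⟩
    (z + x) * (z + x) ^ suc j ∎
    where open ≤-Reasoning

  -- The mean value bound with the slope at the right end, where the derivative is largest.
  ^-tangentʳ : ∀ j {x z} → 0ℚ ≤ x → 0ℚ ≤ z →
    (z + x) ^ suc j ≤ z ^ suc j + ι (suc j) * x * (z + x) ^ j
  ^-tangentʳ zero {x} {z} 0≤x 0≤z = ≤-reflexive
    (solve 2 (λ x z → (z :+ x) :* con 1ℚ := z :* con 1ℚ :+ κ 1 :* x :* con 1ℚ) refl x z)
  ^-tangentʳ (suc j) {x} {z} 0≤x 0≤z = begin
    (z + x) * y
      ≡⟨ *-distribʳ-+ y z x ⟩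
    z * y + x * y
      ≤⟨ +-monoˡ-≤ (x * y) (*-monoˡ 0≤z (^-tangentʳ j 0≤x 0≤z)) ⟩
    z * (z ^ suc j + ι (suc j) * x * (z + x) ^ j) + x * y
      ≤⟨ x≤x+y (0≤* (0≤* (0≤* (0≤ι (suc j)) 0≤x) 0≤x) (0≤^ j (0≤+ 0≤z 0≤x))) ⟩
    (z * (z ^ suc j + ι (suc j) * x * (z + x) ^ j) + x * y) + ι (suc j) * x * x * (z + x) ^ j
      ≡⟨ solve 5 (λ x z p s q →
           (z :* (p :+ s :* x :* q) :+ x :* ((z :+ x) :* q)) :+ s :* x :* x :* q
           := z :* p :+ (κ 1 :+ s) :* x :* ((z :+ x) :* q)) refl
           x z (z ^ suc j) (ι (suc j)) ((z + x) ^ j) ⟩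
    z * z ^ suc j + (ι 1 + ι (suc j)) * x * y
      ≡⟨ cong (λ s → z * z ^ suc j + s * x * y) (ι-+ 1 (suc j)) ⟨
    z * z ^ suc j + ι (2 ℕ.+ j) * x * y ∎
    where
    open ≤-Reasoning
    y = (z + x) ^ suc j

  private
    term-absorb : ∀ j x p → ι (suc j) * x * p * 1/! (suc j) ≡ x * (p * 1/! j)
    term-absorb j x p = trans
      (solve 4 (λ s x p c → s :* x :* p :* c := x :* (p :* (s :* c))) refl (ι (suc j)) x p (1/! (suc j)))
      (cong (λ c → x * (p * c)) (1/!-suc j))

  -- Termwise from the tangents of powers. The derivative of `expTrunc (suc j)` is `expTrunc j`,
  -- hence the lower degree in the linear term.
  expTrunc-tangentˡ : ∀ j {x z} → 0ℚ ≤ x → 0ℚ ≤ z →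
    expTrunc (suc j) z + x * expTrunc j z ≤ expTrunc (suc j) (z + x)
  expTrunc-tangentˡ zero {x} {z} 0≤x 0≤z = ≤-reflexive
    (solve 2 (λ x z → (con 1ℚ :+ z :* con 1ℚ :* con 1ℚ) :+ x :* con 1ℚ
      := con 1ℚ :+ (z :+ x) :* con 1ℚ :* con 1ℚ) refl x z)
  expTrunc-tangentˡ (suc j) {x} {z} 0≤x 0≤z = begin
    (expTrunc (suc j) z + z ^ k * c) + x * (expTrunc j z + z ^ suc j * 1/! (suc j))
      ≡⟨ cong (λ s → (expTrunc (suc j) z + z ^ k * c) + s) (trans (*-distribˡ-+ x _ _)
           (cong (λ s → x * expTrunc j z + s) (sym (term-absorb (suc j) x (z ^ suc j))))) ⟩
    (expTrunc (suc j) z + z ^ k * c) + (x * expTrunc j z + ι k * x * z ^ suc j * c)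
      ≡⟨ solve 5 (λ a b d e c → (a :+ b :* c) :+ (d :+ e :* c) := (a :+ d) :+ (b :+ e) :* c) refl
           (expTrunc (suc j) z) (z ^ k) (x * expTrunc j z) (ι k * x * z ^ suc j) c ⟩
    (expTrunc (suc j) z + x * expTrunc j z) + (z ^ k + ι k * x * z ^ suc j) * c
      ≤⟨ +-mono-≤ (expTrunc-tangentˡ j 0≤x 0≤z) (*-monoʳ (0≤1/! k) (^-tangentˡ (suc j) 0≤x 0≤z)) ⟩
    expTrunc (suc j) (z + x) + (z + x) ^ k * c ∎
    where
    open ≤-Reasoning
    k = suc (suc j)
    c = 1/! k

  expTrunc-tangentʳ : ∀ j {x z} → 0ℚ ≤ x → 0ℚ ≤ z →
    expTrunc (suc j) (z + x) ≤ expTrunc (suc j) z + x * expTrunc j (z + x)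
  expTrunc-tangentʳ zero {x} {z} 0≤x 0≤z = ≤-reflexive
    (solve 2 (λ x z → con 1ℚ :+ (z :+ x) :* con 1ℚ :* con 1ℚ
      := (con 1ℚ :+ z :* con 1ℚ :* con 1ℚ) :+ x :* con 1ℚ) refl x z)
  expTrunc-tangentʳ (suc j) {x} {z} 0≤x 0≤z = begin
    expTrunc (suc j) y + y ^ k * c
      ≤⟨ +-mono-≤ (expTrunc-tangentʳ j 0≤x 0≤z) (*-monoʳ (0≤1/! k) (^-tangentʳ (suc j) 0≤x 0≤z)) ⟩
    (expTrunc (suc j) z + x * expTrunc j y) + (z ^ k + ι k * x * y ^ suc j) * c
      ≡⟨ solve 5 (λ a b d e c → (a :+ d) :+ (b :+ e) :* c := (a :+ b :* c) :+ (d :+ e :* c)) refl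
           (expTrunc (suc j) z) (z ^ k) (x * expTrunc j y) (ι k * x * y ^ suc j) c ⟩
    (expTrunc (suc j) z + z ^ k * c) + (x * expTrunc j y + ι k * x * y ^ suc j * c)
      ≡⟨ cong (λ s → (expTrunc (suc j) z + z ^ k * c) + s) (trans
           (cong (λ s → x * expTrunc j y + s) (term-absorb (suc j) x (y ^ suc j)))
           (sym (*-distribˡ-+ x _ _))) ⟩
    (expTrunc (suc j) z + z ^ k * c) + x * (expTrunc j y + y ^ suc j * 1/! (suc j)) ∎
    where
    open ≤-Reasoning
    y = z + x
    k = suc (suc j)
    c = 1/! k

  -- The counterpart of (1 - x) exp x ≤ 1. Raising the degree of the linear term back to `suc j`
  -- only enlarges an upper bound, so one truncation serves on both sides and the step can be
  -- iterated at fixed degree.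
  expTrunc-shrink : ∀ j {x z} → 0ℚ ≤ x → 0ℚ ≤ z →
    (1ℚ - x) * expTrunc j (z + x) ≤ expTrunc j z
  expTrunc-shrink zero {x} 0≤x 0≤z = 0≤y-x⇒x≤y (subst (0ℚ ≤_)
    (solve 1 (λ x → x := con 1ℚ :- (con 1ℚ :- x) :* con 1ℚ) refl x) 0≤x)
  expTrunc-shrink (suc j) {x} {z} 0≤x 0≤z = begin
    (1ℚ - x) * E
      ≡⟨ solve 2 (λ x E → (con 1ℚ :- x) :* E := E :+ (:- (x :* E))) refl x E ⟩
    E - x * E
      ≤⟨ +-monoˡ-≤ (- (x * E)) (≤-trans (expTrunc-tangentʳ j 0≤x 0≤z)
           (+-monoʳ-≤ (expTrunc (suc j) z) (*-monoˡ 0≤x (expTrunc-suc-≤ j (0≤+ 0≤z 0≤x))))) ⟩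
    (expTrunc (suc j) z + x * E) - x * E
      ≡⟨ solve 2 (λ a b → (a :+ b) :- b := a) refl (expTrunc (suc j) z) (x * E) ⟩
    expTrunc (suc j) z ∎
    where
    open ≤-Reasoning
    E = expTrunc (suc j) (z + x)

  ι-suc* : ∀ k x → ι (suc k) * x ≡ ι k * x + x
  ι-suc* k x = trans (cong (_* x) (ι-+ 1 k))
    (solve 2 (λ k x → (κ 1 :+ k) :* x := k :* x :+ x) refl (ι k) x)

  [1-x]^k*expTrunc≤1 : ∀ j k {x} → 0ℚ ≤ x → x ≤ 1ℚ → (1ℚ - x) ^ k * expTrunc j (ι k * x) ≤ 1ℚ
  [1-x]^k*expTrunc≤1 j zero {x} 0≤x x≤1 = ≤-reflexive
    (trans (*-identityˡ _) (trans (cong (expTrunc j) (*-zeroˡ x)) (expTrunc-0 j)))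
  [1-x]^k*expTrunc≤1 j (suc k) {x} 0≤x x≤1 = begin
    (1ℚ - x) * p * expTrunc j (ι (suc k) * x)
      ≡⟨ cong (λ y → (1ℚ - x) * p * expTrunc j y) (ι-suc* k x) ⟩
    (1ℚ - x) * p * expTrunc j (ι k * x + x)
      ≡⟨ solve 3 (λ a b c → a :* b :* c := b :* (a :* c)) refl (1ℚ - x) p (expTrunc j (ι k * x + x)) ⟩
    p * ((1ℚ - x) * expTrunc j (ι k * x + x))
      ≤⟨ *-monoˡ (0≤^ k (x≤y⇒0≤y-x x≤1)) (expTrunc-shrink j 0≤x (0≤* (0≤ι k) 0≤x)) ⟩
    p * expTrunc j (ι k * x)
      ≤⟨ [1-x]^k*expTrunc≤1 j k 0≤x x≤1 ⟩
    1ℚ ∎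
    where
    open ≤-Reasoning
    p = (1ℚ - x) ^ k

  -- Each factor 1 + x costs one degree: expTrunc-tangentˡ bounds x times the
  -- truncation at the next lower degree only.
  [1+x]^k≤expTrunc : ∀ k {x} → 0ℚ ≤ x → (1ℚ + x) ^ k ≤ expTrunc k (ι k * x)
  [1+x]^k≤expTrunc zero    0≤x = ≤-refl
  [1+x]^k≤expTrunc (suc k) {x} 0≤x = begin
    (1ℚ + x) * (1ℚ + x) ^ k
      ≤⟨ *-monoˡ (0≤+ (nonNegative⁻¹ 1ℚ) 0≤x) ([1+x]^k≤expTrunc k 0≤x) ⟩
    (1ℚ + x) * expTrunc k z
      ≡⟨ solve 2 (λ x e → (con 1ℚ :+ x) :* e := e :+ x :* e) refl x (expTrunc k z) ⟩
    expTrunc k z + x * expTrunc k z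
      ≤⟨ +-monoˡ-≤ (x * expTrunc k z) (expTrunc-suc-≤ k 0≤z) ⟩
    expTrunc (suc k) z + x * expTrunc k z
      ≤⟨ expTrunc-tangentˡ k 0≤x 0≤z ⟩
    expTrunc (suc k) (z + x)
      ≡⟨ cong (expTrunc (suc k)) (ι-suc* k x) ⟨
    expTrunc (suc k) (ι (suc k) * x) ∎
    where
    open ≤-Reasoning
    z = ι k * x
    0≤z = 0≤* (0≤ι k) 0≤x

  bernoulli : ∀ k {x} → 0ℚ ≤ x → x ≤ 1ℚ → 1ℚ - ι k * x ≤ (1ℚ - x) ^ k
  bernoulli zero {x} 0≤x x≤1 = ≤-reflexive (solve 1 (λ x → con 1ℚ :- κ 0 :* x := con 1ℚ) refl x)
  bernoulli (suc k) {x} 0≤x x≤1 = begin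
    1ℚ - ι (suc k) * x
      ≡⟨ cong (λ y → 1ℚ - y) (ι-suc* k x) ⟩
    1ℚ - (ι k * x + x)
      ≤⟨ x≤x+y (0≤* (0≤* (0≤ι k) 0≤x) 0≤x) ⟩
    (1ℚ - (ι k * x + x)) + ι k * x * x
      ≡⟨ solve 2 (λ k x → (con 1ℚ :- (k :* x :+ x)) :+ k :* x :* x := (con 1ℚ :- x) :* (con 1ℚ :- k :* x))
           refl (ι k) x ⟩
    (1ℚ - x) * (1ℚ - ι k * x)
      ≤⟨ *-monoˡ (x≤y⇒0≤y-x x≤1) (bernoulli k 0≤x x≤1) ⟩
    (1ℚ - x) * (1ℚ - x) ^ k ∎
    where open ≤-Reasoning

  -- Both (1 - u)^n and w = 1/E lie between (1 - u) w and w: the products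
  -- (1 - u)^n E and (1 - u)^n (1 + u)^n = (1 - u²)^n are squeezed by 1 - u and 1.
  [1-u]^n≈1/expSum : ∀ n j {u w} → n ℕ.≤ j → 0ℚ ≤ u → u ≤ 1ℚ → ι n * u ≡ 1ℚ →
    0ℚ ≤ w → w ≤ 1ℚ → expSum j * w ≡ 1ℚ → ∣ (1ℚ - u) ^ n - w ∣ ≤ u
  [1-u]^n≈1/expSum n j {u} {w} n≤j 0≤u u≤1 nu≡1 0≤w w≤1 Ew≡1 = ∣∣≤ upper lower
    where
    open ≤-Reasoning
    E = expSum j
    τ = (1ℚ - u) ^ n
    P = (1ℚ + u) ^ n
    0≤τ = 0≤^ n (x≤y⇒0≤y-x u≤1)
    τE≤1 : τ * E ≤ 1ℚ
    τE≤1 = subst (λ e → τ * e ≤ 1ℚ)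
      (trans (cong (expTrunc j) nu≡1) (expTrunc-1 j)) ([1-x]^k*expTrunc≤1 j n 0≤u u≤1)
    P≤E : P ≤ E
    P≤E = ≤-trans
      (subst (P ≤_) (trans (cong (expTrunc n) nu≡1) (expTrunc-1 n)) ([1+x]^k≤expTrunc n 0≤u))
      (expSum-mono (ℕ.≤⇒≤′ n≤j))
    1-u≤τE : 1ℚ - u ≤ τ * E
    1-u≤τE = begin
      1ℚ - u                  ≡⟨ cong (λ y → 1ℚ - y) (trans (sym (*-identityˡ u)) (cong (_* u) (sym nu≡1))) ⟩
      1ℚ - ι n * u * u        ≡⟨ cong (λ y → 1ℚ - y) (*-assoc (ι n) u u) ⟩
      1ℚ - ι n * (u * u)      ≤⟨ bernoulli n (0≤* 0≤u 0≤u) (*-mono {u} {1ℚ} {u} {1ℚ} 0≤u (nonNegative⁻¹ 1ℚ) u≤1 u≤1) ⟩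
      (1ℚ - u * u) ^ n        ≡⟨ cong (_^ n) (solve 1 (λ u → con 1ℚ :- u :* u := (con 1ℚ :- u) :* (con 1ℚ :+ u)) refl u) ⟩
      ((1ℚ - u) * (1ℚ + u)) ^ n ≡⟨ ^-distrib-* (1ℚ - u) (1ℚ + u) n ⟩
      τ * P                   ≤⟨ *-monoˡ 0≤τ P≤E ⟩
      τ * E                   ∎
    τ≡τEw : τ * E * w ≡ τ
    τ≡τEw = trans (*-assoc τ E w) (trans (cong (τ *_) Ew≡1) (*-identityʳ τ))
    upper : τ - w ≤ u
    upper = begin
      τ - w       ≤⟨ +-monoˡ-≤ (- w) (subst₂ _≤_ τ≡τEw (*-identityˡ w) (*-monoʳ 0≤w τE≤1)) ⟩
      w - w       ≡⟨ +-inverseʳ w ⟩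
      0ℚ          ≤⟨ 0≤u ⟩
      u           ∎
    lower : - (τ - w) ≤ u
    lower = begin
      - (τ - w)                   ≤⟨ neg-antimono-≤ (+-monoˡ-≤ (- w) (subst ((1ℚ - u) * w ≤_) τ≡τEw (*-monoʳ 0≤w 1-u≤τE))) ⟩
      - ((1ℚ - u) * w - w)        ≡⟨ solve 2 (λ u w → :- ((con 1ℚ :- u) :* w :- w) := u :* w) refl u w ⟩
      u * w                       ≤⟨ *-monoˡ 0≤u w≤1 ⟩
      u * 1ℚ                      ≡⟨ *-identityʳ u ⟩
      u                           ∎

-- Recurrences for sums of powers over layers.

module LayerSums where

  open import Data.Nat.Base as ℕ using (ℕ; zero; suc; _⊓_)
  import Data.Nat.Properties as ℕ
  open import Data.Rational.Base hiding (_⊓_)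
  open import Data.Rational.Properties
  open import Data.Rational.Solver using (module +-*-Solver)
  open import Relation.Binary.PropositionalEquality
  open import Algebra.Bundles using (CommutativeRing)
  open +-*-Solver
  open Sums
  open FiniteSums +-0-commutativeMonoid public
  open import Algebra.Properties.Semiring.Sum (CommutativeRing.semiring +-*-commutativeRing)
    using (*-distribˡ-sum)
  open Rationals

  ∑-const : ∀ n c → ∑ {n} (λ _ → c) ≡ ι n * c
  ∑-const zero    c = sym (*-zeroˡ c)
  ∑-const (suc n) c = trans (cong (c +_) (∑-const n c)) (trans
    (solve 2 (λ n c → c :+ n :* c := (κ 1 :+ n) :* c) refl (ι n) c)
    (cong (_* c) (sym (ι-+ 1 n))))

  module _ (q : ℚ) where

    private
      -- One row of the double sum, as `Y` is of the triple sum, with numbers for the outer layers: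
      -- on the enlarged board these are successors of layers of the inner board.
      X : ℕ → ℕ → ℚ
      X n a = ∑ {n} λ b → q ^ (a ⊓ layer b)

      Y : ℕ → ℕ → ℕ → ℚ
      Y n a b = ∑ {n} λ c → q ^ (a ⊓ b ℕ.+ a ⊓ layer c ℕ.+ b ⊓ layer c)

    layerSum₂ layerSum₃ : ℕ → ℚ
    layerSum₂ n = ∑ {n} λ a → ∑ {n} λ b → q ^ (layer a ⊓ layer b)
    layerSum₃ n = ∑ {n} λ a → ∑ {n} λ b → ∑ {n} λ c →
      q ^ (layer a ⊓ layer b ℕ.+ layer a ⊓ layer c ℕ.+ layer b ⊓ layer c)

    private
      -- In a row of positive layer the two end cells have minimum 0, and every other minimum is one
      -- more than on the inner board.
      X-suc : ∀ n a → X (2 ℕ.+ n) (suc a) ≡ ι 2 + q * X n a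
      X-suc n a = begin
        X (2 ℕ.+ n) (suc a)
          ≡⟨ ∑-layer n (λ b → q ^ (suc a ⊓ b)) ⟩
        1ℚ + (∑ {n} (λ b → q * q ^ (a ⊓ layer b)) + 1ℚ)
          ≡⟨ cong (λ s → 1ℚ + (s + 1ℚ)) (*-distribˡ-sum {n} q (λ b → q ^ (a ⊓ layer b))) ⟨
        1ℚ + (q * X n a + 1ℚ)
          ≡⟨ solve 1 (λ x → con 1ℚ :+ (x :+ con 1ℚ) := κ 2 :+ x) refl (q * X n a) ⟩
        ι 2 + q * X n a ∎
        where open ≡-Reasoning

      ∑X-suc : ∀ n → ∑ {n} (λ a → X (2 ℕ.+ n) (suc (layer a))) ≡ ι n * ι 2 + q * layerSum₂ n
      ∑X-suc n = begin
        ∑ {n} (λ a → X (2 ℕ.+ n) (suc (layer a)))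
          ≡⟨ sum-cong-≗ {n} (λ a → X-suc n (layer a)) ⟩
        ∑ {n} (λ a → ι 2 + q * X n (layer a))
          ≡⟨ ∑-distrib-+ {n} (λ _ → ι 2) (λ a → q * X n (layer a)) ⟩
        ∑ {n} (λ _ → ι 2) + ∑ {n} (λ a → q * X n (layer a))
          ≡⟨ cong₂ _+_ (∑-const n (ι 2)) (sym (*-distribˡ-sum {n} q (λ a → X n (layer a)))) ⟩
        ι n * ι 2 + q * layerSum₂ n ∎
        where open ≡-Reasoning

    -- The border of the enlarged square has 4 n + 4 cells, all with minimum 0; inside, every
    -- minimum has grown by one.
    layerSum₂-suc² : ∀ n → layerSum₂ (2 ℕ.+ n) ≡ ι 4 + ι 4 * ι n + q * layerSum₂ n
    layerSum₂-suc² n = begin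
      layerSum₂ (2 ℕ.+ n)
        ≡⟨ ∑-layer n (X (2 ℕ.+ n)) ⟩
      X (2 ℕ.+ n) 0 + (∑ {n} (λ a → X (2 ℕ.+ n) (suc (layer a))) + X (2 ℕ.+ n) 0)
        ≡⟨ cong₂ (λ x s → x + (s + x)) (trans (∑-const (2 ℕ.+ n) 1ℚ) (cong (_* 1ℚ) (ι-+ 2 n))) (∑X-suc n) ⟩
      (ι 2 + ι n) * 1ℚ + (ι n * ι 2 + q * layerSum₂ n + (ι 2 + ι n) * 1ℚ)
        ≡⟨ solve 2 (λ n x → (κ 2 :+ n) :* con 1ℚ :+ (n :* κ 2 :+ x :+ (κ 2 :+ n) :* con 1ℚ)
             := κ 4 :+ κ 4 :* n :+ x) refl (ι n) (q * layerSum₂ n) ⟩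
      ι 4 + ι 4 * ι n + q * layerSum₂ n ∎
      where open ≡-Reasoning

    private
      q³ = q * q * q

      -- A coordinate on the border kills the two minima that involve it.
      Y-zero : ∀ n a → Y n a 0 ≡ X n a
      Y-zero n a = sum-cong-≗ {n} λ c → cong (q ^_)
        (trans (ℕ.+-identityʳ _) (cong (ℕ._+ a ⊓ layer c) (ℕ.⊓-zeroʳ a)))

      -- At the two ends only the minimum of the fixed layers survives; inside, all three minima
      -- grow by one.
      Y-suc : ∀ n a b → Y (2 ℕ.+ n) (suc a) (suc b) ≡ ι 2 * q * q ^ (a ⊓ b) + q³ * Y n a b
      Y-suc n a b = begin
        Y (2 ℕ.+ n) (suc a) (suc b)
          ≡⟨ ∑-layer n (λ c → q ^ (suc (a ⊓ b) ℕ.+ suc a ⊓ c ℕ.+ suc b ⊓ c)) ⟩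
        q * q ^ (a ⊓ b ℕ.+ 0 ℕ.+ 0) +
          (∑ {n} (λ c → q ^ (suc (a ⊓ b) ℕ.+ suc (a ⊓ layer c) ℕ.+ suc (b ⊓ layer c))) + q * q ^ (a ⊓ b ℕ.+ 0 ℕ.+ 0))
          ≡⟨ cong₂ (λ x s → q * q ^ x + (s + q * q ^ x))
               (trans (ℕ.+-identityʳ _) (ℕ.+-identityʳ (a ⊓ b)))
               (trans (sum-cong-≗ {n} (λ c → q^[3+] (a ⊓ b) (a ⊓ layer c) (b ⊓ layer c)))
                      (sym (*-distribˡ-sum {n} q³ (λ c → q ^ (a ⊓ b ℕ.+ a ⊓ layer c ℕ.+ b ⊓ layer c))))) ⟩
        q * q ^ (a ⊓ b) + (q³ * Y n a b + q * q ^ (a ⊓ b))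
          ≡⟨ solve 3 (λ q x y → q :* x :+ (y :+ q :* x) := κ 2 :* q :* x :+ y) refl q (q ^ (a ⊓ b)) (q³ * Y n a b) ⟩
        ι 2 * q * q ^ (a ⊓ b) + q³ * Y n a b ∎
        where
        open ≡-Reasoning
        q^[3+] : ∀ i j k → q ^ (suc i ℕ.+ suc j ℕ.+ suc k) ≡ q³ * q ^ (i ℕ.+ j ℕ.+ k)
        q^[3+] i j k = trans
          (cong (q ^_) (trans (ℕ.+-suc (suc i ℕ.+ suc j) k) (cong (λ s → suc (suc (s ℕ.+ k))) (ℕ.+-suc i j))))
          (solve 2 (λ q x → q :* (q :* (q :* x)) := q :* q :* q :* x) refl q (q ^ (i ℕ.+ j ℕ.+ k)))

      ∑Y : ℕ → ℕ → ℚ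
      ∑Y n a = ∑ {n} λ b → Y n a (layer b)

      ∑Y-suc : ∀ n a → ∑Y (2 ℕ.+ n) (suc a)
        ≡ ι 2 * X (2 ℕ.+ n) (suc a) + (ι 2 * q * X n a + q³ * ∑Y n a)
      ∑Y-suc n a = begin
        ∑Y (2 ℕ.+ n) (suc a)
          ≡⟨ ∑-layer n (Y (2 ℕ.+ n) (suc a)) ⟩
        Y (2 ℕ.+ n) (suc a) 0 + (∑ {n} (λ b → Y (2 ℕ.+ n) (suc a) (suc (layer b))) + Y (2 ℕ.+ n) (suc a) 0)
          ≡⟨ cong₂ (λ x s → x + (s + x)) (Y-zero (2 ℕ.+ n) (suc a)) (begin
               ∑ {n} (λ b → Y (2 ℕ.+ n) (suc a) (suc (layer b)))
                 ≡⟨ sum-cong-≗ {n} (λ b → Y-suc n a (layer b)) ⟩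
               ∑ {n} (λ b → ι 2 * q * q ^ (a ⊓ layer b) + q³ * Y n a (layer b))
                 ≡⟨ ∑-distrib-+ {n} (λ b → ι 2 * q * q ^ (a ⊓ layer b)) (λ b → q³ * Y n a (layer b)) ⟩
               ∑ {n} (λ b → ι 2 * q * q ^ (a ⊓ layer b)) + ∑ {n} (λ b → q³ * Y n a (layer b))
                 ≡⟨ cong₂ _+_ (*-distribˡ-sum {n} (ι 2 * q) (λ b → q ^ (a ⊓ layer b)))
                              (*-distribˡ-sum {n} q³ (λ b → Y n a (layer b))) ⟨
               ι 2 * q * X n a + q³ * ∑Y n a ∎) ⟩
        X (2 ℕ.+ n) (suc a) + (ι 2 * q * X n a + q³ * ∑Y n a + X (2 ℕ.+ n) (suc a))
          ≡⟨ solve 2 (λ x s → x :+ (s :+ x) := κ 2 :* x :+ s) refl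
               (X (2 ℕ.+ n) (suc a)) (ι 2 * q * X n a + q³ * ∑Y n a) ⟩
        ι 2 * X (2 ℕ.+ n) (suc a) + (ι 2 * q * X n a + q³ * ∑Y n a) ∎
        where open ≡-Reasoning

    -- The shell of the enlarged cube has 8 corners and 12 edges of `n` further cells, where all
    -- three minima vanish, and 6 faces, inside which only the minimum of the two inner layers
    -- remains, raised by one. In the core all three minima grow by one.
    layerSum₃-suc² : ∀ n → layerSum₃ (2 ℕ.+ n)
      ≡ ι 8 + ι 12 * ι n + ι 6 * q * layerSum₂ n + q³ * layerSum₃ n
    layerSum₃-suc² n = begin
      layerSum₃ (2 ℕ.+ n)
        ≡⟨ ∑-layer n (∑Y (2 ℕ.+ n)) ⟩
      -- `∑Y (2 ℕ.+ n) 0` is the double sum `F⁺` by computation, since a minimum with 0 on its left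
      -- reduces to 0.
      F⁺ + (∑ {n} (λ a → ∑Y (2 ℕ.+ n) (suc (layer a))) + F⁺)
        ≡⟨ cong₂ (λ f s → f + (s + f)) (layerSum₂-suc² n) (begin
             ∑ {n} (λ a → ∑Y (2 ℕ.+ n) (suc (layer a)))
               ≡⟨ sum-cong-≗ {n} (λ a → ∑Y-suc n (layer a)) ⟩
             ∑ {n} (λ a → ι 2 * X (2 ℕ.+ n) (suc (layer a)) + (ι 2 * q * X n (layer a) + q³ * ∑Y n (layer a)))
               ≡⟨ ∑-distrib-+ {n} (λ a → ι 2 * X (2 ℕ.+ n) (suc (layer a))) (λ a → ι 2 * q * X n (layer a) + q³ * ∑Y n (layer a)) ⟩
             ∑ {n} (λ a → ι 2 * X (2 ℕ.+ n) (suc (layer a))) + ∑ {n} (λ a → ι 2 * q * X n (layer a) + q³ * ∑Y n (layer a))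
               ≡⟨ cong₂ _+_
                    (trans (sym (*-distribˡ-sum {n} (ι 2) (λ a → X (2 ℕ.+ n) (suc (layer a))))) (cong (ι 2 *_) (∑X-suc n)))
                    (trans (∑-distrib-+ {n} (λ a → ι 2 * q * X n (layer a)) (λ a → q³ * ∑Y n (layer a)))
                      (sym (cong₂ _+_ (*-distribˡ-sum {n} (ι 2 * q) (λ a → X n (layer a)))
                                      (*-distribˡ-sum {n} q³ (λ a → ∑Y n (layer a)))))) ⟩
             ι 2 * (ι n * ι 2 + q * F) + (ι 2 * q * F + q³ * G) ∎) ⟩
      (ι 4 + ι 4 * ι n + q * F) + (ι 2 * (ι n * ι 2 + q * F) + (ι 2 * q * F + q³ * G) + (ι 4 + ι 4 * ι n + q * F))
        ≡⟨ solve 4 (λ n q F x → (κ 4 :+ κ 4 :* n :+ q :* F)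
             :+ (κ 2 :* (n :* κ 2 :+ q :* F) :+ (κ 2 :* q :* F :+ x) :+ (κ 4 :+ κ 4 :* n :+ q :* F))
             := κ 8 :+ κ 12 :* n :+ κ 6 :* q :* F :+ x) refl (ι n) q F (q³ * G) ⟩
      ι 8 + ι 12 * ι n + ι 6 * q * F + q³ * G ∎
      where
      open ≡-Reasoning
      F = layerSum₂ n
      F⁺ = layerSum₂ (2 ℕ.+ n)
      G = layerSum₃ n

-- The recurrences against their differential equations.

module Recurrence where

  open import Data.Nat.Base as ℕ using (ℕ; suc)
  import Data.Nat.Properties as ℕ
  open import Data.Rational.Base
  open import Data.Rational.Properties
  open import Data.Rational.Solver using (module +-*-Solver)
  open import Relation.Binary.PropositionalEquality
  open +-*-Solver
  open Rationals

  module _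
    {u} (0≤u : 0ℚ ≤ u) (u≤1 : u ≤ 1ℚ)
    (F G : ℕ → ℚ)
    (F₀ : F 0 ≡ 0ℚ) (F₁ : F 1 ≡ 1ℚ)
    (F₊ : ∀ k → F (2 ℕ.+ k) ≡ ι 4 + ι 4 * ι k + (1ℚ - u) * (1ℚ - u) * F k)
    (G₀ : G 0 ≡ 0ℚ) (G₁ : G 1 ≡ 1ℚ)
    (G₊ : ∀ k → G (2 ℕ.+ k) ≡ ι 8 + ι 12 * ι k + ι 6 * ((1ℚ - u) * (1ℚ - u)) * F k
      + (1ℚ - u) * (1ℚ - u) * ((1ℚ - u) * (1ℚ - u)) * ((1ℚ - u) * (1ℚ - u)) * G k)
    where

    private
      t : ℚ
      t = 1ℚ - u

      0≤t : 0ℚ ≤ t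
      0≤t = x≤y⇒0≤y-x u≤1
      t≤1 : t ≤ 1ℚ
      t≤1 = 1-x≤1 0≤u

      -- u² F and 3 u³ G follow Euler steps of size 2 u for f′ + f = 2 z and
      -- g′ + 3 g = 9 f; f and g are the solutions vanishing at z = 0, with t ^ k for exp (- z).
      f g : ℕ → ℚ
      f k = ι 2 * (ι k * u - 1ℚ + t ^ k)
      g k = ι 6 * (ι k * u) - ι 8 + ι 9 * t ^ k - t ^ k * t ^ k * t ^ k

      errF errG : ℕ → ℚ
      errF k = u * u * F k - f k
      errG k = ι 3 * (u * u * u) * G k - g k

      ιu-suc² : ∀ k → ι (2 ℕ.+ k) * u ≡ ι k * u + ι 2 * u
      ιu-suc² k = trans (cong (_* u) (ι-+ 2 k)) (solve 2 (λ k u → (κ 2 :+ k) :* u := k :* u :+ κ 2 :* u) refl (ι k) u)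

      -- The factor t² carries `t ^ k` to its next value exactly, so only the polynomial part of `f`
      -- leaves a defect.
      errF-step : ∀ k → errF (2 ℕ.+ k) ≡ t * t * errF k + ι 2 * (u * u) * (1ℚ + ι k * u)
      errF-step k rewrite F₊ k | ι-+ 2 k = solve 4 (λ u k p F → let t = con 1ℚ :- u in
        u :* u :* (κ 4 :+ κ 4 :* k :+ t :* t :* F) :- κ 2 :* ((κ 2 :+ k) :* u :- con 1ℚ :+ t :* (t :* p))
        := t :* t :* (u :* u :* F :- κ 2 :* (k :* u :- con 1ℚ :+ p)) :+ κ 2 :* (u :* u) :* (con 1ℚ :+ k :* u))
        refl u (ι k) (t ^ k) (F k)

      -- The defect of one double step for `g`, divided by u², after `errF k + f k` is put for u² F;
      -- here z is k u and p is `t ^ k`. The cube of `t ^ k` is reproduced exactly by the factor t⁶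
      -- and leaves no trace.
      remainder : ℚ → ℚ → ℚ
      remainder z p = ι 3 * z * (ι 18 - ι 28 * u + ι 30 * (u * u) - ι 12 * (u * u * u) + ι 2 * (u * u * u * u))
        - (ι 48 - ι 148 * u + ι 120 * (u * u) - ι 48 * (u * u * u) + ι 8 * (u * u * u * u))
        + ι 3 * p * (t * t * (ι 18 - ι 12 * u + ι 3 * (u * u)))

      errG-step : ∀ k → errG (2 ℕ.+ k) ≡ t * t * (t * t) * (t * t) * errG k
        + ι 18 * u * (t * t) * errF k + u * u * remainder (ι k * u) (t ^ k)
      errG-step k rewrite G₊ k | ι-+ 2 k = solve 5 (λ u k p F G →
        let t = con 1ℚ :- u
            z = k :* u
            q = t :* (t :* p) in
        κ 3 :* (u :* u :* u) :* (κ 8 :+ κ 12 :* k :+ κ 6 :* (t :* t) :* F :+ t :* t :* (t :* t) :* (t :* t) :* G)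
          :- (κ 6 :* ((κ 2 :+ k) :* u) :- κ 8 :+ κ 9 :* q :- q :* q :* q)
        := t :* t :* (t :* t) :* (t :* t) :* (κ 3 :* (u :* u :* u) :* G :- (κ 6 :* z :- κ 8 :+ κ 9 :* p :- p :* p :* p))
          :+ κ 18 :* u :* (t :* t) :* (u :* u :* F :- κ 2 :* (z :- con 1ℚ :+ p))
          :+ u :* u :* (κ 3 :* z :* (κ 18 :- κ 28 :* u :+ κ 30 :* (u :* u) :- κ 12 :* (u :* u :* u) :+ κ 2 :* (u :* u :* u :* u))
          :- (κ 48 :- κ 148 :* u :+ κ 120 :* (u :* u) :- κ 48 :* (u :* u :* u) :+ κ 8 :* (u :* u :* u :* u))
          :+ κ 3 :* p :* (t :* t :* (κ 18 :- κ 12 :* u :+ κ 3 :* (u :* u)))))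
        refl u (ι k) (t ^ k) (F k) (G k)

      z≤1-pred : ∀ k → ι (2 ℕ.+ k) * u ≤ 1ℚ → ι k * u ≤ 1ℚ
      z≤1-pred k = ≤-trans (*-monoʳ 0≤u (ι-mono (ℕ.m≤n+m k 2)))

      ιu+u-suc² : ∀ k → u + u + (ι k * u + u) ≡ ι (2 ℕ.+ k) * u + u
      ιu+u-suc² k = trans
        (solve 2 (λ z u → u :+ u :+ (z :+ u) := z :+ κ 2 :* u :+ u) refl (ι k * u) u)
        (cong (_+ u) (sym (ιu-suc² k)))

      errF₀ : errF 0 ≡ 0ℚ
      errF₀ rewrite F₀ = solve 1 (λ u → u :* u :* con 0ℚ :- κ 2 :* (κ 0 :* u :- con 1ℚ :+ con 1ℚ) := con 0ℚ) refl u

      errF₁ : errF 1 ≡ u * u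
      errF₁ rewrite F₁ = solve 1 (λ u →
        u :* u :* con 1ℚ :- κ 2 :* (κ 1 :* u :- con 1ℚ :+ (con 1ℚ :- u) :* con 1ℚ) := u :* u) refl u

      errG₀ : errG 0 ≡ 0ℚ
      errG₀ rewrite G₀ = solve 1 (λ u → κ 3 :* (u :* u :* u) :* con 0ℚ
        :- (κ 6 :* (κ 0 :* u) :- κ 8 :+ κ 9 :* con 1ℚ :- con 1ℚ :* con 1ℚ :* con 1ℚ) := con 0ℚ) refl u

      errG₁ : errG 1 ≡ ι 3 * (u * u) + ι 2 * (u * u) * u
      errG₁ rewrite G₁ = solve 1 (λ u → let t = (con 1ℚ :- u) :* con 1ℚ in
        κ 3 :* (u :* u :* u) :* con 1ℚ :- (κ 6 :* (κ 1 :* u) :- κ 8 :+ κ 9 :* t :- t :* t :* t)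
        := κ 3 :* (u :* u) :+ κ 2 :* (u :* u) :* u) refl u

      0≤z : ∀ k → 0ℚ ≤ ι k * u
      0≤z k = 0≤* (0≤ι k) 0≤u

      0≤u² : 0ℚ ≤ u * u
      0≤u² = 0≤* 0≤u 0≤u

      ∣t²∣≤1 : ∣ t * t ∣ ≤ 1ℚ
      ∣t²∣≤1 = ∣*∣≤ {a = 1ℚ} {b = 1ℚ} (0≤⇒∣∣≤ 0≤t t≤1) (0≤⇒∣∣≤ 0≤t t≤1)

      -- As t² is at most 1, the defects merely add up: a double step adds at most 4 u², while the
      -- bound grows by 8 u².
      ∣errF∣≤ : ∀ k → ι k * u ≤ 1ℚ → ∣ errF k ∣ ≤ ι 4 * u * (ι k * u + u)
      ∣errF∣≤ 0 _ rewrite errF₀ = 0≤* (0≤* (0≤ι 4) 0≤u) (0≤+ (0≤z 0) 0≤u)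
      ∣errF∣≤ 1 _ rewrite errF₁ = 0≤⇒∣∣≤ 0≤u² (subst (u * u ≤_)
        (solve 1 (λ u → u :* u :+ κ 7 :* (u :* u) := κ 4 :* u :* (κ 1 :* u :+ u)) refl u)
        (x≤x+y (0≤* (0≤ι 7) 0≤u²)))
      ∣errF∣≤ (suc (suc k)) z≤1 = begin
        ∣ errF (2 ℕ.+ k) ∣
          ≡⟨ cong ∣_∣ (errF-step k) ⟩
        ∣ t * t * errF k + ι 2 * (u * u) * (1ℚ + z) ∣
          ≤⟨ ∣+∣≤ (∣*∣≤ ∣t²∣≤1 (∣errF∣≤ k z≤1′))
               (∣*∣≤ (0≤⇒∣∣≤ (0≤* (0≤ι 2) 0≤u²) ≤-refl)
                     (0≤⇒∣∣≤ (0≤+ (nonNegative⁻¹ 1ℚ) (0≤z k)) (+-monoʳ-≤ 1ℚ z≤1′))) ⟩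
        1ℚ * (ι 4 * u * (z + u)) + ι 2 * (u * u) * (1ℚ + 1ℚ)
          ≤⟨ x≤x+y (0≤* (0≤ι 4) 0≤u²) ⟩
        (1ℚ * (ι 4 * u * (z + u)) + ι 2 * (u * u) * (1ℚ + 1ℚ)) + ι 4 * (u * u)
          ≡⟨ solve 2 (λ u z → (con 1ℚ :* (κ 4 :* u :* (z :+ u)) :+ κ 2 :* (u :* u) :* (con 1ℚ :+ con 1ℚ))
               :+ κ 4 :* (u :* u) := κ 4 :* u :* (u :+ u :+ (z :+ u))) refl u z ⟩
        ι 4 * u * (u + u + (z + u))
          ≡⟨ cong (ι 4 * u *_) (ιu+u-suc² k) ⟩
        ι 4 * u * (ι (2 ℕ.+ k) * u + u) ∎
        where
        open ≤-Reasoning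
        z = ι k * u
        z≤1′ = z≤1-pred k z≤1

      -- The absolute coefficients add up to 741 = 3 (18 + 28 + 30 + 12 + 2) + (48 + 148 + 120 + 48
      -- + 8) + 3 (18 + 12 + 3).
      ∣remainder∣≤ : ∀ {z p} → ∣ z ∣ ≤ 1ℚ → ∣ p ∣ ≤ 1ℚ → ∣ remainder z p ∣ ≤ ι 741
      ∣remainder∣≤ hz hp =
        ∣+∣≤ (∣-∣≤
          (∣*∣≤ (∣*∣≤ (∣ι∣≤ 3) hz) (∣+∣≤ (∣-∣≤ (∣+∣≤ (∣-∣≤ (∣ι∣≤ 18) (∣*∣≤ (∣ι∣≤ 28) hu))
            (∣*∣≤ (∣ι∣≤ 30) hu²)) (∣*∣≤ (∣ι∣≤ 12) hu³)) (∣*∣≤ (∣ι∣≤ 2) hu⁴)))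
          (∣+∣≤ (∣-∣≤ (∣+∣≤ (∣-∣≤ (∣ι∣≤ 48) (∣*∣≤ (∣ι∣≤ 148) hu))
            (∣*∣≤ (∣ι∣≤ 120) hu²)) (∣*∣≤ (∣ι∣≤ 48) hu³)) (∣*∣≤ (∣ι∣≤ 8) hu⁴)))
          (∣*∣≤ (∣*∣≤ (∣ι∣≤ 3) hp) (∣*∣≤ ∣t²∣≤1 (∣+∣≤ (∣-∣≤ (∣ι∣≤ 18) (∣*∣≤ (∣ι∣≤ 12) hu)) (∣*∣≤ (∣ι∣≤ 3) hu²))))
        where
        hu : ∣ u ∣ ≤ 1ℚ
        hu = 0≤⇒∣∣≤ 0≤u u≤1
        hu² : ∣ u * u ∣ ≤ 1ℚ
        hu² = ∣*∣≤ {a = 1ℚ} {b = 1ℚ} hu hu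
        hu³ : ∣ u * u * u ∣ ≤ 1ℚ
        hu³ = ∣*∣≤ {a = 1ℚ} {b = 1ℚ} hu² hu
        hu⁴ : ∣ u * u * u * u ∣ ≤ 1ℚ
        hu⁴ = ∣*∣≤ {a = 1ℚ} {b = 1ℚ} hu³ hu

      -- A double step adds at most 144 u² through `errF` and 741 u² through `remainder`, while the
      -- bound grows by 2000 u²; 1000 is merely a round constant.
      ∣errG∣≤ : ∀ k → ι k * u ≤ 1ℚ → ∣ errG k ∣ ≤ ι 1000 * u * (ι k * u + u)
      ∣errG∣≤ 0 _ rewrite errG₀ = 0≤* (0≤* (0≤ι 1000) 0≤u) (0≤+ (0≤z 0) 0≤u)
      ∣errG∣≤ 1 _ rewrite errG₁ = begin
        ∣ ι 3 * (u * u) + ι 2 * (u * u) * u ∣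
          ≤⟨ 0≤⇒∣∣≤ (0≤+ (0≤* (0≤ι 3) 0≤u²) (0≤* (0≤* (0≤ι 2) 0≤u²) 0≤u))
               (+-monoʳ-≤ (ι 3 * (u * u)) (*-monoˡ (0≤* (0≤ι 2) 0≤u²) u≤1)) ⟩
        ι 3 * (u * u) + ι 2 * (u * u) * 1ℚ
          ≤⟨ x≤x+y (0≤* (0≤ι 1995) 0≤u²) ⟩
        (ι 3 * (u * u) + ι 2 * (u * u) * 1ℚ) + ι 1995 * (u * u)
          ≡⟨ solve 1 (λ u → (κ 3 :* (u :* u) :+ κ 2 :* (u :* u) :* con 1ℚ) :+ κ 1995 :* (u :* u)
               := κ 1000 :* u :* (κ 1 :* u :+ u)) refl u ⟩
        ι 1000 * u * (ι 1 * u + u) ∎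
        where open ≤-Reasoning
      ∣errG∣≤ (suc (suc k)) z≤1 = begin
        ∣ errG (2 ℕ.+ k) ∣
          ≡⟨ cong ∣_∣ (errG-step k) ⟩
        ∣ t * t * (t * t) * (t * t) * errG k + ι 18 * u * (t * t) * errF k + u * u * remainder z p ∣
          ≤⟨ ∣+∣≤ (∣+∣≤ (∣*∣≤ (∣*∣≤ {a = 1ℚ} {b = 1ℚ} (∣*∣≤ {a = 1ℚ} {b = 1ℚ} ∣t²∣≤1 ∣t²∣≤1) ∣t²∣≤1) (∣errG∣≤ k z≤1′))
                        (∣*∣≤ (∣*∣≤ {b = 1ℚ} (0≤⇒∣∣≤ (0≤* (0≤ι 18) 0≤u) ≤-refl) ∣t²∣≤1) (∣errF∣≤ k z≤1′)))
               (∣*∣≤ (0≤⇒∣∣≤ 0≤u² ≤-refl)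
                     (∣remainder∣≤ (0≤⇒∣∣≤ (0≤z k) z≤1′) (0≤⇒∣∣≤ (0≤^ k 0≤t) (^≤1 k 0≤t t≤1)))) ⟩
        1ℚ * (ι 1000 * u * (z + u)) + ι 18 * u * 1ℚ * (ι 4 * u * (z + u)) + u * u * ι 741
          ≤⟨ +-monoˡ-≤ (u * u * ι 741) (+-monoʳ-≤ (1ℚ * (ι 1000 * u * (z + u)))
               (*-monoˡ (0≤* (0≤* (0≤ι 18) 0≤u) (nonNegative⁻¹ 1ℚ))
                 (*-monoˡ (0≤* (0≤ι 4) 0≤u) (+-mono-≤ z≤1′ u≤1)))) ⟩
        1ℚ * (ι 1000 * u * (z + u)) + ι 18 * u * 1ℚ * (ι 4 * u * (1ℚ + 1ℚ)) + u * u * ι 741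
          ≤⟨ x≤x+y (0≤* (0≤ι 1115) 0≤u²) ⟩
        (1ℚ * (ι 1000 * u * (z + u)) + ι 18 * u * 1ℚ * (ι 4 * u * (1ℚ + 1ℚ)) + u * u * ι 741) + ι 1115 * (u * u)
          ≡⟨ solve 2 (λ u z → (con 1ℚ :* (κ 1000 :* u :* (z :+ u))
               :+ κ 18 :* u :* con 1ℚ :* (κ 4 :* u :* (con 1ℚ :+ con 1ℚ)) :+ u :* u :* κ 741) :+ κ 1115 :* (u :* u)
               := κ 1000 :* u :* (u :+ u :+ (z :+ u))) refl u z ⟩
        ι 1000 * u * (u + u + (z + u))
          ≡⟨ cong (ι 1000 * u *_) (ιu+u-suc² k) ⟩
        ι 1000 * u * (ι (2 ℕ.+ k) * u + u) ∎
        where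
        open ≤-Reasoning
        z = ι k * u
        p = t ^ k
        z≤1′ = z≤1-pred k z≤1

    -- At k = n the scaled variable is 1, where `g` takes this polynomial as its value.
    recurrence-limit : ∀ n → ι n * u ≡ 1ℚ → let τ = (1ℚ - u) ^ n in
      ∣ ι 3 * (u * u * u) * G n - (ι 9 * τ - ι 2 - τ * τ * τ) ∣ ≤ ι 2000 * u
    recurrence-limit n nu≡1 = begin
      ∣ ι 3 * (u * u * u) * G n - (ι 9 * τ - ι 2 - τ * τ * τ) ∣
        ≡⟨ cong (λ x → ∣ ι 3 * (u * u * u) * G n - x ∣) (trans
             (solve 1 (λ τ → κ 9 :* τ :- κ 2 :- τ :* τ :* τ
               := κ 6 :* con 1ℚ :- κ 8 :+ κ 9 :* τ :- τ :* τ :* τ) refl τ)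
             (cong (λ z → ι 6 * z - ι 8 + ι 9 * τ - τ * τ * τ) (sym nu≡1))) ⟩
      ∣ errG n ∣
        ≤⟨ ∣errG∣≤ n (≤-reflexive nu≡1) ⟩
      ι 1000 * u * (ι n * u + u)
        ≤⟨ *-monoˡ (0≤* (0≤ι 1000) 0≤u) (+-mono-≤ (≤-reflexive nu≡1) u≤1) ⟩
      ι 1000 * u * (1ℚ + 1ℚ)
        ≡⟨ solve 1 (λ u → κ 1000 :* u :* (con 1ℚ :+ con 1ℚ) := κ 2000 :* u) refl u ⟩
      ι 2000 * u ∎
      where
      open ≤-Reasoning
      τ = t ^ n

-- The probability that given spaces are free.

module FreeSpaces where

  open import Data.Nat.Base as ℕ using (ℕ; zero; suc; z≤n; s≤s; _∸_)
  open import Data.Nat.Combinatorics using (_C_; nCk+nC[k+1]≡[n+1]C[k+1])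
  import Data.Nat.Properties as ℕ
  open import Data.Nat.Tactic.RingSolver using (solve-∀)
  open import Data.Rational.Base
  open import Data.Rational.Properties
  open import Data.Rational.Solver using (module +-*-Solver)
  open import Relation.Binary.PropositionalEquality
  open +-*-Solver
  open Rationals
  open Exponential using (bernoulli; ι-suc*)
  open Counting using ([1+n]*nCk+k*[1+n]Ck)

  C-mono : ∀ {m n} k → m ℕ.≤′ n → m C k ℕ.≤ n C k
  C-mono k       (ℕ.≤′-reflexive refl) = ℕ.≤-refl
  C-mono zero    (ℕ.≤′-step m≤n)       = ℕ.≤-refl
  C-mono {m} {suc n} (suc k) (ℕ.≤′-step m≤n) = begin
    m C suc k             ≤⟨ C-mono (suc k) m≤n ⟩
    n C suc k             ≤⟨ ℕ.m≤n+m (n C suc k) (n C k) ⟩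
    n C k ℕ.+ n C suc k   ≡⟨ nCk+nC[k+1]≡[n+1]C[k+1] n k ⟩
    suc n C suc k         ∎
    where open ℕ.≤-Reasoning

  n²+9n≤n³ : ∀ n → 4 ℕ.≤ n → n ℕ.^ 2 ℕ.+ 9 ℕ.* n ℕ.≤ n ℕ.^ 3
  n²+9n≤n³ n 4≤n = begin
    -- From 9 ≤ 12 ≤ 3 n. At n = 3 the inequality fails, whence the bound 4.
    n ℕ.^ 2 ℕ.+ 9 ℕ.* n                 ≤⟨ ℕ.+-monoʳ-≤ (n ℕ.^ 2) (ℕ.*-monoˡ-≤ n (ℕ.≤-trans (ℕ.m≤n+m 9 3) (ℕ.*-monoʳ-≤ 3 4≤n))) ⟩
    n ℕ.^ 2 ℕ.+ 3 ℕ.* n ℕ.* n           ≡⟨ eq n ⟩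
    4 ℕ.* n ℕ.^ 2                       ≤⟨ ℕ.*-monoˡ-≤ (n ℕ.^ 2) 4≤n ⟩
    n ℕ.* n ℕ.^ 2                       ∎
    where
    open ℕ.≤-Reasoning
    eq : ∀ n → n ℕ.* (n ℕ.* 1) ℕ.+ 3 ℕ.* n ℕ.* n ≡ 4 ℕ.* (n ℕ.* (n ℕ.* 1))
    eq = solve-∀

  -- The hypothesis `ρ-suc` says that passing from `ρ m` to `ρ (suc m)` costs the factor 1 - K / (N
  -- - m); since K / N = u, this is close to t.
  module _
    {n N K : ℕ} (0<K : 0 ℕ.< K) (K≤N∸m : ∀ {m} → m ℕ.≤ 9 ℕ.* n → K ℕ.≤ N ∸ m)
    {u} (0≤u : 0ℚ ≤ u) (u≤1 : u ≤ 1ℚ) (nu≡1 : ι n * u ≡ 1ℚ) (ιN*u : ι N * u ≡ ι K) (ιK*u² : ι K * (u * u) ≡ 1ℚ)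
    (ρ : ℕ → ℚ) (ρ₀ : ρ 0 ≡ 1ℚ) (0≤ρ : ∀ m → 0ℚ ≤ ρ m) (ρ≤1 : ∀ m → ρ m ≤ 1ℚ)
    (ρ-suc : ∀ M m → N ∸ m ≡ suc M → ι (suc M) * ρ (suc m) + ι K * ρ m ≡ ι (suc M) * ρ m)
    where

    private
      t = 1ℚ - u

      0≤t : 0ℚ ≤ t
      0≤t = x≤y⇒0≤y-x u≤1
      t≤1 : t ≤ 1ℚ
      t≤1 = 1-x≤1 0≤u

      ιm*u≤9 : ∀ {m} → m ℕ.≤ 9 ℕ.* n → ι m * u ≤ ι 9
      ιm*u≤9 {m} m≤9n = begin
        ι m * u             ≤⟨ *-monoʳ 0≤u (ι-mono m≤9n) ⟩
        ι (9 ℕ.* n) * u     ≡⟨ cong (_* u) (ι-* 9 n) ⟩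
        ι 9 * ι n * u       ≡⟨ *-assoc (ι 9) (ι n) u ⟩
        ι 9 * (ι n * u)     ≡⟨ cong (ι 9 *_) nu≡1 ⟩
        ι 9 * 1ℚ            ≡⟨ *-identityʳ (ι 9) ⟩
        ι 9                 ∎
        where open ≤-Reasoning

      -- M (ρ (m + 1) - t ρ m) = - u m ρ m for M = N - m, since u N = K.
      ρ-step : ∀ m → m ℕ.≤ 9 ℕ.* n → ∣ ρ (suc m) - t * ρ m ∣ ≤ ι 9 * (u * u)
      ρ-step m m≤9n = go (N ∸ m) refl (K≤N∸m m≤9n)
        where
        go : ∀ M → N ∸ m ≡ M → K ℕ.≤ M → ∣ ρ (suc m) - t * ρ m ∣ ≤ ι 9 * (u * u)
        go zero    eq K≤0 with () ← ℕ.≤-trans 0<K K≤0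
        go (suc M) eq K≤M = begin
          ∣ δ ∣                         ≡⟨ *-identityʳ ∣ δ ∣ ⟨
          -- Instead of dividing by `suc M`, the factor 1 = K u² is enlarged to (M + 1) u², which
          -- brings out the multiple of `δ` computed in `scaled`.
          ∣ δ ∣ * 1ℚ                    ≡⟨ cong (∣ δ ∣ *_) ιK*u² ⟨
          ∣ δ ∣ * (ι K * (u * u))       ≤⟨ *-monoˡ (0≤∣p∣ δ) (*-monoʳ (0≤* 0≤u 0≤u) (ι-mono K≤M)) ⟩
          ∣ δ ∣ * (ι (suc M) * (u * u)) ≡⟨ solve 3 (λ d m u → d :* (m :* (u :* u)) := m :* d :* (u :* u)) refl ∣ δ ∣ (ι (suc M)) u ⟩
          ι (suc M) * ∣ δ ∣ * (u * u)   ≡⟨ cong (λ x → x * ∣ δ ∣ * (u * u)) (0≤p⇒∣p∣≡p (0≤ι (suc M))) ⟨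
          ∣ ι (suc M) ∣ * ∣ δ ∣ * (u * u) ≡⟨ cong (_* (u * u)) (∣p*q∣≡∣p∣*∣q∣ (ι (suc M)) δ) ⟨
          ∣ ι (suc M) * δ ∣ * (u * u)   ≡⟨ cong (λ x → ∣ x ∣ * (u * u)) scaled ⟩
          ∣ - (ι m * u * ρ m) ∣ * (u * u) ≡⟨ cong (_* (u * u)) (∣-p∣≡∣p∣ (ι m * u * ρ m)) ⟩
          ∣ ι m * u * ρ m ∣ * (u * u)   ≤⟨ *-monoʳ (0≤* 0≤u 0≤u) (∣*∣≤ {a = ι 9} {b = 1ℚ}
                                             (0≤⇒∣∣≤ (0≤* (0≤ι m) 0≤u) (ιm*u≤9 m≤9n)) (0≤⇒∣∣≤ (0≤ρ m) (ρ≤1 m))) ⟩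
          ι 9 * 1ℚ * (u * u)            ≡⟨ cong (_* (u * u)) (*-identityʳ (ι 9)) ⟩
          ι 9 * (u * u)                 ∎
          where
          open ≤-Reasoning
          δ = ρ (suc m) - t * ρ m
          m≤N : m ℕ.≤ N
          m≤N = ℕ.<⇒≤ (ℕ.m∸n≢0⇒n<m λ eq′ → ℕ.1+n≢0 (trans (sym eq) eq′))
          ιN : ι N ≡ ι (suc M) + ι m
          ιN = trans (cong ι (trans (sym (ℕ.m∸n+n≡m m≤N)) (cong (ℕ._+ m) eq))) (ι-+ (suc M) m)
          scaled : ι (suc M) * δ ≡ - (ι m * u * ρ m)
          scaled = begin-equality
            ι (suc M) * (ρ (suc m) - t * ρ m)
              ≡⟨ solve 5 (λ M a k u b → M :* (a :- (con 1ℚ :- u) :* b)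
                   := (M :* a :+ k :* b) :+ (:- (k :* b :+ M :* b :- M :* u :* b))) refl
                   (ι (suc M)) (ρ (suc m)) (ι K) u (ρ m) ⟩
            (ι (suc M) * ρ (suc m) + ι K * ρ m) - (ι K * ρ m + ι (suc M) * ρ m - ι (suc M) * u * ρ m)
              ≡⟨ cong₂ (λ x k → x - (k * ρ m + ι (suc M) * ρ m - ι (suc M) * u * ρ m)) (ρ-suc M m eq)
                   (trans (sym ιN*u) (cong (_* u) ιN)) ⟩
            ι (suc M) * ρ m - ((ι (suc M) + ι m) * u * ρ m + ι (suc M) * ρ m - ι (suc M) * u * ρ m)
              ≡⟨ solve 4 (λ M m u b → M :* b :- ((M :+ m) :* u :* b :+ M :* b :- M :* u :* b)
                   := :- (m :* u :* b)) refl (ι (suc M)) (ι m) u (ρ m) ⟩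
            - (ι m * u * ρ m) ∎

      -- One-step errors add up, since multiplication by t does not enlarge the earlier ones.
      ρ≈t^ : ∀ m → m ℕ.≤ 9 ℕ.* n → ∣ ρ m - t ^ m ∣ ≤ ι m * (ι 9 * (u * u))
      ρ≈t^ zero    _ = subst (λ x → ∣ x - 1ℚ ∣ ≤ ι 0 * (ι 9 * (u * u))) (sym ρ₀)
        (0≤* (0≤ι 0) (0≤* (0≤ι 9) (0≤* 0≤u 0≤u)))
      ρ≈t^ (suc m) m<9n = begin
        ∣ ρ (suc m) - t ^ suc m ∣
          ≡⟨ cong ∣_∣ (solve 4 (λ a t b p → a :- t :* p := (a :- t :* b) :+ t :* (b :- p)) refl
               (ρ (suc m)) t (ρ m) (t ^ m)) ⟩
        ∣ (ρ (suc m) - t * ρ m) + t * (ρ m - t ^ m) ∣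
          ≤⟨ ∣+∣≤ (ρ-step m m≤9n) (∣*∣≤ {a = 1ℚ} (0≤⇒∣∣≤ 0≤t t≤1) (ρ≈t^ m m≤9n)) ⟩
        ε + 1ℚ * (ι m * ε)
          ≡⟨ solve 2 (λ e m → e :+ con 1ℚ :* (m :* e) := m :* e :+ e) refl ε (ι m) ⟩
        ι m * ε + ε
          ≡⟨ ι-suc* m ε ⟨
        ι (suc m) * ε ∎
        where
        open ≤-Reasoning
        ε = ι 9 * (u * u)
        m≤9n = ℕ.<⇒≤ m<9n

      t^≈t^[+5] : ∀ m → ∣ t ^ m - t ^ (5 ℕ.+ m) ∣ ≤ ι 5 * u
      t^≈t^[+5] m = begin
        ∣ t ^ m - t ^ (5 ℕ.+ m) ∣
          ≡⟨ cong ∣_∣ (cong (λ x → t ^ m - x) (^-homo-* t 5 m)) ⟩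
        ∣ t ^ m - t ^ 5 * t ^ m ∣
          ≡⟨ cong ∣_∣ (solve 2 (λ p q → p :- q :* p := p :* (con 1ℚ :- q)) refl (t ^ m) (t ^ 5)) ⟩
        ∣ t ^ m * (1ℚ - t ^ 5) ∣
          ≤⟨ ∣*∣≤ {a = 1ℚ} (0≤⇒∣∣≤ (0≤^ m 0≤t) (^≤1 m 0≤t t≤1))
               (0≤⇒∣∣≤ (x≤y⇒0≤y-x (^≤1 5 0≤t t≤1)) (+-monoʳ-≤ 1ℚ (neg-antimono-≤ (bernoulli 5 0≤u u≤1)))) ⟩
        1ℚ * (1ℚ - (1ℚ - ι 5 * u))
          ≡⟨ solve 1 (λ u → con 1ℚ :* (con 1ℚ :- (con 1ℚ :- κ 5 :* u)) := κ 5 :* u) refl u ⟩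
        ι 5 * u ∎
        where open ≤-Reasoning

    -- 86 = 9 · 9 + 5: m errors of 9 u² with m u at most 9, and 5 u for shifting the exponent.
    decay≈t^[+5] : ∀ m → m ℕ.≤ 9 ℕ.* n → ∣ ρ m - t ^ (5 ℕ.+ m) ∣ ≤ ι 86 * u
    decay≈t^[+5] m m≤9n = begin
      ∣ ρ m - t ^ (5 ℕ.+ m) ∣
        ≤⟨ ∣x-z∣≤ (ρ m) (t ^ m) (t ^ (5 ℕ.+ m)) (ρ≈t^ m m≤9n) (t^≈t^[+5] m) ⟩
      ι m * (ι 9 * (u * u)) + ι 5 * u
        ≡⟨ solve 2 (λ m u → m :* (κ 9 :* (u :* u)) :+ κ 5 :* u := (m :* u) :* (κ 9 :* u) :+ κ 5 :* u) refl (ι m) u ⟩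
      ι m * u * (ι 9 * u) + ι 5 * u
        ≤⟨ +-monoˡ-≤ (ι 5 * u) (*-monoʳ (0≤* (0≤ι 9) 0≤u) (ιm*u≤9 m≤9n)) ⟩
      ι 9 * (ι 9 * u) + ι 5 * u
        ≡⟨ solve 1 (λ u → κ 9 :* (κ 9 :* u) :+ κ 5 :* u := κ 86 :* u) refl u ⟩
      ι 86 * u ∎
      where open ≤-Reasoning

  module _
    (n : ℕ) (4≤n : 4 ℕ.≤ n)
    {u} (0≤u : 0ℚ ≤ u) (u≤1 : u ≤ 1ℚ) (nu≡1 : ι n * u ≡ 1ℚ)
    {r} (0≤r : 0ℚ ≤ r) (r-inverse : ι (n ℕ.^ 3 C n ℕ.^ 2) * r ≡ 1ℚ)
    where

    private
      N = n ℕ.^ 3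
      K = n ℕ.^ 2

    -- the probability that m given spaces are all free
    ρ : ℕ → ℚ
    ρ m = ι ((N ∸ m) C K) * r

    private
      0≤ρ : ∀ m → 0ℚ ≤ ρ m
      0≤ρ m = 0≤* (0≤ι ((N ∸ m) C K)) 0≤r

      ρ≤1 : ∀ m → ρ m ≤ 1ℚ
      ρ≤1 m = subst (ρ m ≤_) r-inverse
        (*-monoʳ 0≤r (ι-mono (C-mono K (ℕ.≤⇒≤′ (ℕ.m∸n≤m N m)))))

      ρ-suc : ∀ M m → N ∸ m ≡ suc M → ι (suc M) * ρ (suc m) + ι K * ρ m ≡ ι (suc M) * ρ m
      ρ-suc M m eq = begin
        ι (suc M) * ρ (suc m) + ι K * ρ m
          ≡⟨ cong₂ (λ x y → ι (suc M) * x + ι K * y) ρ[1+m]≡ ρ[m]≡ ⟩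
        ι (suc M) * (ι (M C K) * r) + ι K * (ι (suc M C K) * r)
          ≡⟨ solve 5 (λ a b c d r → a :* (b :* r) :+ c :* (d :* r) := (a :* b :+ c :* d) :* r) refl
               (ι (suc M)) (ι (M C K)) (ι K) (ι (suc M C K)) r ⟩
        (ι (suc M) * ι (M C K) + ι K * ι (suc M C K)) * r
          ≡⟨ cong (_* r) (cong₂ _+_ (ι-* (suc M) (M C K)) (ι-* K (suc M C K))) ⟨
        (ι (suc M ℕ.* (M C K)) + ι (K ℕ.* (suc M C K))) * r
          ≡⟨ cong (_* r) (ι-+ (suc M ℕ.* (M C K)) (K ℕ.* (suc M C K))) ⟨
        ι (suc M ℕ.* (M C K) ℕ.+ K ℕ.* (suc M C K)) * r
          ≡⟨ cong (λ x → ι x * r) ([1+n]*nCk+k*[1+n]Ck M K) ⟩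
        ι (suc M ℕ.* (suc M C K)) * r
          ≡⟨ cong (_* r) (ι-* (suc M) (suc M C K)) ⟩
        ι (suc M) * ι (suc M C K) * r
          ≡⟨ *-assoc (ι (suc M)) _ r ⟩
        ι (suc M) * (ι (suc M C K) * r)
          ≡⟨ cong (ι (suc M) *_) ρ[m]≡ ⟨
        ι (suc M) * ρ m ∎
        where
        open ≡-Reasoning
        ρ[m]≡ : ρ m ≡ ι (suc M C K) * r
        ρ[m]≡ = cong (λ x → ι (x C K) * r) eq
        ρ[1+m]≡ : ρ (suc m) ≡ ι (M C K) * r
        ρ[1+m]≡ = cong (λ x → ι (x C K) * r)
          (trans (sym (ℕ.pred[m∸n]≡m∸[1+n] N m)) (cong ℕ.pred eq))

      ιN*u : ι N * u ≡ ι K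
      ιN*u = begin
        ι (n ℕ.^ 3) * u         ≡⟨ cong (_* u) (ι-* n K) ⟩
        ι n * ι K * u           ≡⟨ solve 3 (λ n k u → n :* k :* u := (n :* u) :* k) refl (ι n) (ι K) u ⟩
        ι n * u * ι K           ≡⟨ cong (_* ι K) nu≡1 ⟩
        1ℚ * ι K                ≡⟨ *-identityˡ (ι K) ⟩
        ι K                     ∎
        where open ≡-Reasoning

      ιK*u² : ι K * (u * u) ≡ 1ℚ
      ιK*u² = begin
        ι K * (u * u)                 ≡⟨ cong (_* (u * u)) (ι-^ n 2) ⟩
        ι n * (ι n * 1ℚ) * (u * u)    ≡⟨ solve 2 (λ n u → n :* (n :* con 1ℚ) :* (u :* u) := (n :* u) :* (n :* u)) refl (ι n) u ⟩
        ι n * u * (ι n * u)           ≡⟨ cong₂ _*_ nu≡1 nu≡1 ⟩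
        1ℚ                            ∎
        where open ≡-Reasoning

      K≤N∸m : ∀ {m} → m ℕ.≤ 9 ℕ.* n → K ℕ.≤ N ∸ m
      K≤N∸m {m} m≤9n = begin
        K                     ≡⟨ ℕ.m+n∸n≡m K (9 ℕ.* n) ⟨
        K ℕ.+ 9 ℕ.* n ∸ 9 ℕ.* n ≤⟨ ℕ.∸-mono (n²+9n≤n³ n 4≤n) m≤9n ⟩
        N ∸ m                 ∎
        where open ℕ.≤-Reasoning

    ρ≈t^[+5] : ∀ m → m ℕ.≤ 9 ℕ.* n → ∣ ρ m - (1ℚ - u) ^ (5 ℕ.+ m) ∣ ≤ ι 86 * u
    ρ≈t^[+5] = decay≈t^[+5] {n} {N} {K} (ℕ.*-mono-≤ 1≤n (ℕ.*-mono-≤ 1≤n (ℕ.≤-refl {1}))) K≤N∸m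
      0≤u u≤1 nu≡1 ιN*u ιK*u² ρ r-inverse 0≤ρ ρ≤1 ρ-suc
      where
      1≤n : 1 ℕ.≤ n
      1≤n = ℕ.≤-trans (s≤s z≤n) 4≤n

-- The expected proportion against the limit.

module Proportion where

  open import Data.Fin.Base using (Fin; zero; suc)
  import Data.Integer.Base as ℤ
  open import Data.List.Base using (map; length)
  open import Data.Nat.Base as ℕ using (ℕ; zero; suc; _∸_)
  open import Data.Nat.Combinatorics using (_C_)
  open import Data.Nat.ListAction using () renaming (sum to sumˡ)
  import Data.Nat.Properties as ℕ
  open import Data.Rational.Base hiding (_⊓_)
  open import Data.Rational.Properties
  open import Data.Rational.Solver using (module +-*-Solver)
  open import Relation.Binary.PropositionalEquality
  open import Function.Base using (_∘_)
  open import Algebra.Bundles using (CommutativeRing)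
  open import Algebra.Properties.Semiring.Sum (CommutativeRing.semiring +-*-commutativeRing)
    using (*-distribˡ-sum; *-distribʳ-sum)
  open import Defs using (expSum; expSum-mono; recip; recip-inverse; apart≢0; configurations;
    configurations≢0; safeCount; expectedSafeCount; expectedSafeProportion)
  open Sums
  open Sums.FiniteSums ℕ.+-0-commutativeMonoid using () renaming (∑ to ∑ℕ)
  open Geometry using (attackers; attackers≤; attackers-overlaps; overlaps; overlapsAt; count-configurations; total-safe)
  open Exponential using ([1-u]^n≈1/expSum)
  open LayerSums
  open Recurrence
  open FreeSpaces using (ρ≈t^[+5])
  open +-*-Solver
  open Rationals

  ι-∑ : ∀ n (f : Fin n → ℕ) → ι (∑ℕ f) ≡ ∑ (ι ∘ f)
  ι-∑ zero    f = refl
  ι-∑ (suc n) f = trans (ι-+ (f zero) _) (cong (ι (f zero) +_) (ι-∑ n (f ∘ suc)))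

  ∑-close : ∀ n (f g : Fin n → ℚ) {ε} → (∀ i → ∣ f i - g i ∣ ≤ ε) → ∣ ∑ f - ∑ g ∣ ≤ ι n * ε
  ∑-close zero    f g {ε} h = ≤-reflexive (sym (*-zeroˡ ε))
  ∑-close (suc n) f g {ε} h = begin
    ∣ (f zero + ∑ f′) - (g zero + ∑ g′) ∣
      ≡⟨ cong ∣_∣ (solve 4 (λ a b c d → (a :+ b) :- (c :+ d) := (a :- c) :+ (b :- d)) refl (f zero) (∑ f′) (g zero) (∑ g′)) ⟩
    ∣ (f zero - g zero) + (∑ f′ - ∑ g′) ∣
      ≤⟨ ∣+∣≤ (h zero) (∑-close n f′ g′ (h ∘ suc)) ⟩
    ε + ι n * ε
      ≡⟨ solve 2 (λ e n → e :+ n :* e := (κ 1 :+ n) :* e) refl ε (ι n) ⟩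
    (ι 1 + ι n) * ε
      ≡⟨ cong (_* ε) (ι-+ 1 n) ⟨
    ι (suc n) * ε ∎
    where
    open ≤-Reasoning
    f′ = f ∘ suc
    g′ = g ∘ suc

  /≡ι*1/ : ∀ a b .{{_ : ℕ.NonZero b}} → ℤ.+ a / b ≡ ι a * (ℤ.+ 1 / b)
  /≡ι*1/ a b = begin
    ℤ.+ a / b                         ≡⟨ *-identityʳ (ℤ.+ a / b) ⟨
    (ℤ.+ a / b) * 1ℚ                  ≡⟨ cong ((ℤ.+ a / b) *_) (/-*ι 1 b) ⟨
    (ℤ.+ a / b) * ((ℤ.+ 1 / b) * ι b) ≡⟨ solve 3 (λ x y z → x :* (y :* z) := x :* z :* y) refl (ℤ.+ a / b) (ℤ.+ 1 / b) (ι b) ⟩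
    (ℤ.+ a / b) * ι b * (ℤ.+ 1 / b)   ≡⟨ cong (_* (ℤ.+ 1 / b)) (/-*ι a b) ⟩
    ι a * (ℤ.+ 1 / b)                 ∎
    where open ≡-Reasoning

  ^-lipschitz : ∀ k {x y} → ∣ x ∣ ≤ 1ℚ → ∣ y ∣ ≤ 1ℚ → ∣ x ^ k - y ^ k ∣ ≤ ι k * ∣ x - y ∣
  ^-lipschitz zero    {x} {y} _ _ = ≤-reflexive (sym (*-zeroˡ ∣ x - y ∣))
  ^-lipschitz (suc k) {x} {y} hx hy = begin
    ∣ x * x ^ k - y * y ^ k ∣
      ≡⟨ cong ∣_∣ (solve 4 (λ x y p q → x :* p :- y :* q := x :* (p :- q) :+ (x :- y) :* q) refl x y (x ^ k) (y ^ k)) ⟩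
    ∣ x * (x ^ k - y ^ k) + (x - y) * y ^ k ∣
      ≤⟨ ∣+∣≤ (∣*∣≤ {a = 1ℚ} hx (^-lipschitz k hx hy)) (∣*∣≤ {x - y} {b = 1ℚ} ≤-refl (∣^∣≤1 k)) ⟩
    1ℚ * (ι k * ∣ x - y ∣) + ∣ x - y ∣ * 1ℚ
      ≡⟨ solve 2 (λ k d → con 1ℚ :* (k :* d) :+ d :* con 1ℚ := (κ 1 :+ k) :* d) refl (ι k) ∣ x - y ∣ ⟩
    (ι 1 + ι k) * ∣ x - y ∣
      ≡⟨ cong (_* ∣ x - y ∣) (ι-+ 1 k) ⟨
    ι (suc k) * ∣ x - y ∣ ∎
    where
    open ≤-Reasoning
    ∣^∣≤1 : ∀ k → ∣ y ^ k ∣ ≤ 1ℚ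
    ∣^∣≤1 zero    = ≤-refl
    ∣^∣≤1 (suc k) = ∣*∣≤ {a = 1ℚ} {b = 1ℚ} hy (∣^∣≤1 k)

  -- three times the limiting proportion, in terms of w = 1/e
  limitPoly : ℚ → ℚ
  limitPoly w = w ^ 6 * (ι 9 * w - ι 2 - w * w * w)

  limitPoly-lipschitz : ∀ {x y d} → ∣ x ∣ ≤ 1ℚ → ∣ y ∣ ≤ 1ℚ → ∣ x - y ∣ ≤ d →
    ∣ limitPoly x - limitPoly y ∣ ≤ ι 84 * d
  limitPoly-lipschitz {x} {y} {d} hx hy h = begin
    ∣ limitPoly x - limitPoly y ∣
      ≡⟨ cong ∣_∣ (solve 4 (λ x p y q →
           p :* (κ 9 :* x :- κ 2 :- x :* x :* x) :- q :* (κ 9 :* y :- κ 2 :- y :* y :* y)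
           := κ 9 :* (x :* p :- y :* q) :- κ 2 :* (p :- q) :- (x :* (x :* (x :* p)) :- y :* (y :* (y :* q)))) refl
           x (x ^ 6) y (y ^ 6)) ⟩
    ∣ ι 9 * (x ^ 7 - y ^ 7) - ι 2 * (x ^ 6 - y ^ 6) - (x ^ 9 - y ^ 9) ∣
      -- The powers 7, 6 and 9 with coefficients 9, 2 and 1 give the constant 84 = 63 + 12 + 9.
      ≤⟨ ∣-∣≤ (∣-∣≤ (∣*∣≤ (∣ι∣≤ 9) (^-lipschitz 7 hx hy)) (∣*∣≤ (∣ι∣≤ 2) (^-lipschitz 6 hx hy))) (^-lipschitz 9 hx hy) ⟩
    ι 9 * (ι 7 * ∣ x - y ∣) + ι 2 * (ι 6 * ∣ x - y ∣) + ι 9 * ∣ x - y ∣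
      ≡⟨ solve 1 (λ d → κ 9 :* (κ 7 :* d) :+ κ 2 :* (κ 6 :* d) :+ κ 9 :* d := κ 84 :* d) refl ∣ x - y ∣ ⟩
    ι 84 * ∣ x - y ∣
      ≤⟨ *-monoˡ (0≤ι 84) h ⟩
    ι 84 * d ∎
    where open ≤-Reasoning

  1≤expSum : ∀ j → 1ℚ ≤ expSum j
  1≤expSum j = expSum-mono {0} {j} (ℕ.≤⇒≤′ ℕ.z≤n)

  -- The target real at an index where the series for e has partial sum `E`. The shape, `recip`
  -- included, follows the operations on reals, so that the two agree by computation.
  limitTerm : ℚ → ℚ
  limitTerm E = (- ι 1 + ι 9 * E ^ 2 - ι 2 * E ^ 3) * recip (ι 3 * E ^ 9)

  3*limitTerm : ∀ E w → 1ℚ ≤ E → E * w ≡ 1ℚ → ι 3 * limitTerm E ≡ limitPoly w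
  3*limitTerm E w 1≤E Ew≡1 = begin
    ι 3 * (num * c)
      ≡⟨ *-identityʳ _ ⟨
    ι 3 * (num * c) * 1ℚ ^ 9
      ≡⟨ cong (λ p → ι 3 * (num * c) * p ^ 9) Ew≡1 ⟨
    ι 3 * (num * c) * (E * w) ^ 9
      -- Of (E w)⁹, the part E⁹ completes the denominator for `recip-inverse`, and w⁹ is shared out
      -- over the numerator so that every remaining E is paired with a w.
      ≡⟨ solve 3 (λ E w c →
           κ 3 :* ((:- κ 1 :+ κ 9 :* E :^ 2 :- κ 2 :* E :^ 3) :* c) :* (E :* w) :^ 9
           := κ 3 :* E :^ 9 :* c :* (w :^ 6 :* (κ 9 :* w :* (E :* w) :^ 2 :- κ 2 :* (E :* w) :^ 3 :- w :* w :* w))) refl E w c ⟩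
    ι 3 * E ^ 9 * c * (w ^ 6 * (ι 9 * w * (E * w) ^ 2 - ι 2 * (E * w) ^ 3 - w * w * w))
      ≡⟨ cong₂ (λ x p → x * (w ^ 6 * (ι 9 * w * p ^ 2 - ι 2 * p ^ 3 - w * w * w))) (recip-inverse 3E⁹≢0) Ew≡1 ⟩
    1ℚ * (w ^ 6 * (ι 9 * w * 1ℚ ^ 2 - ι 2 * 1ℚ ^ 3 - w * w * w))
      ≡⟨ solve 2 (λ w p → con 1ℚ :* (p :* (κ 9 :* w :* con 1ℚ :- κ 2 :* con 1ℚ :- w :* w :* w))
           := p :* (κ 9 :* w :- κ 2 :- w :* w :* w)) refl w (w ^ 6) ⟩
    limitPoly w ∎
    where
    open ≡-Reasoning
    num = - ι 1 + ι 9 * E ^ 2 - ι 2 * E ^ 3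
    c = recip (ι 3 * E ^ 9)
    3E⁹≢0 : ι 3 * E ^ 9 ≢ 0ℚ
    3E⁹≢0 = apart≢0 (positive⁻¹ 1ℚ) (≤-trans (*-mono {1ℚ} {ι 3} {1ℚ} {E ^ 9} (nonNegative⁻¹ 1ℚ)
      (0≤^ 9 (≤-trans (nonNegative⁻¹ 1ℚ) 1≤E)) (ι-mono {1} {3} (ℕ.s≤s ℕ.z≤n)) (1≤^ 9 1≤E))
      (x≤∣x∣ (ι 3 * E ^ 9)))

  module _ (n : ℕ) .{{_ : ℕ.NonZero n}} where

    private
      N = n ℕ.^ 3
      u = ℤ.+ 1 / n
      t = 1ℚ - u
      q = t * t
      τ = t ^ n
      r = (ℤ.+ 1 / length (configurations n)) {{configurations≢0 n}}

    0≤1/n : 0ℚ ≤ u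
    0≤1/n = nonNegative⁻¹ u {{normalize-nonNeg 1 n}}

    n*1/n : ι n * u ≡ 1ℚ
    n*1/n = trans (*-comm (ι n) u) (/-*ι 1 n)

    1/n≤1 : u ≤ 1ℚ
    1/n≤1 = begin
      u         ≡⟨ *-identityˡ u ⟨
      ι 1 * u   ≤⟨ *-monoʳ 0≤1/n (ι-mono (ℕ.>-nonZero⁻¹ n)) ⟩
      ι n * u   ≡⟨ n*1/n ⟩
      1ℚ        ∎
      where open ≤-Reasoning

    private
      0≤r : 0ℚ ≤ r
      0≤r = nonNegative⁻¹ r {{normalize-nonNeg 1 (length (configurations n)) {{configurations≢0 n}}}}

      r-inverse : ι (N C n ℕ.^ 2) * r ≡ 1ℚ
      r-inverse = trans (cong (λ k → ι k * r) (sym (count-configurations n)))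
        (trans (*-comm (ι (length (configurations n))) r)
               (/-*ι 1 (length (configurations n)) {{configurations≢0 n}}))

      ιN*u³ : ι N * (u * u * u) ≡ 1ℚ
      ιN*u³ = begin
        ι N * (u * u * u)                             ≡⟨ cong (_* (u * u * u)) (ι-^ n 3) ⟩
        ι n ^ 3 * (u * u * u)                         ≡⟨ solve 2 (λ n u → n :^ 3 :* (u :* u :* u) := (n :* u) :^ 3) refl (ι n) u ⟩
        (ι n * u) ^ 3                                 ≡⟨ cong (_^ 3) n*1/n ⟩
        1ℚ                                            ∎
        where open ≡-Reasoning

      1/N≡u³ : (ℤ.+ 1 / N) {{ℕ.m^n≢0 n 3}} ≡ u * u * u
      1/N≡u³ = begin
        v                         ≡⟨ *-identityʳ v ⟨
        v * 1ℚ                    ≡⟨ cong (v *_) ιN*u³ ⟨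
        v * (ι N * (u * u * u))   ≡⟨ *-assoc v (ι N) (u * u * u) ⟨
        v * ι N * (u * u * u)     ≡⟨ cong (_* (u * u * u)) (/-*ι 1 N {{ℕ.m^n≢0 n 3}}) ⟩
        1ℚ * (u * u * u)          ≡⟨ *-identityˡ (u * u * u) ⟩
        u * u * u                 ∎
        where
        open ≡-Reasoning
        v = (ℤ.+ 1 / N) {{ℕ.m^n≢0 n 3}}

      expected≡∑ : expectedSafeCount n ≡ ∑ {N} λ x → ι ((N ∸ attackers n x) C n ℕ.^ 2) * r
      expected≡∑ = begin
        expectedSafeCount n
          ≡⟨ /≡ι*1/ (sumˡ (map (safeCount n) (configurations n))) (length (configurations n)) {{configurations≢0 n}} ⟩
        ι (sumˡ (map (safeCount n) (configurations n))) * r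
          ≡⟨ cong (λ s → ι s * r) (total-safe n) ⟩
        ι (∑ℕ λ x → (N ∸ attackers n x) C n ℕ.^ 2) * r
          ≡⟨ cong (_* r) (ι-∑ N (λ x → (N ∸ attackers n x) C n ℕ.^ 2)) ⟩
        ∑ {N} (λ x → ι ((N ∸ attackers n x) C n ℕ.^ 2)) * r
          ≡⟨ *-distribʳ-sum {N} r (λ x → ι ((N ∸ attackers n x) C n ℕ.^ 2)) ⟩
        ∑ {N} (λ x → ι ((N ∸ attackers n x) C n ℕ.^ 2) * r) ∎
        where open ≡-Reasoning

      t^-attackers : ∀ x → t ^ (5 ℕ.+ attackers n x) ≡ τ ^ 6 * q ^ overlapsAt n x
      t^-attackers x = begin
        t ^ (5 ℕ.+ attackers n x)
          ≡⟨ cong (t ^_) (trans (ℕ.+-comm 5 (attackers n x)) (attackers-overlaps n x)) ⟩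
        t ^ (6 ℕ.* n ℕ.+ 2 ℕ.* o)
          ≡⟨ ^-homo-* t (6 ℕ.* n) (2 ℕ.* o) ⟩
        t ^ (6 ℕ.* n) * t ^ (2 ℕ.* o)
          ≡⟨ cong₂ _*_ (trans (cong (t ^_) (ℕ.*-comm 6 n)) (sym (^-assocʳ t n 6)))
                       (trans (sym (^-assocʳ t 2 o)) (cong (λ s → (t * s) ^ o) (*-identityʳ t))) ⟩
        τ ^ 6 * q ^ o ∎
        where
        open ≡-Reasoning
        o = overlapsAt n x

      ∑t^-attackers : ∑ {N} (λ x → t ^ (5 ℕ.+ attackers n x)) ≡ τ ^ 6 * layerSum₃ q n
      ∑t^-attackers = trans (sum-cong-≗ {N} t^-attackers) (trans
        (∑-cube n (λ i j k → τ ^ 6 * q ^ overlaps i j k))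
        (sym (trans (*-distribˡ-sum {n} (τ ^ 6) (λ i → ∑ {n} λ j → ∑ {n} λ k → q ^ overlaps i j k))
          (sum-cong-≗ {n} λ i → trans (*-distribˡ-sum {n} (τ ^ 6) (λ j → ∑ {n} λ k → q ^ overlaps i j k))
            (sum-cong-≗ {n} λ j → *-distribˡ-sum {n} (τ ^ 6) (λ k → q ^ overlaps i j k))))))

      0≤t : 0ℚ ≤ t
      0≤t = x≤y⇒0≤y-x 1/n≤1

      t≤1 : t ≤ 1ℚ
      t≤1 = 1-x≤1 0≤1/n

      ∣τ∣≤1 : ∣ τ ∣ ≤ 1ℚ
      ∣τ∣≤1 = 0≤⇒∣∣≤ (0≤^ n 0≤t) (^≤1 n 0≤t t≤1)

      -- p ≈ u³ Σ t^(m + 5) = u³ τ⁶ G and 3 u³ G ≈ 9 τ - 2 - τ³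
      3*proportion≈ : 4 ℕ.≤ n → ∣ ι 3 * expectedSafeProportion n - limitPoly τ ∣ ≤ ι 2258 * u
      3*proportion≈ 4≤n = begin
        ∣ ι 3 * expectedSafeProportion n - limitPoly τ ∣
          ≡⟨ cong (λ p → ∣ ι 3 * p - limitPoly τ ∣) (cong₂ _*_ expected≡∑ 1/N≡u³) ⟩
        ∣ ι 3 * (P * (u * u * u)) - limitPoly τ ∣
          ≡⟨ cong ∣_∣ (solve 5 (λ P u T G l → κ 3 :* (P :* (u :* u :* u)) :- T :* l
               := κ 3 :* ((P :- T :* G) :* (u :* u :* u)) :+ T :* (κ 3 :* (u :* u :* u) :* G :- l)) refl
               P u (τ ^ 6) G (ι 9 * τ - ι 2 - τ * τ * τ)) ⟩
        ∣ ι 3 * ((P - τ ^ 6 * G) * (u * u * u)) + τ ^ 6 * (ι 3 * (u * u * u) * G - (ι 9 * τ - ι 2 - τ * τ * τ)) ∣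
          ≤⟨ ∣+∣≤ (∣*∣≤ (∣ι∣≤ 3) (∣*∣≤ P≈ (0≤⇒∣∣≤ 0≤u³ ≤-refl)))
               (∣*∣≤ {a = 1ℚ} (0≤⇒∣∣≤ (0≤^ 6 (0≤^ n 0≤t)) (^≤1 6 (0≤^ n 0≤t) (^≤1 n 0≤t t≤1))) G≈) ⟩
        ι 3 * (ι N * (ι 86 * u) * (u * u * u)) + 1ℚ * (ι 2000 * u)
          -- 258 = 3 · 86: the errors of the N spaces are averaged with weight u³ = 1 / N.
          ≡⟨ solve 2 (λ N u → κ 3 :* (N :* (κ 86 :* u) :* (u :* u :* u)) :+ con 1ℚ :* (κ 2000 :* u)
               := κ 258 :* u :* (N :* (u :* u :* u)) :+ κ 2000 :* u) refl (ι N) u ⟩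
        ι 258 * u * (ι N * (u * u * u)) + ι 2000 * u
          ≡⟨ cong (λ x → ι 258 * u * x + ι 2000 * u) ιN*u³ ⟩
        ι 258 * u * 1ℚ + ι 2000 * u
          ≡⟨ solve 1 (λ u → κ 258 :* u :* con 1ℚ :+ κ 2000 :* u := κ 2258 :* u) refl u ⟩
        ι 2258 * u ∎
        where
        open ≤-Reasoning
        P = ∑ {N} λ x → ι ((N ∸ attackers n x) C n ℕ.^ 2) * r
        G = layerSum₃ q n
        0≤u³ : 0ℚ ≤ u * u * u
        0≤u³ = 0≤* (0≤* 0≤1/n 0≤1/n) 0≤1/n
        P≈ : ∣ P - τ ^ 6 * G ∣ ≤ ι N * (ι 86 * u)
        P≈ = subst (λ s → ∣ P - s ∣ ≤ ι N * (ι 86 * u)) ∑t^-attackers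
          (∑-close N (λ x → ι ((N ∸ attackers n x) C n ℕ.^ 2) * r) (λ x → t ^ (5 ℕ.+ attackers n x))
            λ x → ρ≈t^[+5] n 4≤n 0≤1/n 1/n≤1 n*1/n 0≤r r-inverse (attackers n x) (attackers≤ n x))
        G≈ : ∣ ι 3 * (u * u * u) * G - (ι 9 * τ - ι 2 - τ * τ * τ) ∣ ≤ ι 2000 * u
        G≈ = recurrence-limit 0≤1/n 1/n≤1 (layerSum₂ q) (layerSum₃ q)
          -- Both sums evaluate to 0 on the empty board and to q⁰ = 1 on the board of side 1.
          refl refl (layerSum₂-suc² q) refl refl (layerSum₃-suc² q) n n*1/n

    proportion≈ : 4 ℕ.≤ n → ∀ j → n ℕ.≤ j →
      ∣ expectedSafeProportion n - limitTerm (expSum j) ∣ ≤ ι 2342 * u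
    proportion≈ 4≤n j n≤j = begin
      ∣ p - l ∣
        -- The estimates concern three times the proportion; enlarging the distance to its triple
        -- saves a division.
        ≤⟨ x≤x+y (0≤* (0≤ι 2) (0≤∣p∣ (p - l))) ⟩
      ∣ p - l ∣ + ι 2 * ∣ p - l ∣
        ≡⟨ solve 1 (λ d → d :+ κ 2 :* d := κ 3 :* d) refl ∣ p - l ∣ ⟩
      ι 3 * ∣ p - l ∣
        ≡⟨ ∣p*q∣≡∣p∣*∣q∣ (ι 3) (p - l) ⟨
      ∣ ι 3 * (p - l) ∣
        ≡⟨ cong ∣_∣ (solve 2 (λ p l → κ 3 :* (p :- l) := κ 3 :* p :- κ 3 :* l) refl p l) ⟩
      ∣ ι 3 * p - ι 3 * l ∣
        ≡⟨ cong (λ x → ∣ ι 3 * p - x ∣) (3*limitTerm E w (1≤expSum j) Ew≡1) ⟩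
      ∣ ι 3 * p - limitPoly w ∣
        ≤⟨ ∣x-z∣≤ (ι 3 * p) (limitPoly τ) (limitPoly w) (3*proportion≈ 4≤n)
             (limitPoly-lipschitz ∣τ∣≤1 (0≤⇒∣∣≤ 0≤w w≤1)
               ([1-u]^n≈1/expSum n j n≤j 0≤1/n 1/n≤1 n*1/n 0≤w w≤1 Ew≡1)) ⟩
      ι 2258 * u + ι 84 * u
        ≡⟨ solve 1 (λ u → κ 2258 :* u :+ κ 84 :* u := κ 2342 :* u) refl u ⟩
      ι 2342 * u ∎
      where
      open ≤-Reasoning
      E = expSum j
      p = expectedSafeProportion n
      l = limitTerm E
      instance
        E-pos : Positive E
        E-pos = positive (<-≤-trans (positive⁻¹ 1ℚ) (1≤expSum j))
        E-nonZero : NonZero E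
        E-nonZero = pos⇒nonZero E
      w = 1/ E
      Ew≡1 : E * w ≡ 1ℚ
      Ew≡1 = *-inverseʳ E
      0≤w : 0ℚ ≤ w
      0≤w = <⇒≤ (positive⁻¹ w {{1/pos⇒pos E}})
      w≤1 : w ≤ 1ℚ
      w≤1 = subst₂ _≤_ (*-identityˡ w) Ew≡1 (*-monoʳ 0≤w (1≤expSum j))

-- Passage to the limit.

open import Data.Nat.Base as ℕ using (suc)
import Data.Integer.Base as ℤ
import Data.Nat.Properties as ℕ
import Data.Rational.Base as ℚ
import Data.Rational.Properties as ℚ
open import Data.Product.Base using (_,_)
open import Defs

mainTheorem7 :
    (λ n → fromℚ (expectedSafeProportion n))
      ⟶ (- fromℕ 1 + fromℕ 9 * e ^ 2 - fromℕ 2 * e ^ 3) ÷ (fromℕ 3 * e ^ 9)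
mainTheorem7 ε (mk< g g>0 M bound) =
  -- 2343 = 2342 + 1: beyond the error 2342 u, one more u is reserved for the gap that `_<_` on
  -- reals demands.
  let κ = ℤ.+ 1 ℚ./ 2343
      k , unit<gκ = archimedean (g ℚ.* κ) (ℚ.positive⁻¹ _
        {{ℚ.pos*pos⇒pos g {{ℚ.positive g>0}} κ}})
  -- The 4 makes n² + 9 n ≤ n³ available; `suc k` gives u ≤ `unitFraction k`.
  in 4 ℕ.+ suc k , λ n N≤n →
    let u = ℤ.+ 1 ℚ./ n
    -- From index `n` on, the series for e has enough terms for the comparison with τ; from `M` on,
    -- `ε` exceeds its gap `g`.
    in mk< u (ℚ.positive⁻¹ u {{ℚ.normalize-pos 1 n}}) (n ℕ.+ M) λ j n+M≤j → begin
      ℚ.∣ expectedSafeProportion n ℚ.- limitTerm (expSum j) ∣ ℚ.+ u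
        ≤⟨ ℚ.+-monoˡ-≤ u (proportion≈ n (ℕ.≤-trans (ℕ.m≤m+n 4 (suc k)) N≤n) j
             (ℕ.≤-trans (ℕ.m≤m+n n M) n+M≤j)) ⟩
      ι 2342 ℚ.* u ℚ.+ u
        ≡⟨ ι-suc* 2342 u ⟨
      ι 2343 ℚ.* u
        ≤⟨ *-monoˡ (0≤ι 2343) (1/-anti (ℕ.≤-trans (ℕ.m≤n+m (suc k) 4) N≤n)) ⟩
      ι 2343 ℚ.* unitFraction k
        ≤⟨ *-monoˡ (0≤ι 2343) (ℚ.<⇒≤ unit<gκ) ⟩
      ι 2343 ℚ.* (g ℚ.* κ)
        -- The sum with `ι 0` is the form of the left side of `bound`: a term of `0ℝ` plus the gap.
        ≡⟨ solve 1 (λ g → con (ι 2343) :* (g :* con κ) := con (ι 0) :+ g) refl g ⟩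
      ι 0 ℚ.+ g
        ≤⟨ bound j (ℕ.≤-trans (ℕ.m≤n+m M n) n+M≤j) ⟩
      seq ε j ∎
  where
  open import Data.Rational.Solver using (module +-*-Solver)
  open import Relation.Binary.PropositionalEquality using (refl)
  open +-*-Solver using (solve; con; _:*_; _:+_; _:=_)
  open ℚ.≤-Reasoning
  open Rationals using (ι; 0≤ι; *-monoˡ; 1/-anti)
  open Exponential using (ι-suc*)
  open Proportion using (limitTerm; proportion≈)
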